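{- Let $m\le 158$ be a positive integer, let $C$ be an extremal binary doubly even self-dual $[24m+8,12m+4,4m+4]$ code, and for $w\equiv0\pmod 4$ with $4m+4\le w\le 24m+8-(4m+4)$ let $D_w$ be the support design of $C$ of weight $w$. (1)(i) Let $w\neq 12m+4$. If $D_w$ is a $6$-design, then $m=58$. If $D_w$ is a $7$-design, then $m=58$. (1)(ii) If $D_{12m+4}$ is a $6$-design, then $D_{12m+4}$ is a $7$-design and $m=58$. (2) For no such $w$ is $D_w$ an $8$-design.
   Context: A binary doubly even self-dual code of length $n$ is a binary linear code $C\subseteq\mathbb{F}_2^n$ with $C=C^\perp$ such that every codeword has Hamming weight divisible by $4$; it is extremal if its minimum nonzero weight equals $4\lfloor n/24\rfloor+4$. A $t$-design on a point set $X$ is a collection of $k$-subsets (blocks) of $X$ such that every $t$-subset of $X$ lies in the same number of blocks. The support design $D_w$ has point set $\{1,\dots,n\}$ and as blocks the supports $\{i:c_i\ne0\}$ of all codewords $c\in C$ of weight $w$. -}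

module Defs where

open import Data.Bool using (Bool; true; false; _xor_; _∧_)
open import Data.Nat using (ℕ; zero; suc; _+_; _*_; _≤_; _<_)
open import Data.Nat.DivMod using (_/_)
open import Data.Nat.Divisibility using (_∣_)
open import Data.Vec using (Vec; []; _∷_; zipWith; replicate; foldr)
open import Data.List using (List; []; _∷_; map; _++_; filter; length)
open import Data.Product using (Σ; _×_; ∃-syntax)
open import Relation.Binary.PropositionalEquality using (_≡_)
open import Relation.Nullary using (Dec; yes; no)
open import Relation.Nullary.Decidable using (_×-dec_)
open import Data.Nat.Properties using (_≟_)
open import Data.Fin.Subset using (Subset; _⊆_; ∣_∣)
open import Data.Fin.Subset.Properties using (_⊆?_)

-- A binary word of length n is a Vec Bool n (= Subset n); its support
-- {i : c_i ≠ 0} is the word itself read as a subset of Fin n.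
Word : ℕ → Set
Word n = Vec Bool n

support : ∀ {n} → Word n → Subset n
support c = c

wt : ∀ {n} → Word n → ℕ
wt c = ∣ support c ∣

_⊕_ : ∀ {n} → Word n → Word n → Word n
_⊕_ = zipWith _xor_

zeroWord : ∀ n → Word n
zeroWord n = replicate n false

dot : ∀ {n} → Word n → Word n → Bool
dot x y = foldr (λ _ → Bool) _xor_ false (zipWith _∧_ x y)

Code : ℕ → Set
Code n = Word n → Bool

_∈C_ : ∀ {n} → Word n → Code n → Set
c ∈C C = C c ≡ true

IsLinear : ∀ {n} → Code n → Set
IsLinear {n} C = (zeroWord n ∈C C) × (∀ x y → x ∈C C → y ∈C C → (x ⊕ y) ∈C C)

_∈Dual_ : ∀ {n} → Word n → Code n → Set
x ∈Dual C = ∀ c → c ∈C C → dot x c ≡ false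

IsSelfDual : ∀ {n} → Code n → Set
IsSelfDual C = ∀ x → (x ∈C C → x ∈Dual C) × (x ∈Dual C → x ∈C C)

IsDoublyEven : ∀ {n} → Code n → Set
IsDoublyEven C = ∀ c → c ∈C C → 4 ∣ wt c

MinWeight : ∀ {n} → Code n → ℕ → Set
MinWeight C d = (∃[ c ] (c ∈C C × 0 < wt c × wt c ≡ d))
              × (∀ c → c ∈C C → 0 < wt c → d ≤ wt c)

IsExtremal : ∀ {n} → Code n → Set
IsExtremal {n} C = MinWeight C (4 * (n / 24) + 4)

IsDESD : ∀ {n} → Code n → Set
IsDESD C = IsLinear C × IsSelfDual C × IsDoublyEven C

allWords : ∀ n → List (Word n)
allWords zero = [] ∷ []
allWords (suc n) = map (true ∷_) (allWords n) ++ map (false ∷_) (allWords n)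

-- blocks of the support design D_w: supports of the weight-w codewords
-- (distinct binary codewords have distinct supports)
blocks : ∀ {n} → Code n → ℕ → List (Subset n)
blocks {n} C w = map support (filter (λ c → (C c Data.Bool.≟ true) ×-dec (wt c ≟ w)) (allWords n))
  where import Data.Bool

countContaining : ∀ {n} → Code n → ℕ → Subset n → ℕ
countContaining C w T = length (filter (λ B → T ⊆? B) (blocks C w))

IsDesign : ∀ {n} → ℕ → Code n → ℕ → Set
IsDesign {n} t C w = ∃[ λ′ ] (∀ (T : Subset n) → ∣ T ∣ ≡ t → countContaining C w T ≡ λ′)

{-# OPTIONS --safe #-}

-- Let B_w(T) be the number of codewords of weight w containing the t-set T. By the MacWilliams
-- identity Σ_w B_w(T) (1-u)^(w-t) (1+u)^(n-w) is 2^(k-t) Σ_c (-1)^|c∩T| u^|c∖T|, whose first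
-- nonconstant terms come from the codewords of minimum weight d = 4m+4. Put X = (1-u)⁴ and
-- Y = (1+u)⁴, so that Y - X = 8u(1+u²). If D_d is a (t-1)-design, then the differences
-- B_{d+4j}(T) - B_{d+4j}(T′) are the coefficients of a form of degree 4m in X and Y that is
-- divisible by (Y-X)^(4m+4-t) and is determined by the difference at j = 0: for t = 4, 5, 6, 7
-- it is a multiple of (Y-X)^(4m), 0, (Y-X)^(4m-2) (X²+14XY+Y²) and
-- (Y-X)^(4m-3) (X+Y) (X²-34XY+Y²). Hence if one D_w is a 6-design, so is D_d, except when the
-- coefficient at w vanishes; for m ≤ 158 this happens only if m = 4, where D_d is still a 5-design.
--
-- The number of codewords of weight d is a residue of the same identity, in closed form.
-- The integrality of the parameters of D_d leaves m = 20, 58, 90, 113 (not m = 4). Codewords meet evenly, so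
-- for a codeword b the sum over the blocks of C(|b∩c|/2, 6) is an integer as well; this excludes
-- 20, 90 and, with C(|b∩c|/4, 6) or a codeword b of weight 4 mod 8, also 113.
--
-- If D_w is an 8-design then m = 58 and the case t = 8 gives, for all 8-sets T, that
-- 1386 B_d(T) - 229 Σ_{S⊂T, |S|=7} B_d(S) is constant; its average is not an integer.
module Submission where

open import Defs

-- Codewords heavier than d have weight at least d + 4, so in degrees below d + 4 - t only the zero
-- word and the words of weight d count: after division by u^(d-t), four coefficients are known. The
-- quotient form has degree q = t - 4 in X and V = Y - X, hence q + 1 unknown coefficients, the top
-- one being the difference at j = 0. Four equations for the other q suffice exactly up to t = 8;
-- for t = 5 the surplus forces the difference to vanish. With X = x⁴ and Y = y⁴ the factors of
-- degree 2 and 3 are Klein's octahedral forms x⁸ + 14x⁴y⁴ + y⁸ and x¹² - 33x⁸y⁴ - 33x⁴y⁸ + y¹². The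
-- form for t = 7 is antisymmetric in X and Y, so its coefficient at the middle weight 12m + 4 is
-- zero: there a 6-design is a 7-design, but this says nothing about 7-sets in D_d. Hence for t = 8
-- a second parameter appears, the difference of the sums of B_d over 7-subsets. All series are
-- integral: 1 - u, 1 + u and 1 + u² divide 1 - u⁴, whose explicit inverse serves for all of them,
-- and powers of 2 are cancelled at the end.

-- Formal power series over the integers.

module Series where

  open import Algebra.Bundles using (CommutativeRing)
  import Algebra.Solver.Ring as RingSolver
  import Algebra.Solver.Ring.AlmostCommutativeRing as ACR
  open import Data.Integer as ℤ using (ℤ; +_; 0ℤ; 1ℤ)
  import Data.Integer.Properties as ℤ
  open import Data.Integer.Tactic.RingSolver using (solve-∀)
  open import Data.Maybe using (Maybe; just; nothing)
  open import Data.Nat as ℕ using (ℕ; zero; suc)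
  open import Data.Product using (_,_)
  open import Level using (0ℓ)
  import Relation.Binary.Reasoning.Setoid as SetoidReasoning
  open import Relation.Binary.PropositionalEquality as ≡ using (_≡_; _≗_; refl; cong; cong₂)
  open import Relation.Nullary using (yes; no)

  Coefficients : Set
  Coefficients = ℕ → ℤ

  tail : Coefficients → Coefficients
  tail f n = f (suc n)

  infixl 6 _⊞_
  infixl 7 _⊛_

  _⊞_ _⊛_ : Coefficients → Coefficients → Coefficients
  (f ⊞ g) n = f n ℤ.+ g n
  (f ⊛ g) zero    = f 0 ℤ.* g 0
  (f ⊛ g) (suc n) = f 0 ℤ.* g (suc n) ℤ.+ (tail f ⊛ g) n

  constant : ℤ → Coefficients
  constant a zero    = a
  constant a (suc n) = 0ℤ

  ⊛-cong : ∀ {f f′ g g′} → f ≗ f′ → g ≗ g′ → (f ⊛ g) ≗ (f′ ⊛ g′)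
  ⊛-cong p q zero    = cong₂ ℤ._*_ (p 0) (q 0)
  ⊛-cong p q (suc n) =
    cong₂ ℤ._+_ (cong₂ ℤ._*_ (p 0) (q (suc n))) (⊛-cong (λ i → p (suc i)) q n)

  -- The product is defined by peeling off the left factor; commutativity also needs the recursion
  -- that peels off the right one.
  ⊛-sucʳ : ∀ f g n → (f ⊛ g) (suc n) ≡ f (suc n) ℤ.* g 0 ℤ.+ (f ⊛ tail g) n
  ⊛-sucʳ f g zero    = ℤ.+-comm (f 0 ℤ.* g 1) (f 1 ℤ.* g 0)
  ⊛-sucʳ f g (suc n) rewrite ⊛-sucʳ (tail f) g n =
    lemma (f 0 ℤ.* g (suc (suc n))) (f (suc (suc n)) ℤ.* g 0) ((tail f ⊛ tail g) n)
    where
    lemma : ∀ a b c → a ℤ.+ (b ℤ.+ c) ≡ b ℤ.+ (a ℤ.+ c)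
    lemma = solve-∀

  ⊛-comm : ∀ f g → (f ⊛ g) ≗ (g ⊛ f)
  ⊛-comm f g zero    = ℤ.*-comm (f 0) (g 0)
  ⊛-comm f g (suc n) = ≡.trans
    (cong₂ ℤ._+_ (ℤ.*-comm (f 0) (g (suc n))) (⊛-comm (tail f) g n))
    (≡.sym (⊛-sucʳ g f n))

  ⊛-distribʳ : ∀ h f g → ((f ⊞ g) ⊛ h) ≗ ((f ⊛ h) ⊞ (g ⊛ h))
  ⊛-distribʳ h f g zero    = ℤ.*-distribʳ-+ (h 0) (f 0) (g 0)
  ⊛-distribʳ h f g (suc n) rewrite ⊛-distribʳ h (tail f) (tail g) n =
    lemma (f 0) (g 0) (h (suc n)) ((tail f ⊛ h) n) ((tail g ⊛ h) n)
    where
    lemma : ∀ a b c x y →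
      (a ℤ.+ b) ℤ.* c ℤ.+ (x ℤ.+ y) ≡ a ℤ.* c ℤ.+ x ℤ.+ (b ℤ.* c ℤ.+ y)
    lemma = solve-∀

  ⊛-distribˡ : ∀ h f g → (h ⊛ (f ⊞ g)) ≗ ((h ⊛ f) ⊞ (h ⊛ g))
  ⊛-distribˡ h f g n = ≡.trans (⊛-comm h (f ⊞ g) n) (≡.trans (⊛-distribʳ h f g n)
    (cong₂ ℤ._+_ (⊛-comm f h n) (⊛-comm g h n)))

  scale-⊛ : ∀ a f g → ((λ n → a ℤ.* f n) ⊛ g) ≗ (λ n → a ℤ.* (f ⊛ g) n)
  scale-⊛ a f g zero    = ℤ.*-assoc a (f 0) (g 0)
  scale-⊛ a f g (suc n) rewrite scale-⊛ a (tail f) g n =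
    lemma a (f 0) (g (suc n)) ((tail f ⊛ g) n)
    where
    lemma : ∀ a b c x → a ℤ.* b ℤ.* c ℤ.+ a ℤ.* x ≡ a ℤ.* (b ℤ.* c ℤ.+ x)
    lemma = solve-∀

  ⊛-assoc : ∀ f g h → ((f ⊛ g) ⊛ h) ≗ (f ⊛ (g ⊛ h))
  ⊛-assoc f g h zero    = ℤ.*-assoc (f 0) (g 0) (h 0)
  ⊛-assoc f g h (suc n)
    rewrite ⊛-distribʳ h (λ i → f 0 ℤ.* g (suc i)) (tail f ⊛ g) n
          | scale-⊛ (f 0) (tail g) h n
          | ⊛-assoc (tail f) g h n =
    lemma (f 0) (g 0) (h (suc n)) ((tail g ⊛ h) n) ((tail f ⊛ (g ⊛ h)) n)
    where
    lemma : ∀ a b c x y → a ℤ.* b ℤ.* c ℤ.+ (a ℤ.* x ℤ.+ y) ≡ a ℤ.* (b ℤ.* c ℤ.+ x) ℤ.+ y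
    lemma = solve-∀

  zero-⊛ : ∀ f g → (∀ n → f n ≡ 0ℤ) → ∀ n → (f ⊛ g) n ≡ 0ℤ
  zero-⊛ f g f≡0 zero    rewrite f≡0 0 = refl
  zero-⊛ f g f≡0 (suc n) rewrite f≡0 0 | zero-⊛ (tail f) g (λ i → f≡0 (suc i)) n = refl

  constant-⊛ : ∀ a f n → (constant a ⊛ f) n ≡ a ℤ.* f n
  constant-⊛ a f zero    = refl
  constant-⊛ a f (suc n) rewrite zero-⊛ (tail (constant a)) f (λ _ → refl) n = ℤ.+-identityʳ _

  constant0 : ∀ n → constant 0ℤ n ≡ 0ℤ
  constant0 zero    = refl
  constant0 (suc n) = refl

  ⊛-identityˡ : ∀ f → (constant 1ℤ ⊛ f) ≗ f
  ⊛-identityˡ f n = ≡.trans (constant-⊛ 1ℤ f n) (ℤ.*-identityˡ (f n))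

  -- A record without η, so that unification does not unfold the operations.
  record Series : Set where
    no-eta-equality
    field at : Coefficients
  open Series public

  infix 4 _≋_
  record _≋_ (f g : Series) : Set where
    constructor coeffs
    field coeff : at f ≗ at g
  open _≋_ public

  add mul : Series → Series → Series
  at (add f g) = at f ⊞ at g
  at (mul f g) = at f ⊛ at g

  negate : Series → Series
  at (negate f) n = ℤ.- at f n

  const : ℤ → Series
  at (const a) = constant a

  seriesRing : CommutativeRing 0ℓ 0ℓ
  seriesRing = record
    { Carrier = Series
    ; _≈_ = _≋_
    ; _+_ = add
    ; _*_ = mul
    ; -_ = negate
    ; 0# = const 0ℤ
    ; 1# = const 1ℤ
    ; isCommutativeRing = record
      { isRing = record
        { +-isAbelianGroup = record
          { isGroup = record
            { isMonoid = record
              { isSemigroup = record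
                { isMagma = record
                  { isEquivalence = record
                    { refl = coeffs λ _ → refl
                    ; sym = λ p → coeffs λ n → ≡.sym (coeff p n)
                    ; trans = λ p q → coeffs λ n → ≡.trans (coeff p n) (coeff q n)
                    }
                  ; ∙-cong = λ p q → coeffs λ n → cong₂ ℤ._+_ (coeff p n) (coeff q n)
                  }
                ; assoc = λ f g h → coeffs λ n → ℤ.+-assoc (at f n) (at g n) (at h n)
                }
              ; identity =
                  (λ f → coeffs λ n → ≡.trans (cong (ℤ._+ at f n) (constant0 n)) (ℤ.+-identityˡ (at f n)))
                , (λ f → coeffs λ n → ≡.trans (cong (ℤ._+_ (at f n)) (constant0 n)) (ℤ.+-identityʳ (at f n)))
              }
            ; inverse =
                (λ f → coeffs λ n → ≡.trans (ℤ.+-inverseˡ (at f n)) (≡.sym (constant0 n)))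
              , (λ f → coeffs λ n → ≡.trans (ℤ.+-inverseʳ (at f n)) (≡.sym (constant0 n)))
            ; ⁻¹-cong = λ p → coeffs λ n → cong ℤ.-_ (coeff p n)
            }
          ; comm = λ f g → coeffs λ n → ℤ.+-comm (at f n) (at g n)
          }
        ; *-cong = λ p q → coeffs (⊛-cong (coeff p) (coeff q))
        ; *-assoc = λ f g h → coeffs (⊛-assoc (at f) (at g) (at h))
        ; *-identity = (λ f → coeffs (⊛-identityˡ (at f)))
                     , (λ f → coeffs λ n → ≡.trans (⊛-comm (at f) (constant 1ℤ) n) (⊛-identityˡ (at f) n))
        ; distrib = (λ h f g → coeffs (⊛-distribˡ (at h) (at f) (at g)))
                  , (λ h f g → coeffs (⊛-distribʳ (at h) (at f) (at g)))
        }
      ; *-comm = λ f g → coeffs (⊛-comm (at f) (at g))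
      }
    }

  module S = CommutativeRing seriesRing
  module ≋-Reasoning = SetoidReasoning S.setoid

  private
    const-homo : ACR._-Raw-AlmostCommutative⟶_
      (CommutativeRing.rawRing ℤ.+-*-commutativeRing) (ACR.fromCommutativeRing seriesRing)
    const-homo = record
      { ⟦_⟧ = const
      ; +-homo = λ a b → coeffs λ where
          zero    → refl
          (suc n) → refl
      ; *-homo = λ a b → coeffs λ where
          zero    → refl
          (suc n) → ≡.sym (≡.trans (constant-⊛ a (constant b) (suc n)) (ℤ.*-zeroʳ a))
      ; -‿homo = λ a → coeffs λ where
          zero    → refl
          (suc n) → refl
      ; 0-homo = coeffs λ _ → refl
      ; 1-homo = coeffs λ _ → refl
      }

    _const≟_ : ∀ a b → Maybe (const a ≋ const b)
    a const≟ b with a ℤ.≟ b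
    ... | yes refl = just (coeffs λ _ → refl)
    ... | no _     = nothing

  -- Constants are taken from ℤ, where equality is decidable, so that numerals such as `const (+ 8)`
  -- are computed and not treated as atoms.
  module SeriesSolver = RingSolver
    (CommutativeRing.rawRing ℤ.+-*-commutativeRing) (ACR.fromCommutativeRing seriesRing)
    const-homo _const≟_

  const-+ : ∀ a b → const (a ℤ.+ b) ≋ add (const a) (const b)
  const-+ = ACR._-Raw-AlmostCommutative⟶_.+-homo const-homo

  const-* : ∀ a b → const (a ℤ.* b) ≋ mul (const a) (const b)
  const-* = ACR._-Raw-AlmostCommutative⟶_.*-homo const-homo

-- Finite sums and indicator functions.

module Sums where

  open import Algebra.Bundles using (CommutativeRing)
  open import Data.Bool using (Bool; true; false; if_then_else_)
  import Data.Integer as ℤ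
  import Data.Integer.Properties as ℤ
  open import Data.List using (List; []; _∷_; _++_; map; upTo)
  open import Data.List.Properties using (map-applyUpTo)
  open import Data.Nat as ℕ using (ℕ; zero; suc; z≤n; s≤s)
  import Data.Nat.Properties as ℕ
  open import Data.Nat.Properties using (_≟_)
  open import Function using (_∘_)
  open import Relation.Binary.PropositionalEquality as ≡ using (_≡_; refl; cong; sym; trans)
  open import Relation.Nullary using (does)
  open import Level using (Level)
  open Series

  module Sum {c ℓ : Level} (R : CommutativeRing c ℓ) where
    open CommutativeRing R renaming (refl to ≈-refl; sym to ≈-sym; trans to ≈-trans)
    open import Algebra.Properties.CommutativeSemigroup +-commutativeSemigroup using (interchange)

    sum : ∀ {a} {A : Set a} → List A → (A → Carrier) → Carrier
    sum []       f = 0#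
    sum (x ∷ xs) f = f x + sum xs f

    ⟦_⟧ : Bool → Carrier
    ⟦ b ⟧ = if b then 1# else 0#

    module _ {a : Level} {A : Set a} where

      sum-cong : ∀ xs {f g : A → Carrier} → (∀ x → f x ≈ g x) → sum xs f ≈ sum xs g
      sum-cong []       p = ≈-refl
      sum-cong (x ∷ xs) p = +-cong (p x) (sum-cong xs p)

      sum-++ : ∀ xs ys (f : A → Carrier) → sum (xs ++ ys) f ≈ sum xs f + sum ys f
      sum-++ []       ys f = ≈-sym (+-identityˡ _)
      sum-++ (x ∷ xs) ys f = ≈-trans (+-congˡ (sum-++ xs ys f)) (≈-sym (+-assoc _ _ _))

      sum-zero : ∀ xs → sum xs (λ (_ : A) → 0#) ≈ 0#
      sum-zero []       = ≈-refl
      sum-zero (x ∷ xs) = ≈-trans (+-identityˡ _) (sum-zero xs)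

      sum-+ : ∀ xs (f g : A → Carrier) → sum xs (λ x → f x + g x) ≈ sum xs f + sum xs g
      sum-+ []       f g = ≈-sym (+-identityˡ _)
      sum-+ (x ∷ xs) f g = ≈-trans (+-congˡ (sum-+ xs f g)) (interchange _ _ _ _)

      sum-*ˡ : ∀ k xs (f : A → Carrier) → sum xs (λ x → k * f x) ≈ k * sum xs f
      sum-*ˡ k []       f = ≈-sym (zeroʳ k)
      sum-*ˡ k (x ∷ xs) f = ≈-trans (+-congˡ (sum-*ˡ k xs f)) (≈-sym (distribˡ _ _ _))

      sum-*ʳ : ∀ k xs (f : A → Carrier) → sum xs (λ x → f x * k) ≈ sum xs f * k
      sum-*ʳ k xs f = ≈-trans (sum-cong xs (λ x → *-comm (f x) k))
        (≈-trans (sum-*ˡ k xs f) (*-comm k _))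

    sum-map : ∀ {a b} {A : Set a} {B : Set b} (h : A → B) xs (f : B → Carrier) →
      sum (map h xs) f ≡ sum xs (f ∘ h)
    sum-map h []       f = refl
    sum-map h (x ∷ xs) f = cong (f (h x) +_) (sum-map h xs f)

    sum-swap : ∀ {a b} {A : Set a} {B : Set b} xs ys (f : A → B → Carrier) →
      sum xs (λ x → sum ys (f x)) ≈ sum ys (λ y → sum xs (λ x → f x y))
    sum-swap []       ys f = ≈-sym (sum-zero ys)
    sum-swap (x ∷ xs) ys f =
      ≈-trans (+-congˡ (sum-swap xs ys f)) (≈-sym (sum-+ ys (f x) _))

    sum-upTo-suc : ∀ K (f : ℕ → Carrier) → sum (upTo (suc K)) f ≡ f 0 + sum (upTo K) (f ∘ suc)
    sum-upTo-suc K f = cong (f 0 +_) (trans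
      (cong (λ xs → sum xs f) (sym (map-applyUpTo (λ i → i) suc K)))
      (sum-map suc (upTo K) f))

    sum-upTo-cong : ∀ K {f g : ℕ → Carrier} → (∀ i → i ℕ.< K → f i ≈ g i) →
      sum (upTo K) f ≈ sum (upTo K) g
    sum-upTo-cong zero    p = ≈-refl
    sum-upTo-cong (suc K) {f} {g} p
      rewrite sum-upTo-suc K f | sum-upTo-suc K g =
      +-cong (p 0 (s≤s z≤n)) (sum-upTo-cong K (λ i i<K → p (suc i) (s≤s i<K)))

    sum-upTo-+ : ∀ r K (f : ℕ → Carrier) →
      sum (upTo (r ℕ.+ K)) f ≈ sum (upTo r) f + sum (upTo K) (λ i → f (r ℕ.+ i))
    sum-upTo-+ zero    K f = ≈-sym (+-identityˡ _)
    sum-upTo-+ (suc r) K f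
      rewrite sum-upTo-suc (r ℕ.+ K) f | sum-upTo-suc r f =
      ≈-trans (+-congˡ (sum-upTo-+ r K (f ∘ suc))) (≈-sym (+-assoc _ _ _))

    sum-upTo-single : ∀ K i (f : ℕ → Carrier) → i ℕ.< K →
      sum (upTo K) (λ j → ⟦ does (i ≟ j) ⟧ * f j) ≈ f i
    sum-upTo-single (suc K) zero f _
      rewrite sum-upTo-suc K (λ j → ⟦ does (0 ≟ j) ⟧ * f j) =
      ≈-trans (+-cong (*-identityˡ _)
        (≈-trans (sum-cong (upTo K) (λ _ → zeroˡ _)) (sum-zero (upTo K)))) (+-identityʳ _)
    sum-upTo-single (suc K) (suc i) f (s≤s i<K)
      rewrite sum-upTo-suc K (λ j → ⟦ does (suc i ≟ j) ⟧ * f j) =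
      ≈-trans (+-cong (zeroˡ _) (sum-upTo-single K i (f ∘ suc) i<K)) (+-identityˡ _)

  module Sumℤ = Sum ℤ.+-*-commutativeRing
  module SumS = Sum seriesRing

  sum-coeff : ∀ {a} {A : Set a} (xs : List A) f i →
    at (SumS.sum xs f) i ≡ Sumℤ.sum xs (λ x → at (f x) i)
  sum-coeff []       f zero    = refl
  sum-coeff []       f (suc i) = refl
  sum-coeff (x ∷ xs) f i = cong (ℤ._+_ (at (f x) i)) (sum-coeff xs f i)

  const-sum : ∀ {a} {A : Set a} (xs : List A) f →
    const (Sumℤ.sum xs f) ≋ SumS.sum xs (λ x → const (f x))
  const-sum []       f = CommutativeRing.refl seriesRing
  const-sum (x ∷ xs) f = CommutativeRing.trans seriesRing (const-+ (f x) _)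
    (CommutativeRing.+-congˡ seriesRing (const-sum xs f))

  const-⟦⟧ : ∀ b → const Sumℤ.⟦ b ⟧ ≋ SumS.⟦ b ⟧
  const-⟦⟧ true  = CommutativeRing.refl seriesRing
  const-⟦⟧ false = CommutativeRing.refl seriesRing

-- Poisson summation for a self-dual binary code.

module Poisson where

  open import Algebra.Bundles using (CommutativeRing)
  import Data.Bool.Properties as 𝔹
  open import Algebra.Properties.CommutativeSemigroup
    (CommutativeRing.+-commutativeSemigroup 𝔹.xor-∧-commutativeRing) using (interchange)
  open import Data.Bool using (Bool; true; false; _xor_; _∧_)
  open import Data.Integer as ℤ using (ℤ; +_; 0ℤ; 1ℤ; -1ℤ)
  import Data.Integer.Properties as ℤ
  open import Data.Integer.Tactic.RingSolver using (solve-∀)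
  open import Data.List using ([]; _∷_; map)
  open import Data.Nat using (ℕ; zero; suc)
  open import Data.Product using (proj₁; proj₂)
  open import Data.Vec using (Vec; []; _∷_)
  open import Function using (_∘_)
  open import Relation.Binary.PropositionalEquality as ≡ using (_≡_; refl; cong; cong₂; sym; trans)
  open import Relation.Nullary using (yes; no; contradiction)
  open Series
  open Sums

  ⊕-cancelʳ : ∀ {n} (x y : Word n) → (x ⊕ y) ⊕ y ≡ x
  ⊕-cancelʳ []      []      = refl
  ⊕-cancelʳ (a ∷ x) (b ∷ y) = cong₂ _∷_
    (trans (𝔹.xor-assoc a b b) (trans (cong (a xor_) (𝔹.xor-same b)) (𝔹.xor-identityʳ a)))
    (⊕-cancelʳ x y)

  dot-⊕ʳ : ∀ {n} (x y z : Word n) → dot x (y ⊕ z) ≡ dot x y xor dot x z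
  dot-⊕ʳ []      []      []      = refl
  dot-⊕ʳ (a ∷ x) (b ∷ y) (c ∷ z) rewrite dot-⊕ʳ x y z = lemma a b c (dot x y) (dot x z)
    where
    lemma : ∀ a b c p q → (a ∧ (b xor c)) xor (p xor q) ≡ ((a ∧ b) xor p) xor ((a ∧ c) xor q)
    lemma false b c p q = refl
    lemma true  b c p q = interchange b c p q

  -- Translation by `v` permutes the words: its first bit either preserves or exchanges the two
  -- halves of `allWords`.
  sum-⊕ : ∀ {n} (v : Word n) (f : Word n → ℤ) →
    Sumℤ.sum (allWords n) (λ c → f (c ⊕ v)) ≡ Sumℤ.sum (allWords n) f
  sum-⊕ [] f = refl
  sum-⊕ {suc n} (b ∷ v) f
    rewrite Sumℤ.sum-++ (map (true ∷_) (allWords n)) (map (false ∷_) (allWords n)) f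
          | Sumℤ.sum-++ (map (true ∷_) (allWords n)) (map (false ∷_) (allWords n)) (λ c → f (c ⊕ (b ∷ v)))
          | Sumℤ.sum-map (true ∷_) (allWords n) f
          | Sumℤ.sum-map (false ∷_) (allWords n) f
          | Sumℤ.sum-map (true ∷_) (allWords n) (λ c → f (c ⊕ (b ∷ v)))
          | Sumℤ.sum-map (false ∷_) (allWords n) (λ c → f (c ⊕ (b ∷ v)))
          | sum-⊕ v (λ c → f ((true xor b) ∷ c))
          | sum-⊕ v (λ c → f (b ∷ c)) = halves b
    where
    s = λ a → Sumℤ.sum (allWords n) (λ c → f (a ∷ c))
    halves : ∀ b → s (true xor b) ℤ.+ s b ≡ s true ℤ.+ s false
    halves true  = ℤ.+-comm (s false) (s true)
    halves false = refl

  sgn : Bool → ℤ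
  sgn true  = -1ℤ
  sgn false = 1ℤ

  sgn-xor : ∀ a b → sgn (a xor b) ≡ sgn a ℤ.* sgn b
  sgn-xor true  true  = refl
  sgn-xor true  false = refl
  sgn-xor false b     = sym (ℤ.*-identityˡ (sgn b))

  open CommutativeRing seriesRing using (_+_; _*_; _≈_; 1#; 0#)
  open SeriesSolver using (solve; _:=_; _:*_; _:+_; con)

  -- A product function on words. The factors may vary with the coordinate, which is how a set of
  -- points will be marked.
  weight : ∀ {n} → Vec (Bool → Series) n → Word n → Series
  weight []       []      = 1#
  weight (w ∷ ws) (b ∷ x) = w b * weight ws x

  transform : (Bool → Series) → Bool → Series
  transform w b = w false + const (sgn b) * w true

  transforms : ∀ {n} → Vec (Bool → Series) n → Vec (Bool → Series) n
  transforms = Data.Vec.map transform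

  -- The Fourier transform of a product function is the product of the one-coordinate transforms;
  -- induction splits the sum by the first bit.
  weight-transform : ∀ {n} (ws : Vec (Bool → Series) n) c →
    weight (transforms ws) c ≈
    SumS.sum (allWords n) (λ x → const (sgn (dot x c)) * weight ws x)
  weight-transform [] [] = solve 0 (con 1ℤ := con 1ℤ :* con 1ℤ :+ con 0ℤ) S.refl
  weight-transform {suc n} (w ∷ ws) (b ∷ c) = begin
    (w false + const (sgn b) * w true) * weight (transforms ws) c
      ≈⟨ solve 4 (λ f s t u → (f :+ s :* t) :* u := (s :* t) :* u :+ f :* u) S.refl
           (w false) (const (sgn b)) (w true) (weight (transforms ws) c) ⟩
    const (sgn b) * w true * weight (transforms ws) c + w false * weight (transforms ws) c
      ≈⟨ S.+-cong (S.*-congˡ (weight-transform ws c))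
                  (S.*-congˡ (weight-transform ws c)) ⟩
    const (sgn b) * w true * SumS.sum (allWords n) inner + w false * SumS.sum (allWords n) inner
      ≈⟨ S.+-cong (SumS.sum-*ˡ (const (sgn b) * w true) (allWords n) inner)
                  (SumS.sum-*ˡ (w false) (allWords n) inner) ⟨
    SumS.sum (allWords n) (λ x → const (sgn b) * w true * inner x)
      + SumS.sum (allWords n) (λ x → w false * inner x)
      ≈⟨ S.+-cong (SumS.sum-cong (allWords n) on) (SumS.sum-cong (allWords n) off) ⟩
    SumS.sum (allWords n) (outer ∘ (true ∷_)) + SumS.sum (allWords n) (outer ∘ (false ∷_))
      ≡⟨ cong₂ _+_ (SumS.sum-map (true ∷_) (allWords n) outer) (SumS.sum-map (false ∷_) (allWords n) outer) ⟨
    SumS.sum (map (true ∷_) (allWords n)) outer + SumS.sum (map (false ∷_) (allWords n)) outer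
      ≈⟨ SumS.sum-++ (map (true ∷_) (allWords n)) (map (false ∷_) (allWords n)) outer ⟨
    SumS.sum (allWords (suc n)) outer ∎
    where
    open ≋-Reasoning
    inner : Word n → Series
    inner x = const (sgn (dot x c)) * weight ws x
    outer : Word (suc n) → Series
    outer x = const (sgn (dot x (b ∷ c))) * weight (w ∷ ws) x
    on : ∀ x → const (sgn b) * w true * inner x ≈ outer (true ∷ x)
    on x = begin
      const (sgn b) * w true * (const (sgn (dot x c)) * weight ws x)
        ≈⟨ solve 4 (λ s t u v → s :* t :* (u :* v) := s :* u :* (t :* v)) S.refl
             (const (sgn b)) (w true) (const (sgn (dot x c))) (weight ws x) ⟩
      const (sgn b) * const (sgn (dot x c)) * (w true * weight ws x)
        ≈⟨ S.*-congʳ (const-* (sgn b) (sgn (dot x c))) ⟨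
      const (sgn b ℤ.* sgn (dot x c)) * (w true * weight ws x)
        ≡⟨ cong (λ s → const s * (w true * weight ws x)) (sgn-xor b (dot x c)) ⟨
      outer (true ∷ x) ∎
    off : ∀ x → w false * inner x ≈ outer (false ∷ x)
    off x = solve 3 (λ f u v → f :* (u :* v) := u :* (f :* v)) S.refl
      (w false) (const (sgn (dot x c))) (weight ws x)

  module _ {n : ℕ} (C : Code n) (linear : IsLinear C) (selfDual : IsSelfDual C) where

    C-⊕ : ∀ c {v} → v ∈C C → C (c ⊕ v) ≡ C c
    C-⊕ c {v} v∈C with C c in eq | C (c ⊕ v) in eq′
    ... | true  | true  = refl
    ... | false | false = refl
    ... | true  | false = contradiction (trans (sym (proj₂ linear c v eq v∈C)) eq′) (λ ())
    ... | false | true  = contradiction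
      (trans (sym (proj₂ linear (c ⊕ v) v eq′ v∈C)) (trans (cong C (⊕-cancelʳ c v)) eq)) (λ ())

    size : ℤ
    size = Sumℤ.sum (allWords n) (λ c → Sumℤ.⟦ C c ⟧)

    characterSum : Word n → ℤ
    characterSum x = Sumℤ.sum (allWords n) (λ c → Sumℤ.⟦ C c ⟧ ℤ.* sgn (dot x c))

    characterSum-shift : ∀ x {v} → v ∈C C → characterSum x ≡ sgn (dot x v) ℤ.* characterSum x
    characterSum-shift x {v} v∈C = begin
      characterSum x
        ≡⟨ sum-⊕ v _ ⟨
      Sumℤ.sum (allWords n) (λ c → Sumℤ.⟦ C (c ⊕ v) ⟧ ℤ.* sgn (dot x (c ⊕ v)))
        ≡⟨ Sumℤ.sum-cong (allWords n) (λ c → step c) ⟩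
      Sumℤ.sum (allWords n) (λ c → sgn (dot x v) ℤ.* (Sumℤ.⟦ C c ⟧ ℤ.* sgn (dot x c)))
        ≡⟨ Sumℤ.sum-*ˡ (sgn (dot x v)) (allWords n) _ ⟩
      sgn (dot x v) ℤ.* characterSum x ∎
      where
      open ≡.≡-Reasoning
      reorder : ∀ a b c → a ℤ.* (b ℤ.* c) ≡ c ℤ.* (a ℤ.* b)
      reorder = solve-∀
      step : ∀ c → Sumℤ.⟦ C (c ⊕ v) ⟧ ℤ.* sgn (dot x (c ⊕ v)) ≡
        sgn (dot x v) ℤ.* (Sumℤ.⟦ C c ⟧ ℤ.* sgn (dot x c))
      step c rewrite C-⊕ c v∈C | dot-⊕ʳ x c v | sgn-xor (dot x c) (dot x v) =
        reorder Sumℤ.⟦ C c ⟧ (sgn (dot x c)) (sgn (dot x v))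

    -- Inside the code all signs are 1. Outside, no codeword with odd product is searched for: if
    -- the sum were nonzero, `characterSum-shift` would make `x` orthogonal to every codeword, and
    -- self-duality would put it in the code.
    characterSum-∈ : ∀ x → characterSum x ≡ Sumℤ.⟦ C x ⟧ ℤ.* size
    characterSum-∈ x with C x in eq
    ... | true = trans (Sumℤ.sum-cong (allWords n) term) (sym (ℤ.*-identityˡ size))
      where
      term : ∀ c → Sumℤ.⟦ C c ⟧ ℤ.* sgn (dot x c) ≡ Sumℤ.⟦ C c ⟧
      term c with C c in c∈C
      ... | false = refl
      ... | true rewrite proj₁ (selfDual x) eq c c∈C = refl
    ... | false with characterSum x ℤ.≟ 0ℤ
    ...   | yes s≡0 = s≡0
    ...   | no  s≢0 = contradiction (trans (sym (proj₂ (selfDual x) orthogonal)) eq) (λ ())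
      where
      self-negative : ∀ s → s ≡ -1ℤ ℤ.* s → s ≡ 0ℤ
      self-negative (+ zero)    _ = refl
      self-negative (+ (suc _)) ()
      self-negative ℤ.-[1+ _ ]  ()

      orthogonal : x ∈Dual C
      orthogonal v v∈C with dot x v | characterSum-shift x v∈C
      ... | false | _     = refl
      ... | true  | shift = contradiction (self-negative _ shift) s≢0

    -- Exchanging the two sums leaves the character sum over the code, which is supported on the
    -- dual, here the code itself.
    poisson : ∀ (ws : Vec (Bool → Series) n) →
      SumS.sum (allWords n) (λ c → SumS.⟦ C c ⟧ * weight (transforms ws) c) ≈
      const size * SumS.sum (allWords n) (λ x → SumS.⟦ C x ⟧ * weight ws x)
    poisson ws = begin
      SumS.sum W (λ c → SumS.⟦ C c ⟧ * weight (transforms ws) c)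
        ≈⟨ SumS.sum-cong W (λ c → S.trans
             (S.*-congˡ (weight-transform ws c))
             (S.sym (SumS.sum-*ˡ SumS.⟦ C c ⟧ W (λ x → const (sgn (dot x c)) * weight ws x)))) ⟩
      SumS.sum W (λ c → SumS.sum W (λ x → SumS.⟦ C c ⟧ * (const (sgn (dot x c)) * weight ws x)))
        ≈⟨ SumS.sum-swap W W (λ c x → SumS.⟦ C c ⟧ * (const (sgn (dot x c)) * weight ws x)) ⟩
      SumS.sum W (λ x → SumS.sum W (λ c → SumS.⟦ C c ⟧ * (const (sgn (dot x c)) * weight ws x)))
        ≈⟨ SumS.sum-cong W column ⟩
      SumS.sum W (λ x → const size * (SumS.⟦ C x ⟧ * weight ws x))
        ≈⟨ SumS.sum-*ˡ (const size) W (λ x → SumS.⟦ C x ⟧ * weight ws x) ⟩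
      const size * SumS.sum W (λ x → SumS.⟦ C x ⟧ * weight ws x) ∎
      where
      open ≋-Reasoning
      W = allWords n
      column : ∀ x → SumS.sum W (λ c → SumS.⟦ C c ⟧ * (const (sgn (dot x c)) * weight ws x)) ≈
        const size * (SumS.⟦ C x ⟧ * weight ws x)
      column x = begin
        SumS.sum W (λ c → SumS.⟦ C c ⟧ * (const (sgn (dot x c)) * weight ws x))
          ≈⟨ SumS.sum-cong W (λ c → S.trans
               (S.sym (S.*-assoc SumS.⟦ C c ⟧ (const (sgn (dot x c))) (weight ws x)))
               (S.*-congʳ (S.trans
                 (S.*-congʳ (S.sym (const-⟦⟧ (C c))))
                 (S.sym (const-* Sumℤ.⟦ C c ⟧ (sgn (dot x c))))))) ⟩
        SumS.sum W (λ c → const (Sumℤ.⟦ C c ⟧ ℤ.* sgn (dot x c)) * weight ws x)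
          ≈⟨ SumS.sum-*ʳ (weight ws x) W (λ c → const (Sumℤ.⟦ C c ⟧ ℤ.* sgn (dot x c))) ⟩
        SumS.sum W (λ c → const (Sumℤ.⟦ C c ⟧ ℤ.* sgn (dot x c))) * weight ws x
          ≈⟨ S.*-congʳ (const-sum W (λ c → Sumℤ.⟦ C c ⟧ ℤ.* sgn (dot x c))) ⟨
        const (characterSum x) * weight ws x
          ≡⟨ cong (λ s → const s * weight ws x) (characterSum-∈ x) ⟩
        const (Sumℤ.⟦ C x ⟧ ℤ.* size) * weight ws x
          ≈⟨ S.*-congʳ (S.trans (const-* Sumℤ.⟦ C x ⟧ size)
               (S.*-congʳ (const-⟦⟧ (C x)))) ⟩
        SumS.⟦ C x ⟧ * const size * weight ws x
          ≈⟨ solve 3 (λ i s u → i :* s :* u := s :* (i :* u)) S.refl SumS.⟦ C x ⟧ (const size) (weight ws x) ⟩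
        const size * (SumS.⟦ C x ⟧ * weight ws x) ∎

-- Counting subsets and supersets.

module Count where

  open import Data.Bool using (Bool; true; false)
  open import Data.Fin.Subset using (∣_∣; _∩_; ⊤)
  open import Data.Fin.Subset.Properties using (_⊆?_; ⊆-max; ∩-identityʳ; ∣p∩q∣≤∣p∣)
  open import Data.Integer as ℤ using (ℤ; +_; 0ℤ; 1ℤ; _+_; _*_)
  import Data.Integer.Properties as ℤ
  open import Data.Integer.Tactic.RingSolver using (solve-∀)
  open import Data.List using (List; []; _∷_; _++_; map)
  open import Data.List.Relation.Unary.All using (All; []; _∷_)
  import Data.List.Relation.Unary.All as All
  import Data.List.Relation.Unary.All.Properties as All
  open import Data.Nat as ℕ using (ℕ; zero; suc; s≤s)
  open import Data.Nat.Combinatorics using (_C_; nCk+nC[k+1]≡[n+1]C[k+1]; k>n⇒nCk≡0)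
  import Data.Nat.Properties as ℕ
  open import Data.Nat.Properties using (_≟_)
  open import Data.Vec using ([]; _∷_)
  open import Relation.Binary.PropositionalEquality as ≡ using (_≡_; refl; cong; cong₂; sym; trans)
  open import Relation.Nullary using (does)
  open import Relation.Nullary.Decidable using (dec-true)
  open Sums
  open Sumℤ

  infix 4 _⊑_
  _⊑_ : ∀ {n} → Word n → Word n → Bool
  T ⊑ c = does (T ⊆? c)

  weigh : ∀ {n} → ℕ → Word n → ℤ
  weigh w c = ⟦ does (wt c ≟ w) ⟧

  wt-zeroWord : ∀ n → wt (zeroWord n) ≡ 0
  wt-zeroWord zero    = refl
  wt-zeroWord (suc n) = wt-zeroWord n

  zeroWord-⊑ : ∀ {n} (c : Word n) → (zeroWord n ⊑ c) ≡ true
  zeroWord-⊑ []      = refl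
  zeroWord-⊑ (_ ∷ c) = zeroWord-⊑ c

  subsets : ∀ {n} → ℕ → Word n → List (Word n)
  subsets         zero    b           = zeroWord _ ∷ []
  subsets         (suc r) []          = []
  subsets         (suc r) (false ∷ b) = map (false ∷_) (subsets (suc r) b)
  subsets         (suc r) (true ∷ b)  = map (true ∷_) (subsets r b) ++ map (false ∷_) (subsets (suc r) b)

  subsets-wt : ∀ {n} r (b : Word n) → All (λ U → wt U ≡ r) (subsets r b)
  subsets-wt {n} zero b          = wt-zeroWord n ∷ []
  subsets-wt (suc r) []          = []
  subsets-wt (suc r) (false ∷ b) = All.map⁺ (subsets-wt (suc r) b)
  subsets-wt (suc r) (true ∷ b)  = All.++⁺
    (All.map⁺ (All.map (cong suc) (subsets-wt r b))) (All.map⁺ (subsets-wt (suc r) b))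

  pascal : ∀ n k → + (n C k) + + (n C suc k) ≡ + (suc n C suc k)
  pascal n k = cong +_ (nCk+nC[k+1]≡[n+1]C[k+1] n k)

  -- An r-subset of `b` lies in `c` when it lies in the intersection; Pascal's rule drives the
  -- induction.
  sum-subsets-⊑ : ∀ {n} r (b c : Word n) →
    sum (subsets r b) (λ U → ⟦ U ⊑ c ⟧) ≡ + (∣ b ∩ c ∣ C r)
  sum-subsets-⊑ zero b c rewrite zeroWord-⊑ c = refl
  sum-subsets-⊑ (suc r) [] [] = refl
  sum-subsets-⊑ (suc r) (false ∷ b) (x ∷ c)
    rewrite sum-map (false ∷_) (subsets (suc r) b) (λ U → ⟦ U ⊑ (x ∷ c) ⟧) = sum-subsets-⊑ (suc r) b c
  sum-subsets-⊑ (suc r) (true ∷ b) (x ∷ c)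
    rewrite sum-++ (map (true ∷_) (subsets r b)) (map (false ∷_) (subsets (suc r) b)) (λ U → ⟦ U ⊑ (x ∷ c) ⟧)
          | sum-map (true ∷_) (subsets r b) (λ U → ⟦ U ⊑ (x ∷ c) ⟧)
          | sum-map (false ∷_) (subsets (suc r) b) (λ U → ⟦ U ⊑ (x ∷ c) ⟧)
          | sum-subsets-⊑ (suc r) b c = split x
    where
    split : ∀ x → sum (subsets r b) (λ U → ⟦ (true ∷ U) ⊑ (x ∷ c) ⟧) + + (∣ b ∩ c ∣ C suc r)
      ≡ + (∣ (true ∷ b) ∩ (x ∷ c) ∣ C suc r)
    split true rewrite sum-subsets-⊑ r b c = pascal ∣ b ∩ c ∣ r
    split false rewrite sum-zero (subsets r b) = ℤ.+-identityˡ _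

  module _ {n : ℕ} where

    sum-All : ∀ {P : Word n → Set} {xs} (f : Word n → ℤ) k → All P xs →
      (∀ x → P x → f x ≡ k) → sum xs f ≡ k * sum xs (λ _ → 1ℤ)
    sum-All f k []         eq = sym (ℤ.*-zeroʳ k)
    sum-All {xs = x ∷ xs} f k (px ∷ pxs) eq rewrite eq x px | sum-All {xs = xs} f k pxs eq =
      lemma k (sum xs (λ _ → 1ℤ))
      where
      lemma : ∀ k s → k + k * s ≡ k * (1ℤ + s)
      lemma = solve-∀

  sum-subsets-1 : ∀ {n} r (b : Word n) → sum (subsets r b) (λ _ → 1ℤ) ≡ + (∣ b ∣ C r)
  sum-subsets-1 {n} r b = trans
    (sum-cong (subsets r b) (λ U → sym (cong ⟦_⟧ (dec-true (U ⊆? ⊤) (⊆-max U)))))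
    (trans (sum-subsets-⊑ r b ⊤) (cong (λ x → + (∣ x ∣ C r)) (∩-identityʳ b)))

  -- Only extensions by a single point.
  supersets : ∀ {n} → Word n → List (Word n)
  supersets []          = []
  supersets (true ∷ T)  = map (true ∷_) (supersets T)
  supersets (false ∷ T) = (true ∷ T) ∷ map (false ∷_) (supersets T)

  supersets-wt : ∀ {n} (T : Word n) → All (λ U → wt U ≡ suc (wt T)) (supersets T)
  supersets-wt []          = []
  supersets-wt (true ∷ T)  = All.map⁺ (All.map (cong suc) (supersets-wt T))
  supersets-wt (false ∷ T) = refl ∷ All.map⁺ (supersets-wt T)

  sum-supersets-1 : ∀ {n} (T : Word n) → sum (supersets T) (λ _ → 1ℤ) + + wt T ≡ + n
  sum-supersets-1 [] = refl
  sum-supersets-1 {suc n} (true ∷ T) rewrite sum-map (true ∷_) (supersets T) (λ (_ : Word (suc n)) → 1ℤ) =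
    trans (lemma (sum (supersets T) (λ _ → 1ℤ)) (+ wt T)) (cong (_+_ 1ℤ) (sum-supersets-1 T))
    where
    lemma : ∀ a b → a + (1ℤ + b) ≡ 1ℤ + (a + b)
    lemma = solve-∀
  sum-supersets-1 {suc n} (false ∷ T) rewrite sum-map (false ∷_) (supersets T) (λ (_ : Word (suc n)) → 1ℤ) =
    trans (lemma (sum (supersets T) (λ _ → 1ℤ)) (+ wt T)) (cong (_+_ 1ℤ) (sum-supersets-1 T))
    where
    lemma : ∀ a b → 1ℤ + a + b ≡ 1ℤ + (a + b)
    lemma = solve-∀

  -- If `c` contains `T`, each point of `c` outside `T` gives one extension inside `c`. The points
  -- of `T` are counted on the left to avoid a subtraction.
  sum-supersets-⊑ : ∀ {n} (T c : Word n) →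
    sum (supersets T) (λ U → ⟦ U ⊑ c ⟧) + + wt T * ⟦ T ⊑ c ⟧ ≡ + wt c * ⟦ T ⊑ c ⟧
  sum-supersets-⊑ [] [] = refl
  sum-supersets-⊑ (true ∷ T) (true ∷ c) rewrite sum-map (true ∷_) (supersets T) (λ U → ⟦ U ⊑ (true ∷ c) ⟧) =
    trans (lemma (sum (supersets T) (λ U → ⟦ U ⊑ c ⟧)) (+ wt T) ⟦ T ⊑ c ⟧)
      (trans (cong (_+_ (⟦ T ⊑ c ⟧)) (sum-supersets-⊑ T c)) (lemma′ (+ wt c) ⟦ T ⊑ c ⟧))
    where
    lemma : ∀ a b i → a + (1ℤ + b) * i ≡ i + (a + b * i)
    lemma = solve-∀
    lemma′ : ∀ b i → i + b * i ≡ (1ℤ + b) * i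
    lemma′ = solve-∀
  sum-supersets-⊑ (true ∷ T) (false ∷ c) rewrite sum-map (true ∷_) (supersets T) (λ U → ⟦ U ⊑ (false ∷ c) ⟧)
    | sum-zero (supersets T) = trans (ℤ.+-identityˡ _) (trans (ℤ.*-zeroʳ (+ suc (wt T))) (sym (ℤ.*-zeroʳ (+ wt c))))
  sum-supersets-⊑ (false ∷ T) (true ∷ c) rewrite sum-map (false ∷_) (supersets T) (λ U → ⟦ U ⊑ (true ∷ c) ⟧) =
    trans (lemma (sum (supersets T) (λ U → ⟦ U ⊑ c ⟧)) (+ wt T) ⟦ T ⊑ c ⟧)
      (trans (cong (_+_ (⟦ T ⊑ c ⟧)) (sum-supersets-⊑ T c)) (lemma′ (+ wt c) ⟦ T ⊑ c ⟧))
    where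
    lemma : ∀ a b i → i + a + b * i ≡ i + (a + b * i)
    lemma = solve-∀
    lemma′ : ∀ b i → i + b * i ≡ (1ℤ + b) * i
    lemma′ = solve-∀
  sum-supersets-⊑ (false ∷ T) (false ∷ c) rewrite sum-map (false ∷_) (supersets T) (λ U → ⟦ U ⊑ (false ∷ c) ⟧)
    | ℤ.+-identityˡ (sum (supersets T) (λ U → ⟦ U ⊑ c ⟧)) = sum-supersets-⊑ T c

  -- The intersection has at most r points, so the binomial is 1 or 0. This identifies the top
  -- intersection moment of `T` with its block count.
  subset-C : ∀ {n} r (T c : Word n) → wt T ≡ r → + (∣ T ∩ c ∣ C r) ≡ ⟦ T ⊑ c ⟧
  subset-C zero T c wtT = cong ⟦_⟧ (sym (empty-⊑ T c wtT))
    where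
    empty-⊑ : ∀ {n} (T c : Word n) → wt T ≡ 0 → (T ⊑ c) ≡ true
    empty-⊑ []          []      _   = refl
    empty-⊑ (false ∷ T) (_ ∷ c) wtT = empty-⊑ T c wtT
  subset-C (suc r) [] [] ()
  subset-C (suc r) (true ∷ T) (true ∷ c) wtT = trans
    (sym (pascal ∣ T ∩ c ∣ r)) (trans
    (cong₂ _+_ (subset-C r T c (ℕ.suc-injective wtT))
      (cong +_ (k>n⇒nCk≡0 (s≤s (ℕ.≤-trans (∣p∩q∣≤∣p∣ T c) (ℕ.≤-reflexive (ℕ.suc-injective wtT)))))))
    (ℤ.+-identityʳ _))
  subset-C (suc r) (true ∷ T) (false ∷ c) wtT =
    cong +_ (k>n⇒nCk≡0 (s≤s (ℕ.≤-trans (∣p∩q∣≤∣p∣ T c) (ℕ.≤-reflexive (ℕ.suc-injective wtT)))))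
  subset-C (suc r) (false ∷ T) (x ∷ c) wtT = subset-C (suc r) T c wtT

  -- An r-subset of b lies in ∣ b ∣ - r subsets of size r + 1; r C(j, r) is moved to the left to
  -- avoid the subtraction.
  sum-subsets-C : ∀ {n} r (b c : Word n) →
    sum (subsets (suc r) b) (λ T → + (∣ T ∩ c ∣ C r)) + + r * + (∣ b ∩ c ∣ C r)
      ≡ + wt b * + (∣ b ∩ c ∣ C r)
  sum-subsets-C zero [] [] = refl
  sum-subsets-C (suc r) [] [] = trans (ℤ.+-identityˡ _) (ℤ.*-zeroʳ (+ suc r))
  sum-subsets-C r (false ∷ b) (x ∷ c)
    rewrite sum-map (false ∷_) (subsets (suc r) b) (λ T → + (∣ T ∩ (x ∷ c) ∣ C r)) = sum-subsets-C r b c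
  sum-subsets-C r (true ∷ b) (x ∷ c)
    rewrite sum-++ (map (true ∷_) (subsets r b)) (map (false ∷_) (subsets (suc r) b)) (λ T → + (∣ T ∩ (x ∷ c) ∣ C r))
          | sum-map (true ∷_) (subsets r b) (λ T → + (∣ T ∩ (x ∷ c) ∣ C r))
          | sum-map (false ∷_) (subsets (suc r) b) (λ T → + (∣ T ∩ (x ∷ c) ∣ C r)) = split r x
    where
    sum-All-cong : ∀ {n} {P : Word n → Set} {xs} {f g : Word n → ℤ} → All P xs →
      (∀ x → P x → f x ≡ g x) → sum xs f ≡ sum xs g
    sum-All-cong []         eq = refl
    sum-All-cong (px ∷ pxs) eq = cong₂ _+_ (eq _ px) (sum-All-cong pxs eq)

    exact : ∀ r → sum (subsets r b) (λ T → + (∣ T ∩ c ∣ C r)) ≡ + (∣ b ∩ c ∣ C r)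
    exact r = trans (sum-All-cong (subsets-wt r b) (λ T → subset-C r T c)) (sum-subsets-⊑ r b c)

    absorb : ∀ s k r b → s + r * k ≡ b * k → (k + s) + r * k ≡ (1ℤ + b) * k
    absorb s k r b eq = trans (ℤ.+-assoc k s (r * k))
      (trans (cong (_+_ k) eq) (lemma b k))
      where
      lemma : ∀ b k → k + b * k ≡ (1ℤ + b) * k
      lemma = solve-∀

    Below = λ r → sum (subsets (suc r) b) (λ T → + (∣ T ∩ c ∣ C r))

    split : ∀ r x → sum (subsets r b) (λ T → + (∣ (true ∷ T) ∩ (x ∷ c) ∣ C r)) + Below r
        + + r * + (∣ (true ∷ b) ∩ (x ∷ c) ∣ C r)
      ≡ + wt (true ∷ b) * + (∣ (true ∷ b) ∩ (x ∷ c) ∣ C r)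
    split r false rewrite exact r = absorb (Below r) (+ (∣ b ∩ c ∣ C r)) (+ r) (+ wt b) (sum-subsets-C r b c)
    split zero true rewrite sum-subsets-1 0 b =
      absorb (Below 0) 1ℤ 0ℤ (+ wt b) (sum-subsets-C 0 b c)
    split (suc r) true = begin
      sum (subsets (suc r) b) (λ T → + (suc ∣ T ∩ c ∣ C suc r)) + Below (suc r) + + suc r * + (suc j C suc r)
        ≡⟨ cong (λ s → s + Below (suc r) + + suc r * + (suc j C suc r))
             (sum-cong (subsets (suc r) b) (λ T → sym (pascal ∣ T ∩ c ∣ r))) ⟩
      sum (subsets (suc r) b) (λ T → + (∣ T ∩ c ∣ C r) + + (∣ T ∩ c ∣ C suc r)) + Below (suc r) + + suc r * + (suc j C suc r)
        ≡⟨ cong (λ s → s + Below (suc r) + + suc r * + (suc j C suc r))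
             (trans (sum-+ (subsets (suc r) b) _ _) (cong (_+_ (Below r)) (exact (suc r)))) ⟩
      Below r + + (j C suc r) + Below (suc r) + + suc r * + (suc j C suc r)
        ≡⟨ cong (λ s → Below r + + (j C suc r) + Below (suc r) + + suc r * s) (sym (pascal j r)) ⟩
      Below r + + (j C suc r) + Below (suc r) + + suc r * (+ (j C r) + + (j C suc r))
        ≡⟨ regroup (Below r) (+ (j C suc r)) (Below (suc r)) (+ r) (+ (j C r)) ⟩
      (Below r + + r * + (j C r)) + (Below (suc r) + + suc r * + (j C suc r)) + (+ (j C r) + + (j C suc r))
        ≡⟨ cong₂ (λ s t → s + t + (+ (j C r) + + (j C suc r))) (sum-subsets-C r b c) (sum-subsets-C (suc r) b c) ⟩
      + wt b * + (j C r) + + wt b * + (j C suc r) + (+ (j C r) + + (j C suc r))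
        ≡⟨ collect (+ wt b) (+ (j C r)) (+ (j C suc r)) ⟩
      (1ℤ + + wt b) * (+ (j C r) + + (j C suc r))
        ≡⟨ cong ((1ℤ + + wt b) *_) (pascal j r) ⟩
      + suc (wt b) * + (suc j C suc r) ∎
      where
      open ≡.≡-Reasoning
      j = ∣ b ∩ c ∣
      regroup : ∀ p u q r v → p + u + q + (1ℤ + r) * (v + u) ≡
        (p + r * v) + (q + (1ℤ + r) * u) + (v + u)
      regroup = solve-∀
      collect : ∀ b u v → b * u + b * v + (u + v) ≡ (1ℤ + b) * (u + v)
      collect = solve-∀

-- Block counts, intersection moments and designs.

module Design where

  open import Data.Bool using (true; false)
  import Data.Bool.Properties as 𝔹
  open import Data.Fin.Subset using (∣_∣; _∩_; ⊤)
  open import Data.Fin.Subset.Properties using (_⊆?_; ∩-identityˡ; ∣⊤∣≡n)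
  open import Data.Integer as ℤ using (ℤ; +_; 0ℤ; 1ℤ; _+_; _*_; _-_)
  import Data.Integer.Properties as ℤ
  open import Data.Integer.Tactic.RingSolver using (solve-∀)
  open import Data.List using (List; []; _∷_; map; filter; length)
  open import Data.List.Relation.Unary.All using ([]; _∷_)
  open import Data.Nat as ℕ using (ℕ; zero; suc; z≤n; s≤s)
  open import Data.Nat.Combinatorics using (_C_)
  import Data.Nat.Properties as ℕ
  open import Data.Nat.Properties using (_≟_)
  open import Data.Product using (_,_)
  open import Data.Vec using ([]; _∷_)
  open import Relation.Binary.PropositionalEquality as ≡ using (_≡_; _≢_; refl; cong; cong₂; sym; trans)
  open import Relation.Nullary using (does; yes; no)
  open import Relation.Nullary.Decidable using (_×-dec_; dec-false)
  open Sums
  open Count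
  open Sumℤ

  -- A reference s-set, at which design parameters are read off.
  prefix : ℕ → ∀ n → Word n
  prefix zero    n       = zeroWord n
  prefix (suc s) zero    = []
  prefix (suc s) (suc n) = true ∷ prefix s n

  prefix-wt : ∀ {s n} → s ℕ.≤ n → wt (prefix s n) ≡ s
  prefix-wt {n = n} z≤n = wt-zeroWord n
  prefix-wt (s≤s s≤n)   = cong suc (prefix-wt s≤n)

  module _ {n : ℕ} (𝒞 : Code n) where

    total : ℕ → (Word n → ℤ) → ℤ
    total w f = sum (allWords n) (λ c → ⟦ 𝒞 c ⟧ * (weigh w c * f c))

    total-cong : ∀ w {f g} → (∀ c → c ∈C 𝒞 → wt c ≡ w → f c ≡ g c) → total w f ≡ total w g
    total-cong w {f} {g} eq = sum-cong (allWords n) term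
      where
      term : ∀ c → ⟦ 𝒞 c ⟧ * (weigh w c * f c) ≡ ⟦ 𝒞 c ⟧ * (weigh w c * g c)
      term c with 𝒞 c in c∈C
      ... | false = refl
      ... | true with wt c ≟ w
      ...   | no wt≢w  rewrite dec-false (wt c ≟ w) wt≢w = refl
      ...   | yes wt≡w rewrite eq c c∈C wt≡w = refl

    total-* : ∀ w k f → total w (λ c → k * f c) ≡ k * total w f
    total-* w k f = trans
      (sum-cong (allWords n) (λ c → lemma ⟦ 𝒞 c ⟧ (weigh w c) k (f c))) (sum-*ˡ k (allWords n) _)
      where
      lemma : ∀ a b k x → a * (b * (k * x)) ≡ k * (a * (b * x))
      lemma = solve-∀

    total-+ : ∀ w f g → total w (λ c → f c + g c) ≡ total w f + total w g
    total-+ w f g = trans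
      (sum-cong (allWords n) (λ c → lemma ⟦ 𝒞 c ⟧ (weigh w c) (f c) (g c))) (sum-+ (allWords n) _ _)
      where
      lemma : ∀ a b x y → a * (b * (x + y)) ≡ a * (b * x) + a * (b * y)
      lemma = solve-∀

    total-sum : ∀ {A : Set} w (xs : List A) (f : A → Word n → ℤ) →
      total w (λ c → sum xs (λ x → f x c)) ≡ sum xs (λ x → total w (f x))
    total-sum w xs f = trans
      (sum-cong (allWords n) (λ c → trans
        (cong (⟦ 𝒞 c ⟧ *_) (sym (sum-*ˡ (weigh w c) xs (λ x → f x c))))
        (sym (sum-*ˡ ⟦ 𝒞 c ⟧ xs _))))
      (sum-swap (allWords n) xs (λ c x → ⟦ 𝒞 c ⟧ * (weigh w c * f x c)))

    B : ℕ → Word n → ℤ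
    B w T = total w (λ c → ⟦ T ⊑ c ⟧)

    -- Binomial moments of the intersections of `b` with the words of weight `w`. If these form an
    -- s-design, the value depends on `wt b` alone; at `s = wt b` it is the block count `B`.
    β : ℕ → ℕ → Word n → ℤ
    β w s b = total w (λ c → + (∣ b ∩ c ∣ C s))

    -- The design property as pairwise equality, without naming the constant, so that it follows
    -- from vanishing differences.
    Balanced : ℕ → ℕ → Set
    Balanced w s = ∀ T T′ → wt T ≡ s → wt T′ ≡ s → B w T ≡ B w T′

    count≡B : ∀ w T → + countContaining 𝒞 w T ≡ B w T
    count≡B w T = go (allWords n)
      where
      go : ∀ xs → + length (filter (λ U → T ⊆? U)
        (map support (filter (λ c → (𝒞 c 𝔹.≟ true) ×-dec (wt c ≟ w)) xs)))
        ≡ sum xs (λ c → ⟦ 𝒞 c ⟧ * (weigh w c * ⟦ T ⊑ c ⟧))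
      go [] = refl
      -- `does (wt c ≟ w)` reduces to this Boolean test, so abstracting it evaluates the filter and
      -- the indicator together.
      go (c ∷ xs) with 𝒞 c | wt c ℕ.≡ᵇ w
      ... | false | _     = trans (go xs) (sym (ℤ.+-identityˡ _))
      ... | true  | false = trans (go xs) (sym (ℤ.+-identityˡ _))
      ... | true  | true with does (T ⊆? c)
      ...   | true  = cong (_+_ 1ℤ) (go xs)
      ...   | false = trans (go xs) (sym (ℤ.+-identityˡ _))

    design⇒balanced : ∀ {w s} → IsDesign s 𝒞 w → Balanced w s
    design⇒balanced {w} (λ′ , eq) T T′ T≡s T′≡s =
      trans (sym (count≡B w T)) (trans (cong +_ (trans (eq T T≡s) (sym (eq T′ T′≡s)))) (count≡B w T′))

    balanced⇒design : ∀ {w s} → s ℕ.≤ n → Balanced w s → IsDesign s 𝒞 w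
    balanced⇒design {w} {s} s≤n bal = countContaining 𝒞 w (prefix s n) , λ T T≡s →
      ℤ.+-injective (trans (count≡B w T)
        (trans (bal T (prefix s n) T≡s (prefix-wt s≤n)) (sym (count≡B w (prefix s n)))))

    β-subsets : ∀ w s b → β w s b ≡ sum (subsets s b) (B w)
    β-subsets w s b = trans (total-cong w (λ c _ _ → sym (sum-subsets-⊑ s b c)))
      (total-sum w (subsets s b) (λ U c → ⟦ U ⊑ c ⟧))

    -- The parameter λ_s, once `Balanced w s` is known.
    index : ℕ → ℕ → ℤ
    index w s = B w (prefix s n)

    β-balanced : ∀ {w s} → Balanced w s → s ℕ.≤ n → ∀ b → β w s b ≡ index w s * + (wt b C s)
    β-balanced {w} {s} bal s≤n b = trans (β-subsets w s b) (trans
      (sum-All (B w) (index w s) (subsets-wt s b) (λ U U≡s → bal U (prefix s n) U≡s (prefix-wt s≤n)))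
      (cong (index w s *_) (sum-subsets-1 s b)))

    β-⊤ : ∀ w s → β w s ⊤ ≡ + (w C s) * total w (λ _ → 1ℤ)
    β-⊤ w s = trans (total-cong w (λ c _ wt≡w →
        trans (cong (λ x → + (x C s)) (trans (cong ∣_∣ (∩-identityˡ c)) wt≡w)) (sym (ℤ.*-identityʳ _))))
      (total-* w (+ (w C s)) (λ _ → 1ℤ))

    -- The moment of the whole point set is evaluated in two ways. This is the source of the
    -- integrality conditions on the design parameters.
    index-total : ∀ {w s} → Balanced w s → s ℕ.≤ n →
      index w s * + (n C s) ≡ + (w C s) * total w (λ _ → 1ℤ)
    index-total {w} {s} bal s≤n = trans
      (trans (cong (λ x → index w s * + (x C s)) (sym (∣⊤∣≡n n))) (sym (β-balanced bal s≤n ⊤)))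
      (β-⊤ w s)

    B-supersets : ∀ w T → sum (supersets T) (B w) + + wt T * B w T ≡ + w * B w T
    B-supersets w T = begin
      sum (supersets T) (B w) + + wt T * B w T
        ≡⟨ cong₂ _+_ (total-sum w (supersets T) (λ U c → ⟦ U ⊑ c ⟧)) (total-* w (+ wt T) (λ c → ⟦ T ⊑ c ⟧)) ⟨
      total w (λ c → sum (supersets T) (λ U → ⟦ U ⊑ c ⟧)) + total w (λ c → + wt T * ⟦ T ⊑ c ⟧)
        ≡⟨ total-+ w _ _ ⟨
      total w (λ c → sum (supersets T) (λ U → ⟦ U ⊑ c ⟧) + + wt T * ⟦ T ⊑ c ⟧)
        ≡⟨ total-cong w (λ c _ wt≡w → trans (sum-supersets-⊑ T c) (cong (λ x → + x * ⟦ T ⊑ c ⟧) wt≡w)) ⟩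
      total w (λ c → + w * ⟦ T ⊑ c ⟧)
        ≡⟨ total-* w (+ w) (λ c → ⟦ T ⊑ c ⟧) ⟩
      + w * B w T ∎
      where open ≡.≡-Reasoning

    -- Counting one-point extensions of `T` inside blocks gives (w - s) B(T) = λ_{s+1} (n - s);
    -- cancelling w - s uses `s < w`.
    balanced-pred : ∀ {w s} → suc s ℕ.≤ n → s ℕ.< w → Balanced w (suc s) → Balanced w s
    balanced-pred {w} {s} s<n s<w bal T T′ T≡s T′≡s =
      ℤ.*-cancelˡ-≡ (+ w - + s) (B w T) (B w T′) {{≢-nonZero w-s≢0}}
        (trans (lower T T≡s) (sym (lower T′ T′≡s)))
      where
      open import Data.Integer.Base using (≢-nonZero)
      w-s≢0 : + w - + s ≢ 0ℤ
      w-s≢0 eq = ℕ.<⇒≢ s<w (sym (ℤ.+-injective (ℤ.i-j≡0⇒i≡j (+ w) (+ s) eq)))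
      isolate : ∀ x s w b → x + s * b ≡ w * b → (w - s) * b ≡ x
      isolate x s w b eq = trans (expand w s b) (trans (cong (_- s * b) (sym eq)) (cancel x (s * b)))
        where
        expand : ∀ w s b → (w - s) * b ≡ w * b - s * b
        expand = solve-∀
        cancel : ∀ x y → x + y - y ≡ x
        cancel = solve-∀
      lower : ∀ T → wt T ≡ s → (+ w - + s) * B w T ≡ index w (suc s) * (+ n - + s)
      lower T refl = trans (isolate _ (+ wt T) (+ w) (B w T) (B-supersets w T)) (trans
        (sum-All (B w) (index w (suc s)) (supersets-wt T)
          (λ U U≡s → bal U (prefix (suc s) n) U≡s (prefix-wt s<n)))
        (cong (index w (suc s) *_) (trans (move (sum (supersets T) (λ _ → 1ℤ)) (+ wt T))
          (cong (_- + wt T) (sum-supersets-1 T)))))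
        where
        move : ∀ x y → x ≡ x + y - y
        move = solve-∀

    -- The double count of `sum-subsets-C`, summed over the blocks. With `b` the whole point set it
    -- averages a moment that need not be constant.
    sum-subsets-β : ∀ w r b →
      sum (subsets (suc r) b) (β w r) + + r * β w r b ≡ + wt b * β w r b
    sum-subsets-β w r b = begin
      sum (subsets (suc r) b) (β w r) + + r * β w r b
        ≡⟨ cong₂ _+_ (total-sum w (subsets (suc r) b) (λ T c → + (∣ T ∩ c ∣ C r)))
                       (total-* w (+ r) (λ c → + (∣ b ∩ c ∣ C r))) ⟨
      total w (λ c → sum (subsets (suc r) b) (λ T → + (∣ T ∩ c ∣ C r)))
        + total w (λ c → + r * + (∣ b ∩ c ∣ C r))
        ≡⟨ total-+ w _ _ ⟨
      total w (λ c → sum (subsets (suc r) b) (λ T → + (∣ T ∩ c ∣ C r)) + + r * + (∣ b ∩ c ∣ C r))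
        ≡⟨ total-cong w (λ c _ _ → sum-subsets-C r b c) ⟩
      total w (λ c → + wt b * + (∣ b ∩ c ∣ C r))
        ≡⟨ total-* w (+ wt b) (λ c → + (∣ b ∩ c ∣ C r)) ⟩
      + wt b * β w r b ∎
      where open ≡.≡-Reasoning

-- The MacWilliams identity for the words containing a given set.

module Enumerator where

  open import Algebra.Bundles using (CommutativeRing)
  open import Data.Bool using (Bool; true; false)
  open import Data.Fin.Subset using (∣_∣; _∩_; ∁)
  open import Data.Integer as ℤ using (ℤ; +_; 0ℤ; 1ℤ; -1ℤ)
  import Data.Integer.Properties as ℤ
  open import Data.List using ([]; _∷_; map)
  open import Data.Nat as ℕ using (ℕ; zero; suc)
  import Data.Nat.Properties as ℕ
  open import Data.Product using (_,_; proj₁; proj₂; ∃-syntax)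
  open import Data.Vec as Vec using (Vec; []; _∷_)
  open import Function using (_∘_)
  open import Relation.Binary.Definitions using (tri<; tri≈; tri>)
  open import Relation.Binary.PropositionalEquality as ≡ using (_≡_; _≢_; refl; cong; cong₂; sym; trans)
  open import Relation.Nullary using (contradiction)
  open Series
  open Sums
  open Poisson
  open Count using (_⊑_; wt-zeroWord; zeroWord-⊑)

  open CommutativeRing seriesRing using (_+_; _*_; _-_; 1#; 0#; commutativeSemiring)
  open SeriesSolver using (solve; _:=_; _:*_; _:+_; _:-_; _:^_; con)
  open import Algebra.Properties.CommutativeSemiring.Exp commutativeSemiring public
    using (_^_; ^-homo-*; ^-distrib-*; ^-congˡ; ^-assocʳ)

  -- `t` is the variable called u above; `M`, `P` and `Z` multiply to 1 - t⁴.
  t M P Z : Series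
  at t 1 = 1ℤ
  at t _ = 0ℤ
  M = 1# - t
  P = 1# + t
  Z = 1# + t * t

  -- The first bit is membership in the marked set. There the word is forced to be 1; elsewhere the
  -- factors are those of the usual weight enumerator transform.
  local : Bool → Bool → Series
  local false false = P
  local false true  = M
  local true  false = 0#
  local true  true  = 1#

  weights : ∀ {n} → Word n → Vec (Bool → Series) n
  weights = Vec.map local

  module _ {N : ℕ} (𝒞 : Code N) (linear : IsLinear 𝒞) (selfDual : IsSelfDual 𝒞) where

    -- On `T` the local factor is 1 where the full weight has `M`; the power `M ^ wt T` restores
    -- these factors.
    weight-local : ∀ {n} (T x : Word n) →
      M ^ wt T * weight (weights T) x ≋ SumS.⟦ T ⊑ x ⟧ * (M ^ wt x * P ^ ∣ ∁ x ∣)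
    weight-local [] [] = solve 0 (con 1ℤ :* con 1ℤ := con 1ℤ :* (con 1ℤ :* con 1ℤ)) S.refl
    weight-local (false ∷ T) (false ∷ x) = S.trans
      (solve 3 (λ a p w → a :* (p :* w) := p :* (a :* w)) S.refl (M ^ wt T) P (weight (weights T) x))
      (S.trans (S.*-congˡ (weight-local T x))
      (solve 4 (λ i p m q → p :* (i :* (m :* q)) := i :* (m :* (p :* q))) S.refl
        SumS.⟦ T ⊑ x ⟧ P (M ^ wt x) (P ^ ∣ ∁ x ∣)))
    weight-local (false ∷ T) (true ∷ x) = S.trans
      (solve 3 (λ a p w → a :* (p :* w) := p :* (a :* w)) S.refl (M ^ wt T) M (weight (weights T) x))
      (S.trans (S.*-congˡ (weight-local T x))
      (solve 4 (λ i p m q → p :* (i :* (m :* q)) := i :* ((p :* m) :* q)) S.refl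
        SumS.⟦ T ⊑ x ⟧ M (M ^ wt x) (P ^ ∣ ∁ x ∣)))
    weight-local (true ∷ T) (false ∷ x) =
      solve 3 (λ m w q → m :* (con 0ℤ :* w) := con 0ℤ :* q) S.refl
        (M ^ suc (wt T)) (weight (weights T) x) (M ^ wt x * (P ^ suc ∣ ∁ x ∣))
    weight-local (true ∷ T) (true ∷ x) = S.trans
      (solve 3 (λ a m w → (m :* a) :* (con 1ℤ :* w) := m :* (a :* w)) S.refl (M ^ wt T) M (weight (weights T) x))
      (S.trans (S.*-congˡ (weight-local T x))
      (solve 4 (λ i p m q → p :* (i :* (m :* q)) := i :* ((p :* m) :* q)) S.refl
        SumS.⟦ T ⊑ x ⟧ M (M ^ wt x) (P ^ ∣ ∁ x ∣)))

    -- The local transforms are 2 and 2t off `T`, since P + M = 2 and P - M = 2t, but 1 and -1 on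
    -- `T`. The extra power of 2 makes the factor 2 uniform over all coordinates.
    weight-transform-local : ∀ {n} (T c : Word n) →
      const (+ 2) ^ wt T * weight (transforms (weights T)) c ≋
      const (+ 2) ^ n * (const -1ℤ ^ ∣ T ∩ c ∣ * t ^ ∣ ∁ T ∩ c ∣)
    weight-transform-local [] [] = solve 0 (con 1ℤ :* con 1ℤ := con 1ℤ :* (con 1ℤ :* con 1ℤ)) S.refl
    weight-transform-local {suc n} (false ∷ T) (false ∷ c) = S.trans
      (solve 3 (λ a w t → a :* ((con 1ℤ :+ t :+ con 1ℤ :* (con 1ℤ :- t)) :* w) := con (+ 2) :* (a :* w)) S.refl
        (const (+ 2) ^ wt T) (weight (transforms (weights T)) c) t)
      (S.trans (S.*-congˡ (weight-transform-local T c)) (S.sym (S.*-assoc _ _ _)))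
    weight-transform-local {suc n} (false ∷ T) (true ∷ c) = S.trans
      (solve 3 (λ a w t → a :* ((con 1ℤ :+ t :+ con -1ℤ :* (con 1ℤ :- t)) :* w) := con (+ 2) :* t :* (a :* w)) S.refl
        (const (+ 2) ^ wt T) (weight (transforms (weights T)) c) t)
      (S.trans (S.*-congˡ (weight-transform-local T c))
      (solve 4 (λ t a s o → con (+ 2) :* t :* (a :* (s :* o)) := con (+ 2) :* a :* (s :* (t :* o))) S.refl
        t (const (+ 2) ^ n) (const -1ℤ ^ ∣ T ∩ c ∣) (t ^ ∣ ∁ T ∩ c ∣)))
    weight-transform-local {suc n} (true ∷ T) (false ∷ c) = S.trans
      (solve 2 (λ a w → con (+ 2) :* a :* ((con 0ℤ :+ con 1ℤ :* con 1ℤ) :* w) := con (+ 2) :* (a :* w)) S.refl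
        (const (+ 2) ^ wt T) (weight (transforms (weights T)) c))
      (S.trans (S.*-congˡ (weight-transform-local T c)) (S.sym (S.*-assoc _ _ _)))
    weight-transform-local {suc n} (true ∷ T) (true ∷ c) = S.trans
      (solve 2 (λ a w → con (+ 2) :* a :* ((con 0ℤ :+ con -1ℤ :* con 1ℤ) :* w) := con (+ 2) :* con -1ℤ :* (a :* w)) S.refl
        (const (+ 2) ^ wt T) (weight (transforms (weights T)) c))
      (S.trans (S.*-congˡ (weight-transform-local T c))
      (solve 3 (λ a s o → con (+ 2) :* con -1ℤ :* (a :* (s :* o)) := con (+ 2) :* a :* ((con -1ℤ :* s) :* o)) S.refl
        (const (+ 2) ^ n) (const -1ℤ ^ ∣ T ∩ c ∣) (t ^ ∣ ∁ T ∩ c ∣)))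

    private
      W = allWords N

    containing : Word N → Series
    containing T = SumS.sum W (λ x → SumS.⟦ 𝒞 x ⟧ * (SumS.⟦ T ⊑ x ⟧ * (M ^ wt x * P ^ ∣ ∁ x ∣)))

    meeting : Word N → Series
    meeting T = SumS.sum W (λ c → SumS.⟦ 𝒞 c ⟧ * (const -1ℤ ^ ∣ T ∩ c ∣ * t ^ ∣ ∁ T ∩ c ∣))

    macWilliams′ : ∀ T →
      const (+ 2) ^ N * (M ^ wt T * meeting T) ≋ const (size 𝒞 linear selfDual) * (const (+ 2) ^ wt T * containing T)
    macWilliams′ T = begin
      const (+ 2) ^ N * (M ^ wt T * meeting T)
        ≈⟨ solve 3 (λ a b c → a :* (b :* c) := b :* (a :* c)) S.refl (const (+ 2) ^ N) (M ^ wt T) (meeting T) ⟩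
      M ^ wt T * (const (+ 2) ^ N * meeting T)
        ≈⟨ S.*-congˡ (SumS.sum-*ˡ (const (+ 2) ^ N) W _) ⟨
      M ^ wt T * SumS.sum W (λ c → const (+ 2) ^ N * (SumS.⟦ 𝒞 c ⟧ * (const -1ℤ ^ ∣ T ∩ c ∣ * t ^ ∣ ∁ T ∩ c ∣)))
        ≈⟨ S.*-congˡ (SumS.sum-cong W (λ c → S.trans
             (exchange (const (+ 2) ^ N) SumS.⟦ 𝒞 c ⟧ _)
             (S.trans (S.*-congˡ (S.sym (weight-transform-local T c)))
             (exchange SumS.⟦ 𝒞 c ⟧ (const (+ 2) ^ wt T) _)))) ⟩
      M ^ wt T * SumS.sum W (λ c → const (+ 2) ^ wt T * (SumS.⟦ 𝒞 c ⟧ * weight (transforms (weights T)) c))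
        ≈⟨ S.*-congˡ (S.trans (SumS.sum-*ˡ (const (+ 2) ^ wt T) W _)
             (S.*-congˡ (poisson 𝒞 linear selfDual (weights T)))) ⟩
      M ^ wt T * (const (+ 2) ^ wt T * (const sz * SumS.sum W (λ x → SumS.⟦ 𝒞 x ⟧ * weight (weights T) x)))
        ≈⟨ solve 4 (λ a b c d → a :* (b :* (c :* d)) := c :* (b :* (a :* d))) S.refl
             (M ^ wt T) (const (+ 2) ^ wt T) (const sz) _ ⟩
      const sz * (const (+ 2) ^ wt T * (M ^ wt T * SumS.sum W (λ x → SumS.⟦ 𝒞 x ⟧ * weight (weights T) x)))
        ≈⟨ S.*-congˡ (S.*-congˡ (S.trans (S.sym (SumS.sum-*ˡ (M ^ wt T) W _))
             (SumS.sum-cong W (λ x → S.trans (exchange (M ^ wt T) SumS.⟦ 𝒞 x ⟧ _)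
               (S.*-congˡ (weight-local T x)))))) ⟩
      const sz * (const (+ 2) ^ wt T * containing T) ∎
      where
      open ≋-Reasoning
      sz = size 𝒞 linear selfDual
      exchange : ∀ a b c → a * (b * c) ≋ b * (a * c)
      exchange = solve 3 (λ a b c → a :* (b :* c) := b :* (a :* c)) S.refl

  sum-zeroWord : ∀ n (f : Word n → ℤ) → (∀ c → wt c ≢ 0 → f c ≡ 0ℤ) →
    Sumℤ.sum (allWords n) f ≡ f (zeroWord n)
  sum-zeroWord zero    f f≡0 = ℤ.+-identityʳ _
  sum-zeroWord (suc n) f f≡0
    rewrite Sumℤ.sum-++ (map (true ∷_) (allWords n)) (map (false ∷_) (allWords n)) f
          | Sumℤ.sum-map (true ∷_) (allWords n) f
          | Sumℤ.sum-map (false ∷_) (allWords n) f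
          | sum-zeroWord n (f ∘ (false ∷_)) (λ c → f≡0 (false ∷ c)) = trans
    (cong (ℤ._+ f (zeroWord (suc n)))
      (trans (Sumℤ.sum-cong (allWords n) (λ c → f≡0 (true ∷ c) (λ ()))) (Sumℤ.sum-zero (allWords n))))
    (ℤ.+-identityˡ _)

  const-^ : ∀ a k → const a ^ k ≋ const (a ℤ.^ k)
  const-^ a zero    = S.refl
  const-^ a (suc k) = S.trans (S.*-congˡ (const-^ a k)) (S.sym (const-* a (a ℤ.^ k)))

  const-cancel : ∀ a {f g} → a ≢ 0ℤ → const a * f ≋ const a * g → f ≋ g
  const-cancel a {f} {g} a≢0 eq = coeffs λ i → ℤ.*-cancelˡ-≡ a (at f i) (at g i) {{ℤ.≢-nonZero a≢0}}
    (trans (sym (constant-⊛ a (at f) i)) (trans (coeff eq i) (constant-⊛ a (at g) i)))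

  2^≢0 : ∀ k → (+ 2) ℤ.^ k ≢ 0ℤ
  2^≢0 k eq with ℤ.i^n≡0⇒i≡0 (+ 2) k eq
  ... | ()

  unit-^₀ : ∀ f → at f 0 ≡ 1ℤ → ∀ k → at (f ^ k) 0 ≡ 1ℤ
  unit-^₀ f f₀ zero    = refl
  unit-^₀ f f₀ (suc k) rewrite f₀ | unit-^₀ f f₀ k = refl

  private
    square-injective : ∀ a b → a ℕ.* a ≡ b ℕ.* b → a ≡ b
    square-injective a b eq with ℕ.<-cmp a b
    ... | tri≈ _ a≡b _ = a≡b
    ... | tri< a<b _ _ = contradiction eq (ℕ.<⇒≢ (ℕ.*-mono-< a<b a<b))
    ... | tri> _ _ b<a = contradiction (sym eq) (ℕ.<⇒≢ (ℕ.*-mono-< b<a b<a))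

  ∁-zeroWord-∩ : ∀ {n} (c : Word n) → ∁ (zeroWord n) ∩ c ≡ c
  ∁-zeroWord-∩ []      = refl
  ∁-zeroWord-∩ (_ ∷ c) = cong (_ ∷_) (∁-zeroWord-∩ c)

  zeroWord-∩ : ∀ {n} (c : Word n) → ∣ zeroWord n ∩ c ∣ ≡ 0
  zeroWord-∩ []      = refl
  zeroWord-∩ (_ ∷ c) = zeroWord-∩ c

  module _ {N k : ℕ} (𝒞 : Code N) (linear : IsLinear 𝒞) (selfDual : IsSelfDual 𝒞) (N≡2k : N ≡ k ℕ.+ k) where

    private
      sz = size 𝒞 linear selfDual

      -- The identity only determines the square of the size, so its sign has to be known
      -- separately.
      size≥0 : ∃[ s ] sz ≡ + s
      size≥0 = go W′
        where
        W′ = allWords N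
        go : ∀ xs → ∃[ s ] Sumℤ.sum xs (λ c → Sumℤ.⟦ 𝒞 c ⟧) ≡ + s
        go [] = 0 , refl
        go (c ∷ xs) with 𝒞 c | go xs
        ... | true  | s , eq = suc s , cong (ℤ._+_ 1ℤ) eq
        ... | false | s , eq = s , trans (ℤ.+-identityˡ _) eq

      meeting₀ : at (meeting 𝒞 linear selfDual (zeroWord N)) 0 ≡ 1ℤ
      meeting₀ = trans (sum-coeff (allWords N) _ 0) (trans
        (sum-zeroWord N _ vanish) zero-term)
        where
        term : Word N → ℤ
        term c = at (SumS.⟦ 𝒞 c ⟧ * (const -1ℤ ^ ∣ zeroWord N ∩ c ∣ * t ^ ∣ ∁ (zeroWord N) ∩ c ∣)) 0
        zero-term : term (zeroWord N) ≡ 1ℤ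
        zero-term rewrite proj₁ linear | zeroWord-∩ (zeroWord N) | ∁-zeroWord-∩ (zeroWord N) | wt-zeroWord N = refl
        vanish : ∀ c → wt c ≢ 0 → term c ≡ 0ℤ
        vanish c wt≢0 rewrite ∁-zeroWord-∩ c with wt c
        ... | zero  = contradiction refl wt≢0
        ... | suc w = trans (cong (at SumS.⟦ 𝒞 c ⟧ 0 ℤ.*_) (ℤ.*-zeroʳ (at (const -1ℤ ^ ∣ zeroWord N ∩ c ∣) 0)))
          (ℤ.*-zeroʳ (at SumS.⟦ 𝒞 c ⟧ 0))

      containing₀ : at (containing 𝒞 linear selfDual (zeroWord N)) 0 ≡ sz
      containing₀ = trans (sum-coeff (allWords N) _ 0) (Sumℤ.sum-cong (allWords N) term)
        where
        term : ∀ x → at (SumS.⟦ 𝒞 x ⟧ * (SumS.⟦ zeroWord N ⊑ x ⟧ * (M ^ wt x * P ^ ∣ ∁ x ∣))) 0 ≡ Sumℤ.⟦ 𝒞 x ⟧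
        term x rewrite zeroWord-⊑ x | unit-^₀ M refl (wt x) | unit-^₀ P refl ∣ ∁ x ∣ with 𝒞 x
        ... | true  = refl
        ... | false = refl

    -- This replaces a dimension count: the constant terms of the identity at the empty set say that
    -- the square of the size is 2^N.
    size-2^ : sz ≡ (+ 2) ℤ.^ k
    size-2^ = finish (proj₁ size≥0) (proj₂ size≥0) (trans (sym square) root)
      where
      root : at (const (+ 2) ^ N) 0 ≡ (+ 2) ℤ.^ k ℤ.* (+ 2) ℤ.^ k
      root = trans (coeff (const-^ (+ 2) N) 0)
        (trans (cong ((+ 2) ℤ.^_) N≡2k) (ℤ.^-distribˡ-+-* (+ 2) k k))
      square : at (const (+ 2) ^ N) 0 ≡ sz ℤ.* sz
      square = begin
        at (const (+ 2) ^ N) 0                                ≡⟨ ℤ.*-identityʳ _ ⟨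
        at (const (+ 2) ^ N) 0 ℤ.* 1ℤ                         ≡⟨ cong (at (const (+ 2) ^ N) 0 ℤ.*_) m₀ ⟨
        at (const (+ 2) ^ N * (M ^ wt O * meeting 𝒞 linear selfDual O)) 0
          ≡⟨ coeff (macWilliams′ 𝒞 linear selfDual O) 0 ⟩
        sz ℤ.* (at (const (+ 2) ^ wt O) 0 ℤ.* at (containing 𝒞 linear selfDual O) 0)
          ≡⟨ cong (sz ℤ.*_) c₀ ⟩
        sz ℤ.* sz ∎
        where
        open ≡.≡-Reasoning
        O = zeroWord N
        m₀ : at (M ^ wt O * meeting 𝒞 linear selfDual O) 0 ≡ 1ℤ
        m₀ rewrite unit-^₀ M refl (wt O) | meeting₀ = refl
        c₀ : at (const (+ 2) ^ wt O) 0 ℤ.* at (containing 𝒞 linear selfDual O) 0 ≡ sz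
        c₀ rewrite containing₀ | wt-zeroWord N = ℤ.*-identityˡ sz
      pow : ∀ k → (+ 2) ℤ.^ k ≡ + (2 ℕ.^ k)
      pow zero    = refl
      pow (suc k) = trans (cong ((+ 2) ℤ.*_) (pow k)) (sym (ℤ.pos-* 2 (2 ℕ.^ k)))
      finish : ∀ s → sz ≡ + s → sz ℤ.* sz ≡ (+ 2) ℤ.^ k ℤ.* (+ 2) ℤ.^ k → sz ≡ (+ 2) ℤ.^ k
      finish s eq sq = trans eq (trans (cong +_ (square-injective s (2 ℕ.^ k) squares)) (sym (pow k)))
        where
        squares : s ℕ.* s ≡ 2 ℕ.^ k ℕ.* 2 ℕ.^ k
        squares = ℤ.+-injective (begin
          + (s ℕ.* s)                       ≡⟨ ℤ.pos-* s s ⟩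
          + s ℤ.* + s                       ≡⟨ cong₂ ℤ._*_ eq eq ⟨
          sz ℤ.* sz                         ≡⟨ sq ⟩
          (+ 2) ℤ.^ k ℤ.* (+ 2) ℤ.^ k       ≡⟨ cong₂ ℤ._*_ (pow k) (pow k) ⟩
          + (2 ℕ.^ k) ℤ.* + (2 ℕ.^ k)       ≡⟨ ℤ.pos-* (2 ℕ.^ k) (2 ℕ.^ k) ⟨
          + (2 ℕ.^ k ℕ.* 2 ℕ.^ k) ∎)
          where open ≡.≡-Reasoning

    macWilliams : ∀ T →
      const (+ 2) ^ k * (M ^ wt T * meeting 𝒞 linear selfDual T) ≋
      const (+ 2) ^ wt T * containing 𝒞 linear selfDual T
    macWilliams T = const-cancel ((+ 2) ℤ.^ k) (2^≢0 k) (begin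
      const ((+ 2) ℤ.^ k) * (const (+ 2) ^ k * (M ^ wt T * meeting 𝒞 linear selfDual T))
        ≈⟨ S.*-congʳ (const-^ (+ 2) k) ⟨
      const (+ 2) ^ k * (const (+ 2) ^ k * (M ^ wt T * meeting 𝒞 linear selfDual T))
        ≈⟨ S.*-assoc _ _ _ ⟨
      const (+ 2) ^ k * const (+ 2) ^ k * (M ^ wt T * meeting 𝒞 linear selfDual T)
        ≈⟨ S.*-congʳ (^-homo-* (const (+ 2)) k k) ⟨
      const (+ 2) ^ (k ℕ.+ k) * (M ^ wt T * meeting 𝒞 linear selfDual T)
        ≡⟨ cong (λ n → const (+ 2) ^ n * (M ^ wt T * meeting 𝒞 linear selfDual T)) N≡2k ⟨
      const (+ 2) ^ N * (M ^ wt T * meeting 𝒞 linear selfDual T)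
        ≈⟨ macWilliams′ 𝒞 linear selfDual T ⟩
      const sz * (const (+ 2) ^ wt T * containing 𝒞 linear selfDual T)
        ≡⟨ cong (λ s → const s * (const (+ 2) ^ wt T * containing 𝒞 linear selfDual T)) size-2^ ⟩
      const ((+ 2) ℤ.^ k) * (const (+ 2) ^ wt T * containing 𝒞 linear selfDual T) ∎)
      where open ≋-Reasoning

-- Forms in X and Y and their expansion in V = Y - X.

module Forms where

  open import Algebra.Bundles using (CommutativeRing)
  open import Data.Integer as ℤ using (ℤ; +_; 0ℤ; 1ℤ; -1ℤ)
  import Data.Integer.Properties as ℤ
  open import Data.Integer.Tactic.RingSolver using (solve-∀)
  open import Data.List using (upTo)
  open import Data.Nat as ℕ using (ℕ; zero; suc; s≤s; _∸_)
  open import Data.Nat.Combinatorics using (_C_)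
  import Data.Nat.Properties as ℕ
  open import Data.Nat.Properties using (_≟_)
  open import Data.Product using (_×_; _,_)
  open import Relation.Binary.Definitions using (tri<; tri≈; tri>)
  open import Relation.Binary.PropositionalEquality as ≡ using (_≡_; _≢_; refl; cong; cong₂; sym; trans)
  open import Relation.Nullary using (does; yes; no)
  open import Relation.Nullary.Decidable using (dec-true; dec-false)
  open Series
  open Sums
  open Count using (pascal)
  open Enumerator

  open CommutativeRing seriesRing using (_+_; _*_; _-_; -_; 1#; 0#)
  open SeriesSolver using (solve; _:=_; _:*_; _:+_; _:-_; _:^_; con)

  -- `V` is Y - X in factored form. `E` is the inverse of 1 - t⁴; multiplied by the complementary
  -- factors it inverts each of `M`, `P` and `Z`.
  X Y V E : Series
  X = M ^ 4
  Y = P ^ 4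
  V = const (+ 8) * (t * Z)
  at E = geometric
    where
    geometric : ℕ → ℤ
    geometric 0 = 1ℤ
    geometric 1 = 0ℤ
    geometric 2 = 0ℤ
    geometric 3 = 0ℤ
    geometric (suc (suc (suc (suc n)))) = geometric n

  infix 4 _≡[_]_
  -- Congruence modulo t^k.
  record _≡[_]_ (f : Series) (k : ℕ) (g : Series) : Set where
    constructor upTo<
    field below : ∀ i → i ℕ.< k → at f i ≡ at g i
  open _≡[_]_ public

  t-shift : ∀ f n → at (t * f) (suc n) ≡ at f n
  t-shift f zero = trans (ℤ.+-identityˡ _) (ℤ.*-identityˡ _)
  t-shift f (suc n) = trans (ℤ.+-identityˡ _) (trans
    (cong₂ ℤ._+_ (ℤ.*-identityˡ (at f (suc n))) (zero-⊛ _ (at f) (λ _ → refl) n))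
    (ℤ.+-identityʳ (at f (suc n))))

  t^-shift : ∀ k f n → at (t ^ k * f) (k ℕ.+ n) ≡ at f n
  t^-shift zero    f n = coeff (S.*-identityˡ f) n
  t^-shift (suc k) f n = trans (coeff (S.*-assoc t (t ^ k) f) (suc (k ℕ.+ n)))
    (trans (t-shift (t ^ k * f) (k ℕ.+ n)) (t^-shift k f n))

  t^-below : ∀ k f i → i ℕ.< k → at (t ^ k * f) i ≡ 0ℤ
  t^-below (suc k) f zero    _         = coeff (S.*-assoc t (t ^ k) f) 0
  t^-below (suc k) f (suc i) (s≤s i<k) = trans (coeff (S.*-assoc t (t ^ k) f) (suc i))
    (trans (t-shift (t ^ k * f) i) (t^-below k f i i<k))

  ⊛-local : ∀ h f g k → (∀ i → i ℕ.< k → f i ≡ g i) → ∀ i → i ℕ.< k → (h ⊛ f) i ≡ (h ⊛ g) i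
  ⊛-local h f g (suc k) eq zero    i<k       = cong (h 0 ℤ.*_) (eq 0 i<k)
  ⊛-local h f g (suc k) eq (suc i) (s≤s i<k) = cong₂ ℤ._+_ (cong (h 0 ℤ.*_) (eq (suc i) (s≤s i<k)))
    (⊛-local (tail h) f g k (λ j j<k → eq j (ℕ.m≤n⇒m≤1+n j<k)) i i<k)

  *-congˡ-≡[] : ∀ h {f g k} → f ≡[ k ] g → h * f ≡[ k ] h * g
  *-congˡ-≡[] h {f} {g} {k} eq = upTo< (⊛-local (at h) (at f) (at g) k (below eq))

  ≋⇒≡[] : ∀ {f g} k → f ≋ g → f ≡[ k ] g
  ≋⇒≡[] k f≋g = upTo< λ i _ → coeff f≋g i

  ≡[]-trans : ∀ {f g h k} → f ≡[ k ] g → g ≡[ k ] h → f ≡[ k ] h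
  ≡[]-trans p q = upTo< λ i i<k → trans (below p i i<k) (below q i i<k)

  E-inverse : E * (M * (P * Z)) ≋ 1#
  E-inverse = S.trans (solve 2 (λ e t → e :* ((con 1ℤ :- t) :* ((con 1ℤ :+ t) :* (con 1ℤ :+ t :* t))) :=
      e :- t :^ 4 :* e) S.refl E t) (coeffs difference)
    where
    difference : ∀ i → at (E - t ^ 4 * E) i ≡ at 1# i
    difference 0 = refl
    difference 1 = refl
    difference 2 = refl
    difference 3 = refl
    difference (suc (suc (suc (suc i)))) =
      trans (cong (λ x → at E i ℤ.- x) (t^-shift 4 E i)) (ℤ.+-inverseʳ (at E i))

  -- The range goes up to `j + u`, beyond the last nonzero binomial, so that all terms X^j Y^(L-j)
  -- of a form are expanded over the same index set.
  binomial : ∀ (x z : Series) j u →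
    SumS.sum (upTo (suc (j ℕ.+ u))) (λ i → const (+ (j C i)) * (z ^ i * x ^ ((j ℕ.+ u) ∸ i)))
    ≋ (x + z) ^ j * x ^ u
  binomial x z zero u = begin
    SumS.sum (upTo (suc u)) (λ i → const (+ (0 C i)) * (z ^ i * x ^ (u ∸ i)))
      ≡⟨ SumS.sum-upTo-suc u _ ⟩
    const 1ℤ * (1# * x ^ u) + SumS.sum (upTo u) (λ i → const 0ℤ * (z ^ suc i * x ^ (u ∸ suc i)))
      ≈⟨ S.+-congˡ (S.trans (SumS.sum-cong (upTo u) (λ i → S.zeroˡ _)) (SumS.sum-zero (upTo u))) ⟩
    const 1ℤ * (1# * x ^ u) + 0#
      ≈⟨ solve 1 (λ a → con 1ℤ :* (con 1ℤ :* a) :+ con 0ℤ := con 1ℤ :* a) S.refl (x ^ u) ⟩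
    1# * x ^ u ∎
    where open ≋-Reasoning
  binomial x z (suc j) u = begin
    SumS.sum (upTo (suc (suc L))) (λ i → const (+ (suc j C i)) * (z ^ i * x ^ (suc L ∸ i)))
      ≡⟨ SumS.sum-upTo-suc (suc L) _ ⟩
    first + SumS.sum (upTo (suc L)) (λ i → const (+ (suc j C suc i)) * (z ^ suc i * x ^ (L ∸ i)))
      ≈⟨ S.+-congˡ (S.trans (SumS.sum-cong (upTo (suc L)) split) (S.trans (SumS.sum-+ (upTo (suc L)) _ _)
           (S.+-congʳ (SumS.sum-*ˡ z (upTo (suc L)) _)))) ⟩
    first + (z * SumS.sum (upTo (suc L)) (λ i → const (+ (j C i)) * (z ^ i * x ^ (L ∸ i)))
      + SumS.sum (upTo (suc L)) (λ i → const (+ (j C suc i)) * (z ^ suc i * x ^ (L ∸ i))))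
      ≈⟨ S.+-congˡ (S.+-congʳ (S.*-congˡ (binomial x z j u))) ⟩
    first + (z * ((x + z) ^ j * x ^ u) + rest)
      ≈⟨ solve 3 (λ f a r → f :+ (a :+ r) := a :+ (f :+ r)) S.refl first (z * ((x + z) ^ j * x ^ u)) rest ⟩
    z * ((x + z) ^ j * x ^ u) + (first + rest)
      ≡⟨ cong (_+_ (z * ((x + z) ^ j * x ^ u))) recombine ⟩
    z * ((x + z) ^ j * x ^ u)
      + SumS.sum (upTo (suc (j ℕ.+ suc u))) (λ i → const (+ (j C i)) * (z ^ i * x ^ ((j ℕ.+ suc u) ∸ i)))
      ≈⟨ S.+-congˡ (binomial x z j (suc u)) ⟩
    z * ((x + z) ^ j * x ^ u) + (x + z) ^ j * (x * x ^ u)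
      ≈⟨ solve 4 (λ x z a b → z :* (a :* b) :+ a :* (x :* b) := (x :+ z) :* a :* b) S.refl x z ((x + z) ^ j) (x ^ u) ⟩
    (x + z) ^ suc j * x ^ u ∎
    where
    open ≋-Reasoning
    L = j ℕ.+ u
    first = const 1ℤ * (1# * x ^ suc L)
    rest = SumS.sum (upTo (suc L)) (λ i → const (+ (j C suc i)) * (z ^ suc i * x ^ (L ∸ i)))
    recombine : first + rest ≡
      SumS.sum (upTo (suc (j ℕ.+ suc u))) (λ i → const (+ (j C i)) * (z ^ i * x ^ ((j ℕ.+ suc u) ∸ i)))
    recombine rewrite ℕ.+-suc j u =
      sym (SumS.sum-upTo-suc (suc L) (λ i → const (+ (j C i)) * (z ^ i * x ^ (suc L ∸ i))))
    split : ∀ i → const (+ (suc j C suc i)) * (z ^ suc i * x ^ (L ∸ i)) ≋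
      z * (const (+ (j C i)) * (z ^ i * x ^ (L ∸ i))) + const (+ (j C suc i)) * (z ^ suc i * x ^ (L ∸ i))
    split i = S.trans
      (S.*-congʳ (S.trans (S.reflexive (cong const (sym (pascal j i)))) (const-+ (+ (j C i)) (+ (j C suc i)))))
      (solve 5 (λ a b z p q → (a :+ b) :* ((z :* p) :* q) := z :* (a :* (p :* q)) :+ b :* ((z :* p) :* q)) S.refl
        (const (+ (j C i))) (const (+ (j C suc i))) z (z ^ i) (x ^ (L ∸ i)))

  monomial : ℕ → ℕ → Series
  monomial L i = V ^ i * X ^ (L ∸ i)

  form : (ℕ → ℤ) → ℕ → Series
  form δ L = SumS.sum (upTo (suc L)) (λ j → const (δ j) * (X ^ j * Y ^ (L ∸ j)))

  -- The coefficient of V^i X^(L-i) once Y = X + V is substituted in `form δ L`.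
  moment : (ℕ → ℤ) → ℕ → ℕ → ℤ
  moment δ L i = Sumℤ.sum (upTo (suc L)) (λ j → δ j ℤ.* + ((L ∸ j) C i))

  expansion : (ℕ → ℤ) → ℕ → Series
  expansion N L = SumS.sum (upTo (suc L)) (λ i → const (N i) * monomial L i)

  form-expansion : ∀ δ L → form δ L ≋ expansion (moment δ L) L
  form-expansion δ L = begin
    SumS.sum (upTo (suc L)) (λ j → const (δ j) * (X ^ j * Y ^ (L ∸ j)))
      ≈⟨ SumS.sum-upTo-cong (suc L) (λ j j<1+L → S.*-congˡ {const (δ j)} (power j (ℕ.s≤s⁻¹ j<1+L))) ⟩
    SumS.sum (upTo (suc L)) (λ j → const (δ j) * SumS.sum (upTo (suc L)) (λ i → const (+ ((L ∸ j) C i)) * (V ^ i * X ^ (L ∸ i))))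
      ≈⟨ SumS.sum-cong (upTo (suc L)) (λ j → S.sym (SumS.sum-*ˡ (const (δ j)) (upTo (suc L)) _)) ⟩
    SumS.sum (upTo (suc L)) (λ j → SumS.sum (upTo (suc L)) (λ i → const (δ j) * (const (+ ((L ∸ j) C i)) * (V ^ i * X ^ (L ∸ i)))))
      ≈⟨ SumS.sum-swap (upTo (suc L)) (upTo (suc L)) _ ⟩
    SumS.sum (upTo (suc L)) (λ i → SumS.sum (upTo (suc L)) (λ j → const (δ j) * (const (+ ((L ∸ j) C i)) * (V ^ i * X ^ (L ∸ i)))))
      ≈⟨ SumS.sum-cong (upTo (suc L)) (λ i → S.trans
           (SumS.sum-cong (upTo (suc L)) (λ j → S.trans (S.sym (S.*-assoc _ _ _))
             (S.*-congʳ (S.sym (const-* (δ j) (+ ((L ∸ j) C i)))))))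
           (S.trans (SumS.sum-*ʳ (V ^ i * X ^ (L ∸ i)) (upTo (suc L)) _) (S.*-congʳ (S.sym (const-sum (upTo (suc L)) _))))) ⟩
    expansion (moment δ L) L ∎
    where
    open ≋-Reasoning
    power : ∀ j → j ℕ.≤ L → X ^ j * Y ^ (L ∸ j) ≋
      SumS.sum (upTo (suc L)) (λ i → const (+ ((L ∸ j) C i)) * (V ^ i * X ^ (L ∸ i)))
    power j j≤L = S.trans (S.*-comm _ _) (S.trans (S.*-congʳ (^-congˡ (L ∸ j) Y≋X+V))
      (S.trans (S.sym (binomial X V (L ∸ j) j))
      (S.reflexive (cong (λ l → SumS.sum (upTo (suc l)) (λ i → const (+ ((L ∸ j) C i)) * (V ^ i * X ^ (l ∸ i))))
        (ℕ.m∸n+n≡m j≤L)))))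
      where
      Y≋X+V : Y ≋ X + V
      Y≋X+V = solve 1 (λ t → (con 1ℤ :+ t) :^ 4 :=
        (con 1ℤ :- t) :^ 4 :+ con (+ 8) :* (t :* (con 1ℤ :+ t :* t))) S.refl t

  private
    sign : ℕ → ℤ
    sign i = -1ℤ ℤ.^ i

  -- The Pascal matrix and its signed version are inverse to each other. Pascal's rule in `u` gives
  -- two sums for the smaller `u`; in one of them a second application, to `i C v`, undoes the shift
  -- of the index.
  inversion : ∀ u v K → u ℕ.< K →
    Sumℤ.sum (upTo K) (λ i → -1ℤ ℤ.^ (i ℕ.+ v) ℤ.* + (i C v) ℤ.* + (u C i)) ≡ Sumℤ.⟦ does (v ≟ u) ⟧
  inversion zero v (suc K) _
    rewrite Sumℤ.sum-upTo-suc K (λ i → sign (i ℕ.+ v) ℤ.* + (i C v) ℤ.* + (0 C i)) = trans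
    (cong₂ ℤ._+_ (at-zero v) (trans (Sumℤ.sum-cong (upTo K)
      (λ i → ℤ.*-zeroʳ (sign (suc i ℕ.+ v) ℤ.* + (suc i C v)))) (Sumℤ.sum-zero (upTo K))))
    (ℤ.+-identityʳ _)
    where
    at-zero : ∀ v → sign v ℤ.* + (0 C v) ℤ.* 1ℤ ≡ Sumℤ.⟦ does (v ≟ 0) ⟧
    at-zero zero    = refl
    at-zero (suc v) rewrite ℤ.*-zeroʳ (sign (suc v)) = refl
  inversion (suc u) v (suc K) (s≤s u<K)
    rewrite Sumℤ.sum-upTo-suc K (λ i → sign (i ℕ.+ v) ℤ.* + (i C v) ℤ.* + (suc u C i)) = begin
    sign v ℤ.* + (0 C v) ℤ.* 1ℤ ℤ.+ Sumℤ.sum (upTo K) (λ i → sign (suc i ℕ.+ v) ℤ.* + (suc i C v) ℤ.* + (suc u C suc i))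
      ≡⟨ cong (ℤ._+_ (sign v ℤ.* + (0 C v) ℤ.* 1ℤ)) (trans (Sumℤ.sum-cong (upTo K) split) (Sumℤ.sum-+ (upTo K) _ _)) ⟩
    sign v ℤ.* + (0 C v) ℤ.* 1ℤ ℤ.+ (Sumℤ.sum (upTo K) (λ i → sign (suc i ℕ.+ v) ℤ.* + (suc i C v) ℤ.* + (u C i))
      ℤ.+ Sumℤ.sum (upTo K) (λ i → sign (suc i ℕ.+ v) ℤ.* + (suc i C v) ℤ.* + (u C suc i)))
      ≡⟨ move (sign v ℤ.* + (0 C v) ℤ.* 1ℤ)
           (Sumℤ.sum (upTo K) (λ i → sign (suc i ℕ.+ v) ℤ.* + (suc i C v) ℤ.* + (u C i)))
           (Sumℤ.sum (upTo K) (λ i → sign (suc i ℕ.+ v) ℤ.* + (suc i C v) ℤ.* + (u C suc i))) ⟩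
    Sumℤ.sum (upTo K) (λ i → sign (suc i ℕ.+ v) ℤ.* + (suc i C v) ℤ.* + (u C i))
      ℤ.+ (sign v ℤ.* + (0 C v) ℤ.* 1ℤ ℤ.+ Sumℤ.sum (upTo K) (λ i → sign (suc i ℕ.+ v) ℤ.* + (suc i C v) ℤ.* + (u C suc i)))
      ≡⟨ cong (ℤ._+_ (Sumℤ.sum (upTo K) (λ i → sign (suc i ℕ.+ v) ℤ.* + (suc i C v) ℤ.* + (u C i))))
           (trans (sym (Sumℤ.sum-upTo-suc K (λ i → sign (i ℕ.+ v) ℤ.* + (i C v) ℤ.* + (u C i))))
             (inversion u v (suc K) (ℕ.m≤n⇒m≤1+n u<K))) ⟩
    Sumℤ.sum (upTo K) (λ i → sign (suc i ℕ.+ v) ℤ.* + (suc i C v) ℤ.* + (u C i)) ℤ.+ Sumℤ.⟦ does (v ≟ u) ⟧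
      ≡⟨ lower v ⟩
    Sumℤ.⟦ does (v ≟ suc u) ⟧ ∎
    where
    open ≡.≡-Reasoning
    move : ∀ a b c → a ℤ.+ (b ℤ.+ c) ≡ b ℤ.+ (a ℤ.+ c)
    move = solve-∀
    split : ∀ i → sign (suc i ℕ.+ v) ℤ.* + (suc i C v) ℤ.* + (suc u C suc i) ≡
      sign (suc i ℕ.+ v) ℤ.* + (suc i C v) ℤ.* + (u C i) ℤ.+ sign (suc i ℕ.+ v) ℤ.* + (suc i C v) ℤ.* + (u C suc i)
    split i = trans (cong (ℤ._*_ (sign (suc i ℕ.+ v) ℤ.* + (suc i C v))) (sym (pascal u i))) (ℤ.*-distribˡ-+ (sign (suc i ℕ.+ v) ℤ.* + (suc i C v)) (+ (u C i)) (+ (u C suc i)))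
    lower : ∀ v → Sumℤ.sum (upTo K) (λ i → sign (suc i ℕ.+ v) ℤ.* + (suc i C v) ℤ.* + (u C i)) ℤ.+ Sumℤ.⟦ does (v ≟ u) ⟧
      ≡ Sumℤ.⟦ does (v ≟ suc u) ⟧
    lower zero = trans (cong₂ ℤ._+_
        (trans (Sumℤ.sum-cong (upTo K) (λ i → negate-term (sign (i ℕ.+ 0)) (+ (u C i))))
          (trans (Sumℤ.sum-*ˡ -1ℤ (upTo K) _) (cong (-1ℤ ℤ.*_) (inversion u 0 K u<K)))) refl)
      (cancel Sumℤ.⟦ does (0 ≟ u) ⟧)
      where
      negate-term : ∀ s c → (-1ℤ ℤ.* s) ℤ.* 1ℤ ℤ.* c ≡ -1ℤ ℤ.* (s ℤ.* 1ℤ ℤ.* c)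
      negate-term = solve-∀
      cancel : ∀ x → -1ℤ ℤ.* x ℤ.+ x ≡ 0ℤ
      cancel = solve-∀
    lower (suc v) = trans (cong (ℤ._+ Sumℤ.⟦ does (suc v ≟ u) ⟧)
        (trans (Sumℤ.sum-cong (upTo K) term) (trans (Sumℤ.sum-+ (upTo K) _ _)
          (cong₂ ℤ._+_ (inversion u v K u<K) (trans (Sumℤ.sum-*ˡ -1ℤ (upTo K) _)
            (cong (-1ℤ ℤ.*_) (inversion u (suc v) K u<K)))))))
      (cancel Sumℤ.⟦ does (v ≟ u) ⟧ Sumℤ.⟦ does (suc v ≟ u) ⟧)
      where
      term : ∀ i → sign (suc i ℕ.+ suc v) ℤ.* + (suc i C suc v) ℤ.* + (u C i) ≡
        sign (i ℕ.+ v) ℤ.* + (i C v) ℤ.* + (u C i) ℤ.+ -1ℤ ℤ.* (sign (i ℕ.+ suc v) ℤ.* + (i C suc v) ℤ.* + (u C i))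
      term i = trans
        (cong₂ (λ n c → sign (suc n) ℤ.* c ℤ.* + (u C i)) (ℕ.+-suc i v) (sym (pascal i v)))
        (trans (identity (sign (i ℕ.+ v)) (+ (i C v)) (+ (i C suc v)) (+ (u C i)))
        (cong (λ n → sign (i ℕ.+ v) ℤ.* + (i C v) ℤ.* + (u C i) ℤ.+ -1ℤ ℤ.* (sign n ℤ.* + (i C suc v) ℤ.* + (u C i)))
          (sym (ℕ.+-suc i v))))
        where
        identity : ∀ s a b c → (-1ℤ ℤ.* (-1ℤ ℤ.* s)) ℤ.* (a ℤ.+ b) ℤ.* c ≡
          s ℤ.* a ℤ.* c ℤ.+ -1ℤ ℤ.* ((-1ℤ ℤ.* s) ℤ.* b ℤ.* c)
        identity = solve-∀
      cancel : ∀ x y → x ℤ.+ -1ℤ ℤ.* y ℤ.+ y ≡ x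
      cancel = solve-∀

  at-const-* : ∀ a f i → at (const a * f) i ≡ a ℤ.* at f i
  at-const-* a f = constant-⊛ a (at f)

  ^-const-* : ∀ a k f i → at (const a ^ k * f) i ≡ a ℤ.^ k ℤ.* at f i
  ^-const-* a k f i = trans (coeff (S.*-congʳ {f} (const-^ a k)) i) (at-const-* (a ℤ.^ k) f i)

  V^-split : ∀ k f → V ^ k * f ≋ const (+ 8) ^ k * (t ^ k * (Z ^ k * f))
  V^-split k f = S.trans (S.*-congʳ (S.trans (^-distrib-* (const (+ 8)) (t * Z) k) (S.*-congˡ (^-distrib-* t Z k))))
    (solve 4 (λ a b c d → (a :* (b :* c)) :* d := a :* (b :* (c :* d))) S.refl
      (const (+ 8) ^ k) (t ^ k) (Z ^ k) f)

  V^-below : ∀ k f i → i ℕ.< k → at (V ^ k * f) i ≡ 0ℤ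
  V^-below k f i i<k = trans (coeff (V^-split k f) i) (trans (^-const-* (+ 8) k (t ^ k * (Z ^ k * f)) i)
    (trans (cong ((+ 8) ℤ.^ k ℤ.*_) (t^-below k (Z ^ k * f) i i<k)) (ℤ.*-zeroʳ ((+ 8) ℤ.^ k))))

  V^-leading : ∀ k f → at f 0 ≡ 1ℤ → at (V ^ k * f) k ≡ (+ 8) ℤ.^ k
  V^-leading k f f₀ = trans (coeff (V^-split k f) k) (trans (^-const-* (+ 8) k (t ^ k * (Z ^ k * f)) k)
    (trans (cong ((+ 8) ℤ.^ k ℤ.*_) (trans
      (cong (at (t ^ k * (Z ^ k * f))) (sym (ℕ.+-identityʳ k))) (trans (t^-shift k (Z ^ k * f) 0)
      (cong₂ ℤ._*_ (unit-^₀ Z refl k) f₀)))) (ℤ.*-identityʳ ((+ 8) ℤ.^ k))))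

  8^≢0 : ∀ k → (+ 8) ℤ.^ k ≢ 0ℤ
  8^≢0 k eq with ℤ.i^n≡0⇒i≡0 (+ 8) k eq
  ... | ()

  -- V^i has order i in t with leading coefficient 8^i, so the first r coefficients of the series
  -- form a triangular system for the first r numbers `N i`.
  expansion-vanish : ∀ N L r → r ℕ.≤ suc L → (∀ i → i ℕ.< r → at (expansion N L) i ≡ 0ℤ) →
    ∀ i → i ℕ.< r → N i ≡ 0ℤ
  expansion-vanish N L r r≤1+L F≡0 i i<r = under (suc i) i<r i ℕ.≤-refl
    where
    under : ∀ k → k ℕ.≤ r → ∀ i → i ℕ.< k → N i ≡ 0ℤ
    under (suc k) k<r i i<1+k with i ≟ k
    ... | no i≢k = under k (ℕ.<⇒≤ k<r) i (ℕ.≤∧≢⇒< (ℕ.s≤s⁻¹ i<1+k) i≢k)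
    ... | yes refl = ℤ.*-cancelʳ-≡ (N i) 0ℤ ((+ 8) ℤ.^ i) {{ℤ.≢-nonZero (8^≢0 i)}} (begin
      N i ℤ.* (+ 8) ℤ.^ i
        ≡⟨ Sumℤ.sum-upTo-single (suc L) i (λ j → N j ℤ.* (+ 8) ℤ.^ i) (ℕ.≤-trans k<r r≤1+L) ⟨
      Sumℤ.sum (upTo (suc L)) (λ j → Sumℤ.⟦ does (i ≟ j) ⟧ ℤ.* (N j ℤ.* (+ 8) ℤ.^ i))
        ≡⟨ Sumℤ.sum-cong (upTo (suc L)) term ⟨
      Sumℤ.sum (upTo (suc L)) (λ j → at (const (N j) * (V ^ j * X ^ (L ∸ j))) i)
        ≡⟨ sum-coeff (upTo (suc L)) (λ j → const (N j) * (V ^ j * X ^ (L ∸ j))) i ⟨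
      at (expansion N L) i
        ≡⟨ F≡0 i k<r ⟩
      0ℤ ∎)
      where
      open ≡.≡-Reasoning
      term : ∀ j → at (const (N j) * (V ^ j * X ^ (L ∸ j))) i ≡ Sumℤ.⟦ does (i ≟ j) ⟧ ℤ.* (N j ℤ.* (+ 8) ℤ.^ i)
      term j with ℕ.<-cmp i j
      ... | tri< i<j i≢j _ rewrite dec-false (i ≟ j) i≢j = trans (at-const-* (N j) (V ^ j * X ^ (L ∸ j)) i)
        (trans (cong (N j ℤ.*_) (V^-below j (X ^ (L ∸ j)) i i<j)) (ℤ.*-zeroʳ (N j)))
      ... | tri> _ i≢j j<i rewrite dec-false (i ≟ j) i≢j = trans (at-const-* (N j) (V ^ j * X ^ (L ∸ j)) i)
        (cong (ℤ._* at (V ^ j * X ^ (L ∸ j)) i) (under i (ℕ.<⇒≤ k<r) j j<i))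
      ... | tri≈ _ refl _ rewrite dec-true (i ≟ i) refl = trans (at-const-* (N i) (V ^ i * X ^ (L ∸ i)) i)
        (trans (cong (N i ℤ.*_) (V^-leading i (X ^ (L ∸ i)) (unit-^₀ X refl (L ∸ i)))) (sym (ℤ.*-identityˡ (N i ℤ.* (+ 8) ℤ.^ i))))

  expansion-split : ∀ N r q → (∀ i → i ℕ.< r → N i ≡ 0ℤ) →
    expansion N (r ℕ.+ q) ≋ V ^ r * expansion (λ s → N (r ℕ.+ s)) q
  expansion-split N r q N≡0 = begin
    SumS.sum (upTo (suc (r ℕ.+ q))) F
      ≡⟨ cong (λ k → SumS.sum (upTo k) F) (sym (ℕ.+-suc r q)) ⟩
    SumS.sum (upTo (r ℕ.+ suc q)) F
      ≈⟨ SumS.sum-upTo-+ r (suc q) F ⟩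
    SumS.sum (upTo r) F + SumS.sum (upTo (suc q)) (λ s → F (r ℕ.+ s))
      ≈⟨ S.+-cong (S.trans (SumS.sum-upTo-cong r (λ i i<r → S.trans (S.*-congʳ {V ^ i * X ^ ((r ℕ.+ q) ∸ i)}
             (S.reflexive (cong const (N≡0 i i<r)))) (S.zeroˡ _))) (SumS.sum-zero (upTo r)))
           (SumS.sum-cong (upTo (suc q)) shift) ⟩
    0# + SumS.sum (upTo (suc q)) (λ s → V ^ r * (const (N (r ℕ.+ s)) * (V ^ s * X ^ (q ∸ s))))
      ≈⟨ S.trans (S.+-identityˡ _) (SumS.sum-*ˡ (V ^ r) (upTo (suc q)) _) ⟩
    V ^ r * expansion (λ s → N (r ℕ.+ s)) q ∎
    where
    open ≋-Reasoning
    F = λ i → const (N i) * (V ^ i * X ^ ((r ℕ.+ q) ∸ i))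
    shift : ∀ s → F (r ℕ.+ s) ≋ V ^ r * (const (N (r ℕ.+ s)) * (V ^ s * X ^ (q ∸ s)))
    shift s = S.trans (S.*-congˡ (S.*-cong (^-homo-* V r s)
        (S.reflexive (cong (X ^_) (ℕ.[m+n]∸[m+o]≡n∸o r q s)))))
      (solve 4 (λ n a b c → n :* ((a :* b) :* c) := a :* (n :* (b :* c))) S.refl
        (const (N (r ℕ.+ s))) (V ^ r) (V ^ s) (X ^ (q ∸ s)))

  E^-unit : ∀ r → E ^ r ≡[ 4 ] 1#
  E^-unit zero    = ≋⇒≡[] 4 S.refl
  E^-unit (suc r) = ≡[]-trans (*-congˡ-≡[] E (E^-unit r)) (≡[]-trans (≋⇒≡[] 4 (S.*-identityʳ E)) E-unit)
    where
    E-unit : E ≡[ 4 ] 1#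
    E-unit = upTo< λ where
      0 _ → refl
      1 _ → refl
      2 _ → refl
      3 _ → refl
      (suc (suc (suc (suc i)))) (s≤s (s≤s (s≤s (s≤s ()))))

  1^ : ∀ r → 1# ^ r ≋ 1#
  1^ zero    = S.refl
  1^ (suc r) = S.trans (S.*-identityˡ _) (1^ r)

  Z⁻¹ : Series
  Z⁻¹ = E * (M * P)

  Z-inverse : Z * Z⁻¹ ≋ 1#
  Z-inverse = S.trans
    (solve 4 (λ z e m p → z :* (e :* (m :* p)) := e :* (m :* (p :* z))) S.refl Z E M P) E-inverse

  -- V is 8 t Z, and Z⁻¹ is E M P; so only E survives when the
  -- factor (E Z)^r is removed, and E is 1 up to t⁴.
  leading-form : ∀ δ r q k W →
    const (+ 2) ^ k * form δ (r ℕ.+ q) ≡[ r ℕ.+ 4 ] t ^ r * ((E * Z) ^ r * W) →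
    (∀ i → i ℕ.< r → moment δ (r ℕ.+ q) i ≡ 0ℤ) ×
    (∀ i → i ℕ.< 4 →
      (+ 2) ℤ.^ k ℤ.* ((+ 8) ℤ.^ r ℤ.* at (expansion (λ s → moment δ (r ℕ.+ q) (r ℕ.+ s)) q) i) ≡ at W i)
  leading-form δ r q k W eq = vanish , leading
    where
    L = r ℕ.+ q
    F′ = expansion (λ s → moment δ L (r ℕ.+ s)) q
    vanish : ∀ i → i ℕ.< r → moment δ L i ≡ 0ℤ
    vanish = expansion-vanish (moment δ L) L r (ℕ.m≤n⇒m≤1+n (ℕ.m≤m+n r q)) λ i i<r →
      trans (sym (coeff (form-expansion δ L) i))
        (ℤ.*-cancelˡ-≡ ((+ 2) ℤ.^ k) _ 0ℤ {{ℤ.≢-nonZero (2^≢0 k)}}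
          (trans (sym (^-const-* (+ 2) k (form δ L) i))
          (trans (below eq i (ℕ.≤-trans i<r (ℕ.m≤m+n r 4)))
          (trans (t^-below r ((E * Z) ^ r * W) i i<r) (sym (ℤ.*-zeroʳ ((+ 2) ℤ.^ k)))))))
    left : Z⁻¹ ^ r * (const (+ 2) ^ k * form δ L) ≋ t ^ r * (const (+ 2) ^ k * (const (+ 8) ^ r * F′))
    left = begin
      Z⁻¹ ^ r * (const (+ 2) ^ k * form δ L)
        ≈⟨ S.*-congˡ (S.*-congˡ (S.trans (form-expansion δ L) (S.trans (expansion-split (moment δ L) r q vanish) (V^-split r F′)))) ⟩
      Z⁻¹ ^ r * (const (+ 2) ^ k * (const (+ 8) ^ r * (t ^ r * (Z ^ r * F′))))
        ≈⟨ solve 6 (λ e a b c z f → e :* (a :* (b :* (c :* (z :* f)))) := (z :* e) :* (c :* (a :* (b :* f)))) S.refl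
             (Z⁻¹ ^ r) (const (+ 2) ^ k) (const (+ 8) ^ r) (t ^ r) (Z ^ r) F′ ⟩
      Z ^ r * Z⁻¹ ^ r * (t ^ r * (const (+ 2) ^ k * (const (+ 8) ^ r * F′)))
        ≈⟨ S.*-congʳ (S.trans (S.sym (^-distrib-* Z (E * (M * P)) r)) (S.trans (^-congˡ r Z-inverse) (1^ r))) ⟩
      1# * (t ^ r * (const (+ 2) ^ k * (const (+ 8) ^ r * F′)))
        ≈⟨ S.*-identityˡ _ ⟩
      t ^ r * (const (+ 2) ^ k * (const (+ 8) ^ r * F′)) ∎
      where open ≋-Reasoning
    right : Z⁻¹ ^ r * (t ^ r * ((E * Z) ^ r * W)) ≋ t ^ r * (E ^ r * W)
    right = begin
      Z⁻¹ ^ r * (t ^ r * ((E * Z) ^ r * W))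
        ≈⟨ solve 4 (λ a b c d → a :* (b :* (c :* d)) := b :* ((c :* a) :* d)) S.refl
             (Z⁻¹ ^ r) (t ^ r) ((E * Z) ^ r) W ⟩
      t ^ r * ((E * Z) ^ r * Z⁻¹ ^ r * W)
        ≈⟨ S.*-congˡ (S.*-congʳ (S.trans (S.sym (^-distrib-* (E * Z) (E * (M * P)) r))
             (^-congˡ r (S.trans (S.*-assoc E Z _) (S.trans (S.*-congˡ Z-inverse) (S.*-identityʳ E)))))) ⟩
      t ^ r * (E ^ r * W) ∎
      where open ≋-Reasoning
    leading : ∀ i → i ℕ.< 4 → (+ 2) ℤ.^ k ℤ.* ((+ 8) ℤ.^ r ℤ.* at F′ i) ≡ at W i
    leading i i<4 = begin
      (+ 2) ℤ.^ k ℤ.* ((+ 8) ℤ.^ r ℤ.* at F′ i)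
        ≡⟨ cong ((+ 2) ℤ.^ k ℤ.*_) (^-const-* (+ 8) r F′ i) ⟨
      (+ 2) ℤ.^ k ℤ.* at (const (+ 8) ^ r * F′) i
        ≡⟨ ^-const-* (+ 2) k (const (+ 8) ^ r * F′) i ⟨
      at (const (+ 2) ^ k * (const (+ 8) ^ r * F′)) i
        ≡⟨ t^-shift r (const (+ 2) ^ k * (const (+ 8) ^ r * F′)) i ⟨
      at (t ^ r * (const (+ 2) ^ k * (const (+ 8) ^ r * F′))) (r ℕ.+ i)
        ≡⟨ coeff left (r ℕ.+ i) ⟨
      at (Z⁻¹ ^ r * (const (+ 2) ^ k * form δ L)) (r ℕ.+ i)
        ≡⟨ below (*-congˡ-≡[] (Z⁻¹ ^ r) eq) (r ℕ.+ i) (ℕ.+-monoʳ-< r i<4) ⟩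
      at (Z⁻¹ ^ r * (t ^ r * ((E * Z) ^ r * W))) (r ℕ.+ i)
        ≡⟨ coeff right (r ℕ.+ i) ⟩
      at (t ^ r * (E ^ r * W)) (r ℕ.+ i)
        ≡⟨ t^-shift r (E ^ r * W) i ⟩
      at (E ^ r * W) i
        ≡⟨ coeff (S.*-comm (E ^ r) W) i ⟩
      at (W * E ^ r) i
        ≡⟨ below (*-congˡ-≡[] W (E^-unit r)) i i<4 ⟩
      at (W * 1#) i
        ≡⟨ coeff (S.*-identityʳ W) i ⟩
      at W i ∎
      where open ≡.≡-Reasoning

-- Extraction of the top moment as a residue, and its closed form.

module Residue where

  open import Algebra.Bundles using (CommutativeRing)
  open import Data.Integer as ℤ using (ℤ; +_; 0ℤ; 1ℤ)
  import Data.Integer.Properties as ℤ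
  open import Data.Integer.Tactic.RingSolver using (solve-∀)
  open import Data.List using (upTo)
  open import Data.Nat as ℕ using (ℕ; zero; suc; z≤n; s≤s; _∸_)
  open import Data.Nat.Combinatorics using (_C_; nCn≡1)
  import Data.Nat.Properties as ℕ
  open import Data.Nat.Properties using (_≟_)
  open import Data.Product using (_×_; _,_; proj₁; proj₂)
  open import Relation.Binary.PropositionalEquality as ≡ using (_≡_; refl; cong; cong₂; sym; trans)
  open import Relation.Nullary using (does)
  open import Relation.Nullary.Decidable using (dec-true; dec-false)
  open Series
  open Sums
  open Count using (pascal)
  open Enumerator
  open Forms

  open CommutativeRing seriesRing using (_+_; _*_; _-_; -_; 1#; 0#)
  open SeriesSolver using (solve; _:=_; _:*_; _:+_; _:-_; _:^_; :-_; con)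

  -- The Euler operator t d/dt: unlike the derivative it shifts no index.
  θ : Series → Series
  at (θ f) n = + n ℤ.* at f n

  private
    leibniz : ∀ f g n → + n ℤ.* (f ⊛ g) n ≡
      ((λ i → + i ℤ.* f i) ⊛ g) n ℤ.+ (f ⊛ (λ i → + i ℤ.* g i)) n
    leibniz f g zero    = sym (trans
      (cong₂ ℤ._+_ (ℤ.*-zeroˡ (g 0)) (ℤ.*-zeroʳ (f 0))) refl)
    leibniz f g (suc n) = begin
      + suc n ℤ.* (f 0 ℤ.* g (suc n) ℤ.+ (tail f ⊛ g) n)
        ≡⟨ expand (+ n) (f 0) (g (suc n)) ((tail f ⊛ g) n) ⟩
      f 0 ℤ.* (+ suc n ℤ.* g (suc n)) ℤ.+ ((tail f ⊛ g) n ℤ.+ + n ℤ.* (tail f ⊛ g) n)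
        ≡⟨ cong (λ x → f 0 ℤ.* (+ suc n ℤ.* g (suc n)) ℤ.+ ((tail f ⊛ g) n ℤ.+ x)) (leibniz (tail f) g n) ⟩
      f 0 ℤ.* (+ suc n ℤ.* g (suc n)) ℤ.+ ((tail f ⊛ g) n ℤ.+
        (((λ i → + i ℤ.* tail f i) ⊛ g) n ℤ.+ (tail f ⊛ (λ i → + i ℤ.* g i)) n))
        ≡⟨ regroup (f 0 ℤ.* (+ suc n ℤ.* g (suc n))) ((tail f ⊛ g) n)
             (((λ i → + i ℤ.* tail f i) ⊛ g) n) ((tail f ⊛ (λ i → + i ℤ.* g i)) n) (g (suc n)) ⟩
      0ℤ ℤ.* g (suc n) ℤ.+ ((tail f ⊛ g) n ℤ.+ ((λ i → + i ℤ.* tail f i) ⊛ g) n)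
        ℤ.+ (f 0 ℤ.* (+ suc n ℤ.* g (suc n)) ℤ.+ (tail f ⊛ (λ i → + i ℤ.* g i)) n)
        ≡⟨ cong (λ x → 0ℤ ℤ.* g (suc n) ℤ.+ x ℤ.+ (f 0 ℤ.* (+ suc n ℤ.* g (suc n)) ℤ.+ (tail f ⊛ (λ i → + i ℤ.* g i)) n))
             (trans (sym (⊛-distribʳ g (tail f) (λ i → + i ℤ.* tail f i) n))
               (⊛-cong {g = g} (λ i → sym (ℤ.suc-* (+ i) (tail f i))) (λ _ → refl) n)) ⟩
      0ℤ ℤ.* g (suc n) ℤ.+ ((λ i → + suc i ℤ.* tail f i) ⊛ g) n
        ℤ.+ (f 0 ℤ.* (+ suc n ℤ.* g (suc n)) ℤ.+ (tail f ⊛ (λ i → + i ℤ.* g i)) n) ∎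
      where
      open ≡.≡-Reasoning
      expand : ∀ n a b c → (1ℤ ℤ.+ n) ℤ.* (a ℤ.* b ℤ.+ c) ≡ a ℤ.* ((1ℤ ℤ.+ n) ℤ.* b) ℤ.+ (c ℤ.+ n ℤ.* c)
      expand = solve-∀
      regroup : ∀ a b c d e → a ℤ.+ (b ℤ.+ (c ℤ.+ d)) ≡ 0ℤ ℤ.* e ℤ.+ (b ℤ.+ c) ℤ.+ (a ℤ.+ d)
      regroup = solve-∀

  θ-* : ∀ f g → θ (f * g) ≋ θ f * g + f * θ g
  θ-* f g = coeffs (leibniz (at f) (at g))

  θ-cong : ∀ {f g} → f ≋ g → θ f ≋ θ g
  θ-cong f≋g = coeffs λ n → cong (+ n ℤ.*_) (coeff f≋g n)

  θ-1 : θ 1# ≋ 0#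
  θ-1 = coeffs λ where
    zero    → refl
    (suc n) → ℤ.*-zeroʳ (+ suc n)

  θ-t : θ t ≋ t
  θ-t = coeffs λ where
    zero          → refl
    (suc zero)    → refl
    (suc (suc n)) → ℤ.*-zeroʳ (+ suc (suc n))

  θ-^ : ∀ h g → θ h ≋ g * h → ∀ l → θ (h ^ l) ≋ const (+ l) * (g * h ^ l)
  θ-^ h g θh zero    = S.trans θ-1 (S.sym (S.zeroˡ _))
  θ-^ h g θh (suc l) = begin
    θ (h * h ^ l)                            ≈⟨ θ-* h (h ^ l) ⟩
    θ h * h ^ l + h * θ (h ^ l)              ≈⟨ S.+-cong (S.*-congʳ θh) (S.*-congˡ (θ-^ h g θh l)) ⟩
    g * h * h ^ l + h * (const (+ l) * (g * h ^ l))
      ≈⟨ solve 4 (λ g h p l → g :* h :* p :+ h :* (l :* (g :* p)) := (con 1ℤ :+ l) :* (g :* (h :* p))) S.refl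
           g h (h ^ l) (const (+ l)) ⟩
    (const 1ℤ + const (+ l)) * (g * (h * h ^ l)) ≈⟨ S.*-congʳ (const-+ 1ℤ (+ l)) ⟨
    const (+ suc l) * (g * (h * h ^ l)) ∎
    where open ≋-Reasoning

  -- Dividing V^i X^(L-i) by Z^L gives (8t)^i times the power L - i of this series, so a form
  -- becomes, up to the factor h^L, a polynomial in t/h.
  h : Series
  h = M ^ 4 * Z⁻¹

  private
    θ-M : θ M ≋ - t
    θ-M = coeffs λ where
      zero          → refl
      (suc zero)    → refl
      (suc (suc n)) → ℤ.*-zeroʳ (+ suc (suc n))

    θ-Z : θ Z ≋ const (+ 2) * (t * t)
    θ-Z = S.trans (coeffs λ n → ℤ.*-distribˡ-+ (+ n) (at 1# n) (at (t * t) n)) (S.trans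
      (S.+-cong θ-1 (S.trans (θ-* t t) (S.+-cong (S.*-congʳ θ-t) (S.*-congˡ θ-t))))
      (solve 1 (λ t → con 0ℤ :+ (t :* t :+ t :* t) := con (+ 2) :* (t :* t)) S.refl t))

    θ-Z⁻¹ : θ Z⁻¹ ≋ - (const (+ 2) * (t * t)) * (Z⁻¹ * Z⁻¹)
    θ-Z⁻¹ = begin
      θ Z⁻¹                    ≈⟨ S.*-identityˡ _ ⟨
      1# * θ Z⁻¹               ≈⟨ S.*-congʳ Z-inverse ⟨
      Z * Z⁻¹ * θ Z⁻¹
        ≈⟨ solve 4 (λ z i x y → z :* i :* x := (y :* i :+ z :* x) :* i :+ :- y :* (i :* i)) S.refl Z Z⁻¹ (θ Z⁻¹) (const (+ 2) * (t * t)) ⟩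
      (const (+ 2) * (t * t) * Z⁻¹ + Z * θ Z⁻¹) * Z⁻¹ + - (const (+ 2) * (t * t)) * (Z⁻¹ * Z⁻¹)
        ≈⟨ S.+-congʳ (S.*-congʳ (S.trans (S.+-congʳ (S.*-congʳ (S.sym θ-Z)))
             (S.trans (S.sym (θ-* Z Z⁻¹)) (S.trans (θ-cong Z-inverse) θ-1)))) ⟩
      0# * Z⁻¹ + - (const (+ 2) * (t * t)) * (Z⁻¹ * Z⁻¹)
        ≈⟨ solve 2 (λ i y → con 0ℤ :* i :+ y := y) S.refl Z⁻¹ (- (const (+ 2) * (t * t)) * (Z⁻¹ * Z⁻¹)) ⟩
      - (const (+ 2) * (t * t)) * (Z⁻¹ * Z⁻¹) ∎
      where open ≋-Reasoning

    θ-M⁴ : θ (M ^ 4) ≋ - (const (+ 4) * t) * M ^ 3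
    θ-M⁴ = begin
      θ (M * (M * (M * (M * 1#))))
        ≈⟨ θ-* M _ ⟩
      θ M * M ^ 3 + M * θ (M ^ 3)
        ≈⟨ S.+-congˡ (S.*-congˡ (θ-* M _)) ⟩
      θ M * M ^ 3 + M * (θ M * M ^ 2 + M * θ (M ^ 2))
        ≈⟨ S.+-congˡ (S.*-congˡ (S.+-congˡ (S.*-congˡ (S.trans (θ-* M _)
             (S.+-congˡ (S.*-congˡ (S.trans (θ-* M _) (S.+-congˡ (S.*-congˡ θ-1)))))))))⟩
      θ M * M ^ 3 + M * (θ M * M ^ 2 + M * (θ M * M ^ 1 + M * (θ M * 1# + M * 0#)))
        ≈⟨ solve 2 (λ d m → d :* m :^ 3 :+ m :* (d :* m :^ 2 :+ m :* (d :* m :^ 1 :+ m :* (d :* con 1ℤ :+ m :* con 0ℤ)))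
             := con (+ 4) :* d :* m :^ 3) S.refl (θ M) M ⟩
      const (+ 4) * θ M * M ^ 3
        ≈⟨ S.*-congʳ (S.*-congˡ θ-M) ⟩
      const (+ 4) * - t * M ^ 3
        ≈⟨ solve 2 (λ t m → con (+ 4) :* :- t :* m := :- (con (+ 4) :* t) :* m) S.refl t (M ^ 3) ⟩
      - (const (+ 4) * t) * M ^ 3 ∎
      where open ≋-Reasoning

  -- The logarithmic derivative of h is 1 - E P⁴, from P³ = M Z + 4 t Z + 2 t² M.
  θ-h : θ h ≋ (1# - E * P ^ 4) * h
  θ-h = begin
    θ (M ^ 4 * Z⁻¹)
      ≈⟨ S.trans (θ-* (M ^ 4) Z⁻¹) (S.+-cong (S.*-congʳ θ-M⁴) (S.*-congˡ θ-Z⁻¹)) ⟩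
    - (const (+ 4) * t) * M ^ 3 * Z⁻¹ + M ^ 4 * (- (const (+ 2) * (t * t)) * (Z⁻¹ * Z⁻¹))
      ≈⟨ S.+-congʳ (S.*-congˡ (S.trans (S.sym (S.*-identityˡ _)) (S.*-congʳ (S.sym Z-inverse)))) ⟩
    - (const (+ 4) * t) * M ^ 3 * (Z * Z⁻¹ * Z⁻¹) + M ^ 4 * (- (const (+ 2) * (t * t)) * (Z⁻¹ * Z⁻¹))
      ≈⟨ solve 2 (λ t i → let m = con 1ℤ :- t; p = con 1ℤ :+ t; z = con 1ℤ :+ t :* t in
           :- (con (+ 4) :* t) :* m :^ 3 :* (z :* i :* i) :+ m :^ 4 :* (:- (con (+ 2) :* (t :* t)) :* (i :* i))
           := m :^ 4 :* (z :* i :* i) :- p :^ 3 :* m :^ 3 :* (i :* i)) S.refl t Z⁻¹ ⟩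
    M ^ 4 * (Z * Z⁻¹ * Z⁻¹) - P ^ 3 * M ^ 3 * (Z⁻¹ * Z⁻¹)
      ≈⟨ S.+-congʳ (S.*-congˡ (S.trans (S.*-congʳ Z-inverse) (S.*-identityˡ _))) ⟩
    M ^ 4 * Z⁻¹ - P ^ 3 * M ^ 3 * (E * (M * P) * Z⁻¹)
      ≈⟨ solve 4 (λ e m p i → m :^ 4 :* i :- p :^ 3 :* m :^ 3 :* (e :* (m :* p) :* i)
           := (con 1ℤ :- e :* p :^ 4) :* (m :^ 4 :* i)) S.refl E M P Z⁻¹ ⟩
    (1# - E * P ^ 4) * h ∎
    where open ≋-Reasoning

  -- θ f - l f has no term of degree l, and for f = h ^ l it is - l E P⁴ f.
  residue-vanish : ∀ l → at (E * P ^ 4 * h ^ suc l) (suc l) ≡ 0ℤ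
  residue-vanish l = ℤ.*-cancelˡ-≡ (+ suc l) _ 0ℤ (cancel (+ suc l) (at (h ^ suc l) (suc l)) _ (begin
    + suc l ℤ.* at (h ^ suc l) (suc l)
      ≡⟨ coeff (θ-^ h (1# - E * P ^ 4) θ-h (suc l)) (suc l) ⟩
    at (const (+ suc l) * ((1# - E * P ^ 4) * h ^ suc l)) (suc l)
      ≡⟨ at-const-* (+ suc l) ((1# - E * P ^ 4) * h ^ suc l) (suc l) ⟩
    + suc l ℤ.* at ((1# - E * P ^ 4) * h ^ suc l) (suc l)
      ≡⟨ cong (+ suc l ℤ.*_) (coeff (solve 2 (λ g p → (con 1ℤ :- g) :* p := p :- g :* p) S.refl (E * P ^ 4) (h ^ suc l)) (suc l)) ⟩
    + suc l ℤ.* (at (h ^ suc l) (suc l) ℤ.- at (E * P ^ 4 * h ^ suc l) (suc l)) ∎))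
    where
    open ≡.≡-Reasoning
    cancel : ∀ k a b → k ℤ.* a ≡ k ℤ.* (a ℤ.- b) → k ℤ.* b ≡ k ℤ.* 0ℤ
    cancel k a b eq = trans (expand k a b) (trans (cong (λ x → k ℤ.* a ℤ.- x) (sym eq))
      (trans (ℤ.+-inverseʳ (k ℤ.* a)) (sym (ℤ.*-zeroʳ k))))
      where
      expand : ∀ k a b → k ℤ.* b ≡ k ℤ.* a ℤ.- k ℤ.* (a ℤ.- b)
      expand = solve-∀

  -- E P⁴ dt/t is the logarithmic differential of t/h. Against it (h/t)^l has residue 1 for l = 0
  -- and 0 for l > 0, so the coefficient of t^L in the kernel times V^i X^(L-i) is nonzero only for
  -- i = L.
  kernel : ℕ → Series
  kernel L = E * P ^ 4 * Z⁻¹ ^ L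

  kernel-term : ∀ i l → kernel (i ℕ.+ l) * (V ^ i * X ^ l) ≋ const (+ 8) ^ i * (t ^ i * (E * P ^ 4 * h ^ l))
  kernel-term i l = begin
    E * P ^ 4 * Z⁻¹ ^ (i ℕ.+ l) * (V ^ i * X ^ l)
      ≈⟨ S.*-cong (S.*-congˡ (^-homo-* Z⁻¹ i l)) (V^-split i (X ^ l)) ⟩
    E * P ^ 4 * (Z⁻¹ ^ i * Z⁻¹ ^ l) * (const (+ 8) ^ i * (t ^ i * (Z ^ i * X ^ l)))
      ≈⟨ solve 7 (λ e a b c d z x → e :* (a :* b) :* (c :* (d :* (z :* x))) := (z :* a) :* (c :* (d :* (e :* (x :* b))))) S.refl
           (E * P ^ 4) (Z⁻¹ ^ i) (Z⁻¹ ^ l) (const (+ 8) ^ i) (t ^ i) (Z ^ i) (X ^ l) ⟩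
    Z ^ i * Z⁻¹ ^ i * (const (+ 8) ^ i * (t ^ i * (E * P ^ 4 * (X ^ l * Z⁻¹ ^ l))))
      ≈⟨ S.*-cong (S.trans (S.sym (^-distrib-* Z Z⁻¹ i)) (S.trans (^-congˡ i Z-inverse) (1^ i)))
           (S.*-congˡ (S.*-congˡ (S.*-congˡ (S.sym (^-distrib-* X Z⁻¹ l))))) ⟩
    1# * (const (+ 8) ^ i * (t ^ i * (E * P ^ 4 * h ^ l)))
      ≈⟨ S.*-identityˡ _ ⟩
    const (+ 8) ^ i * (t ^ i * (E * P ^ 4 * h ^ l)) ∎
    where
    open ≋-Reasoning

  kernel-expansion : ∀ N L → at (kernel L * expansion N L) L ≡ N L ℤ.* (+ 8) ℤ.^ L
  kernel-expansion N L = begin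
    at (kernel L * expansion N L) L
      ≡⟨ coeff (SumS.sum-*ˡ (kernel L) (upTo (suc L)) F) L ⟨
    at (SumS.sum (upTo (suc L)) (λ i → kernel L * F i)) L
      ≡⟨ coeff (SumS.sum-upTo-cong (suc L) (λ i i<1+L → term i (ℕ.s≤s⁻¹ i<1+L))) L ⟩
    at (SumS.sum (upTo (suc L)) G) L
      ≡⟨ sum-coeff (upTo (suc L)) G L ⟩
    Sumℤ.sum (upTo (suc L)) (λ i → at (G i) L)
      ≡⟨ Sumℤ.sum-upTo-cong (suc L) (λ i i<1+L → value i (ℕ.s≤s⁻¹ i<1+L)) ⟩
    Sumℤ.sum (upTo (suc L)) (λ i → Sumℤ.⟦ does (L ≟ i) ⟧ ℤ.* (N i ℤ.* (+ 8) ℤ.^ i))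
      ≡⟨ Sumℤ.sum-upTo-single (suc L) L (λ i → N i ℤ.* (+ 8) ℤ.^ i) ℕ.≤-refl ⟩
    N L ℤ.* (+ 8) ℤ.^ L ∎
    where
    open ≡.≡-Reasoning
    F G : ℕ → Series
    F i = const (N i) * (V ^ i * X ^ (L ∸ i))
    G i = const (N i) * (const (+ 8) ^ i * (t ^ i * (E * P ^ 4 * h ^ (L ∸ i))))
    term : ∀ i → i ℕ.≤ L → kernel L * F i ≋ G i
    term i i≤L = S.trans (solve 3 (λ k n v → k :* (n :* v) := n :* (k :* v)) S.refl (kernel L) (const (N i)) (V ^ i * X ^ (L ∸ i)))
      (S.*-congˡ (S.trans (S.*-congʳ (S.reflexive (cong kernel (sym (ℕ.m+[n∸m]≡n i≤L))))) (kernel-term i (L ∸ i))))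
    expand : ∀ i → at (G i) L ≡ N i ℤ.* ((+ 8) ℤ.^ i ℤ.* at (t ^ i * (E * P ^ 4 * h ^ (L ∸ i))) L)
    expand i = trans (at-const-* (N i) (const (+ 8) ^ i * (t ^ i * (E * P ^ 4 * h ^ (L ∸ i)))) L)
      (cong (N i ℤ.*_) (^-const-* (+ 8) i (t ^ i * (E * P ^ 4 * h ^ (L ∸ i))) L))
    coefficient : ∀ i l → i ℕ.+ l ≡ L → at (t ^ i * (E * P ^ 4 * h ^ l)) L ≡ Sumℤ.⟦ does (L ≟ i) ⟧
    coefficient i zero refl rewrite dec-true (i ℕ.+ 0 ≟ i) (ℕ.+-identityʳ i) =
      trans (t^-shift i (E * P ^ 4 * h ^ 0) 0) refl
    coefficient i (suc l) refl rewrite dec-false (i ℕ.+ suc l ≟ i) (ℕ.m+1+n≢m i) =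
      trans (t^-shift i (E * P ^ 4 * h ^ suc l) (suc l)) (residue-vanish l)
    value : ∀ i → i ℕ.≤ L → at (G i) L ≡ Sumℤ.⟦ does (L ≟ i) ⟧ ℤ.* (N i ℤ.* (+ 8) ℤ.^ i)
    value i i≤L = trans (expand i) (trans
      (cong (λ x → N i ℤ.* ((+ 8) ℤ.^ i ℤ.* x)) (coefficient i (L ∸ i) (ℕ.m+[n∸m]≡n i≤L)))
      (reorder (N i) ((+ 8) ℤ.^ i) Sumℤ.⟦ does (L ≟ i) ⟧))
      where
      reorder : ∀ a b c → a ℤ.* (b ℤ.* c) ≡ c ℤ.* (a ℤ.* b)
      reorder = solve-∀

  -- Reading off the coefficient of t^L sees both sides modulo t^(L+1) only, which is all that a
  -- truncated enumerator provides.
  residue-moment : ∀ a L k c W → const (+ 2) ^ k * form a L ≡[ suc L ] const (+ 2) ^ c * W →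
    (+ 2) ℤ.^ k ℤ.* (moment a L L ℤ.* (+ 8) ℤ.^ L) ≡ (+ 2) ℤ.^ c ℤ.* at (kernel L * W) L
  residue-moment a L k c W eq = begin
    (+ 2) ℤ.^ k ℤ.* (moment a L L ℤ.* (+ 8) ℤ.^ L)
      ≡⟨ cong ((+ 2) ℤ.^ k ℤ.*_) (trans (sym (kernel-expansion (moment a L) L))
           (coeff (S.*-congˡ {kernel L} (S.sym (form-expansion a L))) L)) ⟩
    (+ 2) ℤ.^ k ℤ.* at (kernel L * form a L) L
      ≡⟨ move k (form a L) ⟨
    at (kernel L * (const (+ 2) ^ k * form a L)) L
      ≡⟨ below (*-congˡ-≡[] (kernel L) eq) L ℕ.≤-refl ⟩
    at (kernel L * (const (+ 2) ^ c * W)) L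
      ≡⟨ move c W ⟩
    (+ 2) ℤ.^ c ℤ.* at (kernel L * W) L ∎
    where
    open ≡.≡-Reasoning
    move : ∀ k f → at (kernel L * (const (+ 2) ^ k * f)) L ≡ (+ 2) ℤ.^ k ℤ.* at (kernel L * f) L
    move k f = trans (coeff (solve 3 (λ a b c → a :* (b :* c) := b :* (a :* c)) S.refl (kernel L) (const (+ 2) ^ k) f) L)
      (^-const-* (+ 2) k (kernel L * f) L)

  -- The exponent 3 + L is d - 1 for d = 4 + L. The negative powers of Z in the kernel leave just
  -- Z³.
  kernel-EZ : ∀ L → kernel L * (E * Z) ^ (3 ℕ.+ L) ≋ E ^ (4 ℕ.+ L) * (P ^ 4 * Z ^ 3)
  kernel-EZ L = begin
    E * P ^ 4 * Z⁻¹ ^ L * ((E * Z) * ((E * Z) * ((E * Z) * (E * Z) ^ L)))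
      ≈⟨ solve 5 (λ e p z i q → e :* p :^ 4 :* i :* (e :* z :* (e :* z :* (e :* z :* q))) :=
           e :* (e :* (e :* (e :* (q :* i)))) :* (p :^ 4 :* z :^ 3)) S.refl E P Z (Z⁻¹ ^ L) ((E * Z) ^ L) ⟩
    E * (E * (E * (E * ((E * Z) ^ L * Z⁻¹ ^ L)))) * (P ^ 4 * Z ^ 3)
      ≈⟨ S.*-congʳ (S.*-congˡ (S.*-congˡ (S.*-congˡ (S.*-congˡ (S.trans (S.sym (^-distrib-* (E * Z) Z⁻¹ L))
           (^-congˡ L (S.trans (S.*-assoc E Z Z⁻¹) (S.trans (S.*-congˡ Z-inverse) (S.*-identityʳ E))))))))) ⟩
    E ^ (4 ℕ.+ L) * (P ^ 4 * Z ^ 3) ∎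
    where open ≋-Reasoning

  E-step : ∀ f → E * f ≋ f + t ^ 4 * (E * f)
  E-step f = begin
    E * f
      ≈⟨ solve 3 (λ e f t → e :* f := e :* ((con 1ℤ :- t) :* ((con 1ℤ :+ t) :* (con 1ℤ :+ t :* t))) :* f :+ t :^ 4 :* (e :* f))
           S.refl E f t ⟩
    E * (M * (P * Z)) * f + t ^ 4 * (E * f)
      ≈⟨ S.+-congʳ (S.trans (S.*-congʳ E-inverse) (S.*-identityˡ f)) ⟩
    f + t ^ 4 * (E * f) ∎
    where open ≋-Reasoning

  E-step-at : ∀ f n → at (E * f) (4 ℕ.+ n) ≡ at f (4 ℕ.+ n) ℤ.+ at (E * f) n
  E-step-at f n = trans (coeff (E-step f) (4 ℕ.+ n)) (cong (ℤ._+_ (at f (4 ℕ.+ n))) (t^-shift 4 (E * f) n))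

  -- Multiplication by `E` forms partial sums in steps of four, and Pascal's rule sums the
  -- binomials: this is the negative binomial series of (1 - t⁴)^(-c-1).
  E^-at : ∀ c i → at (E ^ suc c) (i ℕ.* 4) ≡ + ((c ℕ.+ i) C i)
  E^-at zero zero = refl
  E^-at zero (suc i) = trans (E-step-at 1# (i ℕ.* 4)) (trans (ℤ.+-identityˡ (at (E ^ 1) (i ℕ.* 4)))
    (trans (E^-at zero i) (trans (cong +_ (nCn≡1 i)) (cong +_ (sym (nCn≡1 (suc i)))))))
  E^-at (suc c) zero = trans (ℤ.*-identityˡ _) (E^-at c zero)
  E^-at (suc c) (suc i) = trans (E-step-at (E ^ suc c) (i ℕ.* 4))
    (trans (cong₂ ℤ._+_ (E^-at c (suc i)) (E^-at (suc c) i))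
    (trans (cong (λ n → + ((c ℕ.+ suc i) C suc i) ℤ.+ + (n C i)) (sym (ℕ.+-suc c i)))
    (trans (ℤ.+-comm (+ ((c ℕ.+ suc i) C suc i)) (+ ((c ℕ.+ suc i) C i))) (pascal (c ℕ.+ suc i) i))))

  record InFourthPowers (f : Series) : Set where
    field off : ∀ i → at f (1 ℕ.+ i ℕ.* 4) ≡ 0ℤ × at f (2 ℕ.+ i ℕ.* 4) ≡ 0ℤ × at f (3 ℕ.+ i ℕ.* 4) ≡ 0ℤ
  open InFourthPowers

  E^-fourthPowers : ∀ c → InFourthPowers (E ^ c)
  off (E^-fourthPowers zero) i = refl , refl , refl
  off (E^-fourthPowers (suc c)) zero with off (E^-fourthPowers c) 0
  ... | p₁ , p₂ , p₃ = low 1 (s≤s (s≤s z≤n)) p₁ , low 2 (s≤s (s≤s (s≤s z≤n))) p₂ , low 3 ℕ.≤-refl p₃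
    where
    low : ∀ j → j ℕ.< 4 → at (E ^ c) j ≡ 0ℤ → at (E ^ suc c) j ≡ 0ℤ
    low j j<4 eq = trans (coeff (E-step (E ^ c)) j) (cong₂ ℤ._+_ eq (t^-below 4 (E ^ suc c) j j<4))
  off (E^-fourthPowers (suc c)) (suc i) with off (E^-fourthPowers c) (suc i) | off (E^-fourthPowers (suc c)) i
  ... | p₁ , p₂ , p₃ | q₁ , q₂ , q₃ =
      trans (E-step-at (E ^ c) (1 ℕ.+ i ℕ.* 4)) (cong₂ ℤ._+_ p₁ q₁)
    , trans (E-step-at (E ^ c) (2 ℕ.+ i ℕ.* 4)) (cong₂ ℤ._+_ p₂ q₂)
    , trans (E-step-at (E ^ c) (3 ℕ.+ i ℕ.* 4)) (cong₂ ℤ._+_ p₃ q₃)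

  +-fourthPowers : ∀ {f g} → InFourthPowers f → InFourthPowers g → InFourthPowers (f + g)
  off (+-fourthPowers F G) i with off F i | off G i
  ... | p₁ , p₂ , p₃ | q₁ , q₂ , q₃ = cong₂ ℤ._+_ p₁ q₁ , cong₂ ℤ._+_ p₂ q₂ , cong₂ ℤ._+_ p₃ q₃

  const-fourthPowers : ∀ a {f} → InFourthPowers f → InFourthPowers (const a * f)
  off (const-fourthPowers a {f} F) i with off F i
  ... | p₁ , p₂ , p₃ = scale p₁ , scale p₂ , scale p₃
    where
    scale : ∀ {j} → at f j ≡ 0ℤ → at (const a * f) j ≡ 0ℤ
    scale {j} eq = trans (at-const-* a f j) (trans (cong (a ℤ.*_) eq) (ℤ.*-zeroʳ a))

  t⁴-fourthPowers : ∀ {f} → InFourthPowers f → InFourthPowers (t ^ 4 * f)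
  off (t⁴-fourthPowers {f} F) zero =
      t^-below 4 f 1 (s≤s (s≤s z≤n)) , t^-below 4 f 2 (s≤s (s≤s (s≤s z≤n))) , t^-below 4 f 3 ℕ.≤-refl
  off (t⁴-fourthPowers {f} F) (suc i) with off F i
  ... | p₁ , p₂ , p₃ =
      trans (t^-shift 4 f (1 ℕ.+ i ℕ.* 4)) p₁
    , trans (t^-shift 4 f (2 ℕ.+ i ℕ.* 4)) p₂
    , trans (t^-shift 4 f (3 ℕ.+ i ℕ.* 4)) p₃

  off-fourthPowers : ∀ {f} → InFourthPowers f → ∀ i →
    at (t ^ 1 * f) (i ℕ.* 4) ≡ 0ℤ × at (t ^ 2 * f) (i ℕ.* 4) ≡ 0ℤ × at (t ^ 3 * f) (i ℕ.* 4) ≡ 0ℤ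
  off-fourthPowers {f} F zero =
    t^-below 1 f 0 (s≤s z≤n) , t^-below 2 f 0 (s≤s z≤n) , t^-below 3 f 0 (s≤s z≤n)
  off-fourthPowers {f} F (suc i) with off F i
  ... | p₁ , p₂ , p₃ =
      trans (t^-shift 1 f (3 ℕ.+ i ℕ.* 4)) p₃
    , trans (t^-shift 2 f (2 ℕ.+ i ℕ.* 4)) p₂
    , trans (t^-shift 3 f (1 ℕ.+ i ℕ.* 4)) p₁

  -- The effect of multiplication by t⁴ on a sequence indexed by the multiples of four.
  delay : (ℕ → ℕ) → ℕ → ℕ
  delay f zero    = 0
  delay f (suc i) = f i

  multichoose : ℕ → ℕ → ℕ
  multichoose c i = (c ℕ.+ i) C i

  residue : ℕ → ℕ → ℕ
  residue c m = multichoose c m ℕ.+ 22 ℕ.* delay (multichoose c) m ℕ.+ 9 ℕ.* delay (delay (multichoose c)) m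

  t⁴-delay : ∀ f e → (∀ i → at f (i ℕ.* 4) ≡ + e i) → ∀ i → at (t ^ 4 * f) (i ℕ.* 4) ≡ + delay e i
  t⁴-delay f e eq zero    = t^-below 4 f 0 (s≤s z≤n)
  t⁴-delay f e eq (suc i) = trans (t^-shift 4 f (i ℕ.* 4)) (eq i)

  -- Of P⁴ Z³ only the terms 1 + 22 t⁴ + 9 t⁸ contribute.
  residue-coefficient : ∀ c m → at (E ^ suc c * (P ^ 4 * Z ^ 3)) (m ℕ.* 4) ≡ + residue c m
  residue-coefficient c m = begin
    at (f * (P ^ 4 * Z ^ 3)) i
      ≡⟨ coeff (solve 2 (λ f t → f :* ((con 1ℤ :+ t) :^ 4 :* (con 1ℤ :+ t :* t) :^ 3) :=
           (f :+ con (+ 22) :* (t :^ 4 :* f) :+ con (+ 9) :* (t :^ 4 :* (t :^ 4 :* f)))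
           :+ (t :^ 1 :* (con (+ 4) :* f :+ con (+ 24) :* (t :^ 4 :* f) :+ con (+ 4) :* (t :^ 4 :* (t :^ 4 :* f)))
           :+ t :^ 2 :* (con (+ 9) :* f :+ con (+ 22) :* (t :^ 4 :* f) :+ con (+ 1) :* (t :^ 4 :* (t :^ 4 :* f)))
           :+ t :^ 3 :* (con (+ 16) :* f :+ con (+ 16) :* (t :^ 4 :* f) :+ con (+ 0) :* (t :^ 4 :* (t :^ 4 :* f)))))
           S.refl f t) i ⟩
    at f i ℤ.+ at (const (+ 22) * f₁) i ℤ.+ at (const (+ 9) * f₂) i
      ℤ.+ (at (t ^ 1 * q (+ 4) (+ 24) (+ 4)) i ℤ.+ at (t ^ 2 * q (+ 9) (+ 22) (+ 1)) i ℤ.+ at (t ^ 3 * q (+ 16) (+ 16) (+ 0)) i)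
      ≡⟨ cong₂ ℤ._+_ (cong₂ ℤ._+_ (cong₂ ℤ._+_ (E^-at c m)
             (trans (at-const-* (+ 22) f₁ i) (cong ((+ 22) ℤ.*_) (e₁ m))))
             (trans (at-const-* (+ 9) f₂ i) (cong ((+ 9) ℤ.*_) (t⁴-delay f₁ _ e₁ m))))
           (cong₂ ℤ._+_ (cong₂ ℤ._+_ (proj₁ (off-fourthPowers (Q (+ 4) (+ 24) (+ 4)) m))
             (proj₁ (proj₂ (off-fourthPowers (Q (+ 9) (+ 22) (+ 1)) m))))
             (proj₂ (proj₂ (off-fourthPowers (Q (+ 16) (+ 16) (+ 0)) m)))) ⟩
    + multichoose c m ℤ.+ (+ 22) ℤ.* + delay (multichoose c) m ℤ.+ (+ 9) ℤ.* + delay (delay (multichoose c)) m ℤ.+ 0ℤ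
      ≡⟨ ℤ.+-identityʳ _ ⟩
    + multichoose c m ℤ.+ (+ 22) ℤ.* + delay (multichoose c) m ℤ.+ (+ 9) ℤ.* + delay (delay (multichoose c)) m
      ≡⟨ cong₂ (λ x y → + multichoose c m ℤ.+ x ℤ.+ y)
           (sym (ℤ.pos-* 22 (delay (multichoose c) m))) (sym (ℤ.pos-* 9 (delay (delay (multichoose c)) m))) ⟩
    + residue c m ∎
    where
    open ≡.≡-Reasoning
    i = m ℕ.* 4
    f = E ^ suc c
    f₁ = t ^ 4 * f
    f₂ = t ^ 4 * f₁
    e₁ = t⁴-delay f (multichoose c) (E^-at c)
    q : ℤ → ℤ → ℤ → Series
    q x y z = const x * f + const y * f₁ + const z * f₂
    Q : ∀ x y z → InFourthPowers (q x y z)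
    Q x y z = +-fourthPowers (+-fourthPowers (const-fourthPowers x F₀)
      (const-fourthPowers y (t⁴-fourthPowers F₀))) (const-fourthPowers z (t⁴-fourthPowers (t⁴-fourthPowers F₀)))
      where F₀ = E^-fourthPowers (suc c)

-- Weights of an extremal code and truncation of its enumerator.

module CodeForms where

  open import Algebra.Bundles using (CommutativeRing)
  open import Data.Bool using (Bool; true; false; not)
  open import Data.Fin.Subset using (∣_∣; _∩_; ∁; ⊤)
  open import Data.Fin.Subset.Properties using (∣∁p∣≡n∸∣p∣; ∣p∣≤n; ∣p∩q∣≤∣p∣; ∩-identityˡ)
  open import Data.Integer as ℤ using (ℤ; +_; 0ℤ; 1ℤ; -1ℤ)
  import Data.Integer.Properties as ℤ
  open import Data.List using (List; []; _∷_; upTo)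
  open import Data.Nat as ℕ using (ℕ; zero; suc; s≤s; _∸_)
  open import Data.Nat.Combinatorics using (_C_)
  open import Data.Nat.Divisibility using (_∣_; divides; ∣m+n∣m⇒∣n)
  import Data.Nat.Properties as ℕ
  open import Data.Nat.Properties using (_≟_)
  open import Data.Product using (_×_; _,_; proj₁; proj₂; ∃-syntax)
  open import Data.Vec using ([]; _∷_)
  open import Relation.Binary.PropositionalEquality as ≡ using (_≡_; _≢_; refl; cong; cong₂; sym; trans)
  open import Relation.Nullary using (contradiction; does; yes; no)
  open import Relation.Nullary.Decidable using (dec-true; dec-false)
  open Series
  open Sums
  open Count
  open Design
  open Enumerator
  open Forms

  open CommutativeRing seriesRing using (_+_; _*_; _-_; -_; 1#; 0#)
  open SeriesSolver using (solve; _:=_; _:*_; _:+_; _:-_; _:^_; :-_; con)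

  odd : ℕ → Bool
  odd zero    = false
  odd (suc n) = not (odd n)

  dot-odd : ∀ {n} (x y : Word n) → dot x y ≡ odd ∣ x ∩ y ∣
  dot-odd []          []          = refl
  dot-odd (true ∷ x)  (true ∷ y)  = cong not (dot-odd x y)
  dot-odd (true ∷ x)  (false ∷ y) = dot-odd x y
  dot-odd (false ∷ x) (_ ∷ y)     = dot-odd x y

  odd-4* : ∀ q → odd (q ℕ.* 4) ≡ false
  odd-4* zero    = refl
  odd-4* (suc q) rewrite odd-4* q = refl

  ⊕-⊤ : ∀ {n} (c : Word n) → c ⊕ ⊤ ≡ ∁ c
  ⊕-⊤ []          = refl
  ⊕-⊤ (true ∷ c)  = cong (false ∷_) (⊕-⊤ c)
  ⊕-⊤ (false ∷ c) = cong (true ∷_) (⊕-⊤ c)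

  wt-partition : ∀ {n} (T c : Word n) → ∣ T ∩ c ∣ ℕ.+ ∣ ∁ T ∩ c ∣ ≡ wt c
  wt-partition []          []          = refl
  wt-partition (true ∷ T)  (true ∷ c)  = cong suc (wt-partition T c)
  wt-partition (true ∷ T)  (false ∷ c) = wt-partition T c
  wt-partition (false ∷ T) (true ∷ c)  = trans (ℕ.+-suc _ _) (cong suc (wt-partition T c))
  wt-partition (false ∷ T) (false ∷ c) = wt-partition T c

  ⊑-empty : ∀ {n} (T c : Word n) → wt T ≢ 0 → wt c ≡ 0 → (T ⊑ c) ≡ false
  ⊑-empty []          []          T≢0 _   = contradiction refl T≢0
  ⊑-empty (true ∷ T)  (false ∷ c) T≢0 c≡0 = refl
  ⊑-empty (false ∷ T) (false ∷ c) T≢0 c≡0 = ⊑-empty T c T≢0 c≡0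

  ⊑-full : ∀ {n} (T c : Word n) → wt c ≡ n → (T ⊑ c) ≡ true
  ⊑-full []      []      _   = refl
  ⊑-full {suc n} (_ ∷ T) (false ∷ c) c≡n =
    contradiction (ℕ.≤-reflexive (sym c≡n)) (ℕ.<⇒≱ (s≤s (∣p∣≤n c)))
  ⊑-full (true ∷ T)  (true ∷ c) c≡n = ⊑-full T c (ℕ.suc-injective c≡n)
  ⊑-full (false ∷ T) (true ∷ c) c≡n = ⊑-full T c (ℕ.suc-injective c≡n)

  sum-≡[] : ∀ {A : Set} (xs : List A) {f g : A → Series} {k} → (∀ x → f x ≡[ k ] g x) →
    SumS.sum xs f ≡[ k ] SumS.sum xs g
  sum-≡[] []       eq = ≋⇒≡[] _ S.refl
  sum-≡[] (x ∷ xs) eq = upTo< λ i i<k → cong₂ ℤ._+_ (below (eq x) i i<k) (below (sum-≡[] xs eq) i i<k)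

  module _ {n : ℕ} (𝒞 : Code n) (linear : IsLinear 𝒞) (selfDual : IsSelfDual 𝒞) (doublyEven : IsDoublyEven 𝒞) where

    meet-even : ∀ {b c} → b ∈C 𝒞 → c ∈C 𝒞 → odd ∣ b ∩ c ∣ ≡ false
    meet-even {b} {c} b∈ c∈ = trans (sym (dot-odd b c)) (proj₁ (selfDual b) b∈ c c∈)

    -- All weights are even, so the all-one word is orthogonal to the code. It makes the code closed
    -- under complements.
    ⊤∈ : ⊤ ∈C 𝒞
    ⊤∈ = proj₂ (selfDual ⊤) λ c c∈ → trans (dot-odd ⊤ c)
      (trans (cong (λ x → odd ∣ x ∣) (∩-identityˡ c)) (even c (doublyEven c c∈)))
      where
      even : ∀ c → 4 ∣ wt c → odd (wt c) ≡ false
      even c (divides q eq) = trans (cong odd eq) (odd-4* q)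

    ∁∈ : ∀ {c} → c ∈C 𝒞 → ∁ c ∈C 𝒞
    ∁∈ {c} c∈ = trans (cong 𝒞 (sym (⊕-⊤ c))) (proj₂ linear c ⊤ c∈ ⊤∈)

    -- The minimum weight, applied to the complementary codeword, also bounds the weight by n - d;
    -- divisibility by 4 leaves the steps between the two bounds.
    codeword-weight : ∀ {d L} → n ≡ d ℕ.+ (d ℕ.+ L ℕ.* 4) → 4 ∣ d → (∀ c → c ∈C 𝒞 → 0 ℕ.< wt c → d ℕ.≤ wt c) →
      ∀ c → c ∈C 𝒞 → wt c ≢ 0 → wt c ≢ n → ∃[ j ] (j ℕ.≤ L × wt c ≡ d ℕ.+ j ℕ.* 4)
    codeword-weight {d} {L} n≡ 4∣d min c c∈ c≢0 c≢n = from (∣m+n∣m⇒∣n 4∣wt 4∣d)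
      where
      d≤wt : d ℕ.≤ wt c
      d≤wt = min c c∈ (ℕ.n≢0⇒n>0 c≢0)
      d≤∁ : d ℕ.≤ n ∸ wt c
      d≤∁ = ≡.subst (d ℕ.≤_) (∣∁p∣≡n∸∣p∣ c) (min (∁ c) (∁∈ c∈)
        (≡.subst (0 ℕ.<_) (sym (∣∁p∣≡n∸∣p∣ c)) (ℕ.m<n⇒0<n∸m (ℕ.≤∧≢⇒< (∣p∣≤n c) c≢n))))
      e = wt c ∸ d
      wt≡ : d ℕ.+ e ≡ wt c
      wt≡ = ℕ.m+[n∸m]≡n d≤wt
      4∣wt : 4 ∣ d ℕ.+ e
      4∣wt = ≡.subst (4 ∣_) (sym wt≡) (doublyEven c c∈)
      e≤ : e ℕ.≤ L ℕ.* 4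
      e≤ = ℕ.+-cancelˡ-≤ d e (L ℕ.* 4) (ℕ.+-cancelˡ-≤ d (d ℕ.+ e) (d ℕ.+ L ℕ.* 4) (begin
        d ℕ.+ (d ℕ.+ e)         ≡⟨ cong (d ℕ.+_) wt≡ ⟩
        d ℕ.+ wt c              ≤⟨ ℕ.+-monoˡ-≤ (wt c) d≤∁ ⟩
        n ∸ wt c ℕ.+ wt c       ≡⟨ ℕ.m∸n+n≡m (∣p∣≤n c) ⟩
        n                       ≡⟨ n≡ ⟩
        d ℕ.+ (d ℕ.+ L ℕ.* 4)   ∎))
        where open ℕ.≤-Reasoning
      from : 4 ∣ e → ∃[ j ] (j ℕ.≤ L × wt c ≡ d ℕ.+ j ℕ.* 4)
      from (divides j eq) = j , ℕ.*-cancelʳ-≤ j L 4 (≡.subst (ℕ._≤ L ℕ.* 4) eq e≤) ,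
        trans (sym wt≡) (cong (d ℕ.+_) eq)

  -- `d`, `L` and `k` stand for 4m + 4, 4m and 12m + 4. They stay variables tied together by
  -- equations, so that the series arguments do not compute with them.
  record Extremal {n : ℕ} (𝒞 : Code n) (d L k : ℕ) : Set where
    field
      linear     : IsLinear 𝒞
      selfDual   : IsSelfDual 𝒞
      doublyEven : IsDoublyEven 𝒞
      minimum    : ∀ c → c ∈C 𝒞 → 0 ℕ.< wt c → d ℕ.≤ wt c
      4∣d        : 4 ∣ d
      n≡k+k      : n ≡ k ℕ.+ k
      n≡d+d+4L   : n ≡ d ℕ.+ (d ℕ.+ L ℕ.* 4)
      d>0        : 0 ℕ.< d

    weights-of : ∀ c → c ∈C 𝒞 → wt c ≢ 0 → wt c ≢ n → ∃[ j ] (j ℕ.≤ L × wt c ≡ d ℕ.+ j ℕ.* 4)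
    weights-of = codeword-weight 𝒞 linear selfDual doublyEven n≡d+d+4L 4∣d minimum

    -- Apart from the zero and the all-one word, on which `b` must vanish, a codeword of weight d +
    -- 4j has enumerator (MP)^d X^j Y^(L-j). The common factor splits off and leaves a form of
    -- degree L.
    group : ∀ (b : Word n → ℤ) → (∀ c → wt c ≡ 0 → b c ≡ 0ℤ) → (∀ c → wt c ≡ n → b c ≡ 0ℤ) →
      SumS.sum (allWords n) (λ c → SumS.⟦ 𝒞 c ⟧ * (const (b c) * (M ^ wt c * P ^ ∣ ∁ c ∣)))
      ≋ (M * P) ^ d * form (λ j → total 𝒞 (d ℕ.+ j ℕ.* 4) b) L
    group b b₀ bₙ = begin
      SumS.sum W (λ c → SumS.⟦ 𝒞 c ⟧ * (const (b c) * (M ^ wt c * P ^ ∣ ∁ c ∣)))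
        ≈⟨ SumS.sum-cong W term ⟩
      SumS.sum W (λ c → (M * P) ^ d * SumS.sum U (λ j → const (e j c) * (X ^ j * Y ^ (L ∸ j))))
        ≈⟨ SumS.sum-*ˡ ((M * P) ^ d) W _ ⟩
      (M * P) ^ d * SumS.sum W (λ c → SumS.sum U (λ j → const (e j c) * (X ^ j * Y ^ (L ∸ j))))
        ≈⟨ S.*-congˡ (SumS.sum-swap W U _) ⟩
      (M * P) ^ d * SumS.sum U (λ j → SumS.sum W (λ c → const (e j c) * (X ^ j * Y ^ (L ∸ j))))
        ≈⟨ S.*-congˡ (SumS.sum-cong U (λ j → S.trans (SumS.sum-*ʳ (X ^ j * Y ^ (L ∸ j)) W _)
             (S.*-congʳ (S.sym (const-sum W (e j)))))) ⟩
      (M * P) ^ d * form (λ j → total 𝒞 (d ℕ.+ j ℕ.* 4) b) L ∎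
      where
      open ≋-Reasoning
      W = allWords n
      U = upTo (suc L)
      e : ℕ → Word n → ℤ
      e j c = Sumℤ.⟦ 𝒞 c ⟧ ℤ.* (weigh (d ℕ.+ j ℕ.* 4) c ℤ.* b c)
      Grouped : Word n → Set
      Grouped c = SumS.⟦ 𝒞 c ⟧ * (const (b c) * (M ^ wt c * P ^ ∣ ∁ c ∣)) ≋
        (M * P) ^ d * SumS.sum U (λ j → const (e j c) * (X ^ j * Y ^ (L ∸ j)))
      none : ∀ c → (∀ j → e j c ≡ 0ℤ) → SumS.⟦ 𝒞 c ⟧ * const (b c) ≋ 0# → Grouped c
      none c e≡0 b≡0 = S.trans (S.trans (S.sym (S.*-assoc _ _ _)) (S.trans (S.*-congʳ b≡0) (S.zeroˡ _)))
        (S.sym (S.trans (S.*-congˡ (S.trans (SumS.sum-cong U (λ j → S.trans (S.*-congʳ (S.reflexive (cong const (e≡0 j)))) (S.zeroˡ _)))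
          (SumS.sum-zero U))) (S.zeroʳ _)))
      vanishing : ∀ c → b c ≡ 0ℤ → Grouped c
      vanishing c b≡0 = none c
        (λ j → trans (cong (λ x → Sumℤ.⟦ 𝒞 c ⟧ ℤ.* (weigh (d ℕ.+ j ℕ.* 4) c ℤ.* x)) b≡0)
          (trans (cong (Sumℤ.⟦ 𝒞 c ⟧ ℤ.*_) (ℤ.*-zeroʳ (weigh (d ℕ.+ j ℕ.* 4) c))) (ℤ.*-zeroʳ Sumℤ.⟦ 𝒞 c ⟧)))
        (S.trans (S.*-congˡ (S.reflexive (cong const b≡0))) (S.zeroʳ _))
      term : ∀ c → Grouped c
      term c = cases (𝒞 c) refl
        where
        cases : ∀ x → 𝒞 c ≡ x → Grouped c
        cases false c∉ = none c (λ j → cong (λ x → Sumℤ.⟦ x ⟧ ℤ.* (weigh (d ℕ.+ j ℕ.* 4) c ℤ.* b c)) c∉)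
          (S.trans (S.*-congʳ (S.reflexive (cong SumS.⟦_⟧ c∉))) (S.zeroˡ _))
        cases true c∈ with wt c ≟ 0 | wt c ≟ n
        ... | yes c≡0 | _       = vanishing c (b₀ c c≡0)
        ... | no _    | yes c≡n = vanishing c (bₙ c c≡n)
        ... | no c≢0  | no c≢n  = main (weights-of c c∈ c≢0 c≢n)
          where
          main : ∃[ j ] (j ℕ.≤ L × wt c ≡ d ℕ.+ j ℕ.* 4) → Grouped c
          main (j , j≤L , wt≡) = S.trans lhs (S.sym (S.*-congˡ rhs))
            where
            ∁≡ : ∣ ∁ c ∣ ≡ d ℕ.+ (L ∸ j) ℕ.* 4
            ∁≡ = trans (∣∁p∣≡n∸∣p∣ c) (trans (cong₂ _∸_ n≡′ wt≡) (ℕ.m+n∸m≡n (d ℕ.+ j ℕ.* 4) _))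
              where
              n≡′ : n ≡ d ℕ.+ j ℕ.* 4 ℕ.+ (d ℕ.+ (L ∸ j) ℕ.* 4)
              n≡′ = trans n≡d+d+4L (trans (cong (λ l → d ℕ.+ (d ℕ.+ l ℕ.* 4)) (sym (ℕ.m+[n∸m]≡n j≤L)))
                (rearrange d j (L ∸ j)))
                where
                open import Data.Nat.Tactic.RingSolver using () renaming (solve-∀ to solveℕ-∀)
                rearrange : ∀ d j l → d ℕ.+ (d ℕ.+ (j ℕ.+ l) ℕ.* 4) ≡ d ℕ.+ j ℕ.* 4 ℕ.+ (d ℕ.+ l ℕ.* 4)
                rearrange = solveℕ-∀
            pow : ∀ f j → f ^ (d ℕ.+ j ℕ.* 4) ≋ f ^ d * (f ^ 4) ^ j
            pow f j = S.trans (^-homo-* f d (j ℕ.* 4)) (S.*-congˡ (S.trans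
              (S.reflexive (cong (f ^_) (ℕ.*-comm j 4))) (S.sym (^-assocʳ f 4 j))))
            lhs : SumS.⟦ 𝒞 c ⟧ * (const (b c) * (M ^ wt c * P ^ ∣ ∁ c ∣)) ≋
              (M * P) ^ d * (const (b c) * (X ^ j * Y ^ (L ∸ j)))
            lhs = begin
              SumS.⟦ 𝒞 c ⟧ * (const (b c) * (M ^ wt c * P ^ ∣ ∁ c ∣))
                ≡⟨ cong (λ x → SumS.⟦ x ⟧ * (const (b c) * (M ^ wt c * P ^ ∣ ∁ c ∣))) c∈ ⟩
              1# * (const (b c) * (M ^ wt c * P ^ ∣ ∁ c ∣))
                ≈⟨ S.trans (S.*-identityˡ _) (S.*-congˡ (S.*-cong
                     (S.trans (S.reflexive (cong (M ^_) wt≡)) (pow M j))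
                     (S.trans (S.reflexive (cong (P ^_) ∁≡)) (pow P (L ∸ j))))) ⟩
              const (b c) * (M ^ d * X ^ j * (P ^ d * Y ^ (L ∸ j)))
                ≈⟨ solve 5 (λ b m x p y → b :* (m :* x :* (p :* y)) := m :* p :* (b :* (x :* y))) S.refl
                     (const (b c)) (M ^ d) (X ^ j) (P ^ d) (Y ^ (L ∸ j)) ⟩
              M ^ d * P ^ d * (const (b c) * (X ^ j * Y ^ (L ∸ j)))
                ≈⟨ S.*-congʳ (^-distrib-* M P d) ⟨
              (M * P) ^ d * (const (b c) * (X ^ j * Y ^ (L ∸ j))) ∎
            rhs : SumS.sum U (λ i → const (e i c) * (X ^ i * Y ^ (L ∸ i))) ≋ const (b c) * (X ^ j * Y ^ (L ∸ j))
            rhs = S.trans (SumS.sum-cong U indicator)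
              (SumS.sum-upTo-single (suc L) j (λ i → const (b c) * (X ^ i * Y ^ (L ∸ i))) (s≤s j≤L))
              where
              indicator : ∀ i → const (e i c) * (X ^ i * Y ^ (L ∸ i)) ≋
                SumS.⟦ does (j ≟ i) ⟧ * (const (b c) * (X ^ i * Y ^ (L ∸ i)))
              indicator i = S.trans (S.*-congʳ (S.trans (S.reflexive (cong const e≡))
                  (S.trans (const-* Sumℤ.⟦ does (j ≟ i) ⟧ (b c)) (S.*-congʳ (const-⟦⟧ (does (j ≟ i)))))))
                (S.*-assoc _ _ _)
                where
                e≡ : e i c ≡ Sumℤ.⟦ does (j ≟ i) ⟧ ℤ.* b c
                e≡ rewrite c∈ | wt≡ with j ≟ i
                ... | yes refl rewrite dec-true (d ℕ.+ j ℕ.* 4 ≟ d ℕ.+ j ℕ.* 4) refl | dec-true (j ≟ j) refl = ℤ.*-identityˡ _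
                ... | no j≢i rewrite dec-false (j ≟ i) j≢i
                    | dec-false (d ℕ.+ j ℕ.* 4 ≟ d ℕ.+ i ℕ.* 4) (λ eq → j≢i (ℕ.*-cancelʳ-≡ j i 4 (ℕ.+-cancelˡ-≡ d _ _ eq))) = ℤ.*-identityˡ _

  P⁻¹ tP⁻¹ : Series
  P⁻¹ = E * (M * Z)
  tP⁻¹ = t * P⁻¹

  module Truncation {n : ℕ} {𝒞 : Code n} {d L k : ℕ} (ext : Extremal 𝒞 d L k) where
    open Extremal ext

    contains meets : Word n → Series
    contains = containing 𝒞 linear selfDual
    meets    = meeting 𝒞 linear selfDual

    identity : ∀ T → const (+ 2) ^ k * (M ^ wt T * meets T) ≋ const (+ 2) ^ wt T * contains T
    identity = macWilliams {k = k} 𝒞 linear selfDual n≡k+k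

    weigh-≡ : ∀ w (c : Word n) → wt c ≡ w → weigh w c ≡ 1ℤ
    weigh-≡ w c eq = cong Sumℤ.⟦_⟧ (dec-true (wt c ≟ w) eq)

    weigh-≢ : ∀ w (c : Word n) → wt c ≢ w → weigh w c ≡ 0ℤ
    weigh-≢ w c neq = cong Sumℤ.⟦_⟧ (dec-false (wt c ≟ w) neq)

    above-d : ∀ c → c ∈C 𝒞 → d ℕ.< wt c → d ℕ.+ 4 ℕ.≤ wt c
    above-d c c∈ d<wt = gap 4∣d (doublyEven c c∈) d<wt
      where
      gap : ∀ {a b} → 4 ∣ a → 4 ∣ b → a ℕ.< b → a ℕ.+ 4 ℕ.≤ b
      gap (divides p refl) (divides q refl) a<b = ℕ.≤-trans (ℕ.≤-reflexive (ℕ.+-comm (p ℕ.* 4) 4))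
        (ℕ.*-monoˡ-≤ 4 (ℕ.*-cancelʳ-< 4 p q a<b))

    -- The sign (-1)^j is (t - P)^j. Its binomial expansion depends on the minimum-weight words
    -- through the moments `β` alone, which do not distinguish sets of equal size as long as s is at
    -- most the strength of the design.
    profile : Word n → Series
    profile T = SumS.sum (upTo (suc (wt T))) (λ s → const (β 𝒞 d s T) * ((- P) ^ s * t ^ (wt T ∸ s)))

    -- A nonzero word of weight other than `d` has at least d + 4 points, of which at most `wt T`
    -- lie in `T`; so it contributes nothing below t^(r+4). The summand 1 is the zero word.
    meets-truncated : ∀ T r → r ℕ.+ wt T ≡ d → meets T ≡[ r ℕ.+ 4 ] 1# + t ^ r * profile T
    meets-truncated T r r+T≡d = ≡[]-trans (sum-≡[] (allWords n) term) (≋⇒≡[] (r ℕ.+ 4) total-≋)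
      where
      Q : ℕ → Series
      Q j = SumS.sum (upTo (suc (wt T))) (λ s → const (+ (j C s)) * ((- P) ^ s * t ^ (wt T ∸ s)))
      inner : Word n → Series
      inner c = const (weigh 0 c) + const (weigh d c) * (t ^ r * Q ∣ T ∩ c ∣)
      by-weight : ∀ c → c ∈C 𝒞 → const -1ℤ ^ ∣ T ∩ c ∣ * t ^ ∣ ∁ T ∩ c ∣ ≡[ r ℕ.+ 4 ] inner c
      by-weight c c∈ with wt c ≟ 0
      ... | yes c≡0 = ≋⇒≡[] _ (begin
        const -1ℤ ^ ∣ T ∩ c ∣ * t ^ ∣ ∁ T ∩ c ∣
          ≡⟨ cong₂ (λ x y → const -1ℤ ^ x * t ^ y) (ℕ.m+n≡0⇒m≡0 ∣ T ∩ c ∣ both) (ℕ.m+n≡0⇒n≡0 ∣ T ∩ c ∣ both) ⟩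
        1# * 1#
          ≈⟨ solve 1 (λ q → con 1ℤ :* con 1ℤ := con 1ℤ :+ con 0ℤ :* q) S.refl (t ^ r * Q ∣ T ∩ c ∣) ⟩
        const 1ℤ + const 0ℤ * (t ^ r * Q ∣ T ∩ c ∣)
          ≡⟨ cong₂ (λ x y → const x + const y * (t ^ r * Q ∣ T ∩ c ∣)) (weigh-≡ 0 c c≡0)
               (weigh-≢ d c (λ c≡d → ℕ.<⇒≢ d>0 (trans (sym c≡0) c≡d))) ⟨
        inner c ∎)
        where
        open ≋-Reasoning
        both : ∣ T ∩ c ∣ ℕ.+ ∣ ∁ T ∩ c ∣ ≡ 0
        both = trans (wt-partition T c) c≡0
      ... | no c≢0 with wt c ≟ d
      ...   | yes c≡d = ≋⇒≡[] _ (begin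
        const -1ℤ ^ j * t ^ ∣ ∁ T ∩ c ∣
          ≈⟨ S.*-cong (^-congˡ j (solve 1 (λ t → con -1ℤ := t :+ :- (con 1ℤ :+ t)) S.refl t))
               (S.trans (S.reflexive (cong (t ^_) out)) (^-homo-* t r u)) ⟩
        (t + - P) ^ j * (t ^ r * t ^ u)
          ≈⟨ solve 3 (λ a b c → a :* (b :* c) := b :* (a :* c)) S.refl ((t + - P) ^ j) (t ^ r) (t ^ u) ⟩
        t ^ r * ((t + - P) ^ j * t ^ u)
          ≈⟨ S.*-congˡ (binomial t (- P) j u) ⟨
        t ^ r * SumS.sum (upTo (suc (j ℕ.+ u))) (λ s → const (+ (j C s)) * ((- P) ^ s * t ^ ((j ℕ.+ u) ∸ s)))
          ≡⟨ cong (λ w → t ^ r * SumS.sum (upTo (suc w)) (λ s → const (+ (j C s)) * ((- P) ^ s * t ^ (w ∸ s)))) j+u ⟩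
        t ^ r * Q j
          ≈⟨ solve 1 (λ q → q := con 0ℤ :+ con 1ℤ :* q) S.refl (t ^ r * Q j) ⟩
        const 0ℤ + const 1ℤ * (t ^ r * Q j)
          ≡⟨ cong₂ (λ x y → const x + const y * (t ^ r * Q j)) (weigh-≢ 0 c c≢0) (weigh-≡ d c c≡d) ⟨
        inner c ∎)
        where
        open ≋-Reasoning
        j = ∣ T ∩ c ∣
        u = wt T ∸ j
        j+u : j ℕ.+ u ≡ wt T
        j+u = ℕ.m+[n∸m]≡n (∣p∩q∣≤∣p∣ T c)
        out : ∣ ∁ T ∩ c ∣ ≡ r ℕ.+ u
        out = ℕ.+-cancelˡ-≡ j _ _ (trans (wt-partition T c) (trans c≡d (trans (sym r+T≡d)
          (trans (cong (r ℕ.+_) (sym j+u)) (trans (sym (ℕ.+-assoc r j u))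
          (trans (cong (ℕ._+ u) (ℕ.+-comm r j)) (ℕ.+-assoc j r u)))))))
      ...   | no c≢d = upTo< λ i i<r+4 → trans
          (trans (coeff (S.*-comm (const -1ℤ ^ ∣ T ∩ c ∣) (t ^ o)) i)
            (t^-below o (const -1ℤ ^ ∣ T ∩ c ∣) i (ℕ.<-≤-trans i<r+4 r+4≤o)))
          (sym (trans (coeff vanish i) (constant0 i)))
        where
        o = ∣ ∁ T ∩ c ∣
        vanish : inner c ≋ 0#
        vanish = S.trans (S.reflexive (cong₂ (λ x y → const x + const y * (t ^ r * Q ∣ T ∩ c ∣))
            (weigh-≢ 0 c c≢0) (weigh-≢ d c c≢d)))
          (solve 1 (λ q → con 0ℤ :+ con 0ℤ :* q := con 0ℤ) S.refl (t ^ r * Q ∣ T ∩ c ∣))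
        r+4≤o : r ℕ.+ 4 ℕ.≤ o
        r+4≤o = ℕ.+-cancelˡ-≤ (wt T) (r ℕ.+ 4) o (begin
          wt T ℕ.+ (r ℕ.+ 4)   ≡⟨ ℕ.+-assoc (wt T) r 4 ⟨
          wt T ℕ.+ r ℕ.+ 4     ≡⟨ cong (ℕ._+ 4) (trans (ℕ.+-comm (wt T) r) r+T≡d) ⟩
          d ℕ.+ 4              ≤⟨ above-d c c∈ (ℕ.≤∧≢⇒< (minimum c c∈ (ℕ.n≢0⇒n>0 c≢0)) (λ d≡c → c≢d (sym d≡c))) ⟩
          wt c                 ≡⟨ wt-partition T c ⟨
          ∣ T ∩ c ∣ ℕ.+ o      ≤⟨ ℕ.+-monoˡ-≤ o (∣p∩q∣≤∣p∣ T c) ⟩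
          wt T ℕ.+ o           ∎)
          where open ℕ.≤-Reasoning
      term : ∀ c → SumS.⟦ 𝒞 c ⟧ * (const -1ℤ ^ ∣ T ∩ c ∣ * t ^ ∣ ∁ T ∩ c ∣) ≡[ r ℕ.+ 4 ] SumS.⟦ 𝒞 c ⟧ * inner c
      term c = cases (𝒞 c) refl
        where
        cases : ∀ x → 𝒞 c ≡ x → SumS.⟦ 𝒞 c ⟧ * (const -1ℤ ^ ∣ T ∩ c ∣ * t ^ ∣ ∁ T ∩ c ∣) ≡[ r ℕ.+ 4 ] SumS.⟦ 𝒞 c ⟧ * inner c
        cases true  c∈ = *-congˡ-≡[] SumS.⟦ 𝒞 c ⟧ (by-weight c c∈)
        cases false c∉ = ≋⇒≡[] _ (S.trans (S.*-congʳ (S.reflexive (cong SumS.⟦_⟧ c∉)))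
          (S.trans (S.zeroˡ _) (S.sym (S.trans (S.*-congʳ (S.reflexive (cong SumS.⟦_⟧ c∉))) (S.zeroˡ _)))))
      to-const : ∀ c x → SumS.⟦ 𝒞 c ⟧ * const x ≋ const (Sumℤ.⟦ 𝒞 c ⟧ ℤ.* x)
      to-const c x = S.trans (S.*-congʳ (S.sym (const-⟦⟧ (𝒞 c)))) (S.sym (const-* Sumℤ.⟦ 𝒞 c ⟧ x))
      zero-part : SumS.sum (allWords n) (λ c → SumS.⟦ 𝒞 c ⟧ * const (weigh 0 c)) ≋ 1#
      zero-part = S.trans (SumS.sum-cong (allWords n) (λ c → to-const c (weigh 0 c)))
        (S.trans (S.sym (const-sum (allWords n) _)) (S.reflexive (cong const count)))
        where
        count : Sumℤ.sum (allWords n) (λ c → Sumℤ.⟦ 𝒞 c ⟧ ℤ.* weigh 0 c) ≡ 1ℤ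
        count = trans (sum-zeroWord n _ (λ c c≢0 → trans (cong (Sumℤ.⟦ 𝒞 c ⟧ ℤ.*_) (weigh-≢ 0 c c≢0)) (ℤ.*-zeroʳ Sumℤ.⟦ 𝒞 c ⟧)))
          (cong₂ ℤ._*_ (cong Sumℤ.⟦_⟧ (proj₁ linear)) (weigh-≡ 0 (zeroWord n) (wt-zeroWord n)))
      min-part : SumS.sum (allWords n) (λ c → SumS.⟦ 𝒞 c ⟧ * (const (weigh d c) * (t ^ r * Q ∣ T ∩ c ∣))) ≋ t ^ r * profile T
      min-part = begin
        SumS.sum (allWords n) (λ c → SumS.⟦ 𝒞 c ⟧ * (const (weigh d c) * (t ^ r * Q ∣ T ∩ c ∣)))
          ≈⟨ SumS.sum-cong (allWords n) (λ c → solve 4 (λ a b x y → a :* (b :* (x :* y)) := x :* (a :* b :* y)) S.refl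
               SumS.⟦ 𝒞 c ⟧ (const (weigh d c)) (t ^ r) (Q ∣ T ∩ c ∣)) ⟩
        SumS.sum (allWords n) (λ c → t ^ r * (SumS.⟦ 𝒞 c ⟧ * const (weigh d c) * Q ∣ T ∩ c ∣))
          ≈⟨ SumS.sum-*ˡ (t ^ r) (allWords n) _ ⟩
        t ^ r * SumS.sum (allWords n) (λ c → SumS.⟦ 𝒞 c ⟧ * const (weigh d c) * Q ∣ T ∩ c ∣)
          ≈⟨ S.*-congˡ (SumS.sum-cong (allWords n) (λ c → S.sym (SumS.sum-*ˡ (SumS.⟦ 𝒞 c ⟧ * const (weigh d c)) S′ _))) ⟩
        t ^ r * SumS.sum (allWords n) (λ c → SumS.sum S′ (λ s → SumS.⟦ 𝒞 c ⟧ * const (weigh d c) * (const (+ (∣ T ∩ c ∣ C s)) * R s)))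
          ≈⟨ S.*-congˡ (SumS.sum-swap (allWords n) S′ _) ⟩
        t ^ r * SumS.sum S′ (λ s → SumS.sum (allWords n) (λ c → SumS.⟦ 𝒞 c ⟧ * const (weigh d c) * (const (+ (∣ T ∩ c ∣ C s)) * R s)))
          ≈⟨ S.*-congˡ (SumS.sum-cong S′ (λ s → S.trans (SumS.sum-cong (allWords n) (λ c → entry c s))
               (S.trans (SumS.sum-*ʳ (R s) (allWords n) _) (S.*-congʳ (S.sym (const-sum (allWords n) _)))))) ⟩
        t ^ r * profile T ∎
        where
        open ≋-Reasoning
        S′ = upTo (suc (wt T))
        R : ℕ → Series
        R s = (- P) ^ s * t ^ (wt T ∸ s)
        entry : ∀ c s → SumS.⟦ 𝒞 c ⟧ * const (weigh d c) * (const (+ (∣ T ∩ c ∣ C s)) * R s) ≋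
          const (Sumℤ.⟦ 𝒞 c ⟧ ℤ.* (weigh d c ℤ.* + (∣ T ∩ c ∣ C s))) * R s
        entry c s = S.trans (solve 4 (λ a b x y → a :* b :* (x :* y) := a :* (b :* x) :* y) S.refl
            SumS.⟦ 𝒞 c ⟧ (const (weigh d c)) (const (+ (∣ T ∩ c ∣ C s))) (R s))
          (S.*-congʳ (S.trans (S.*-congˡ (S.sym (const-* (weigh d c) _))) (to-const c _)))
      total-≋ : SumS.sum (allWords n) (λ c → SumS.⟦ 𝒞 c ⟧ * inner c) ≋ 1# + t ^ r * profile T
      total-≋ = S.trans (SumS.sum-cong (allWords n) (λ c → S.distribˡ SumS.⟦ 𝒞 c ⟧ _ _))
        (S.trans (SumS.sum-+ (allWords n) _ _) (S.+-cong zero-part min-part))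

-- Deviations between two sets of points and their moments.

module Levels where

  open import Algebra.Bundles using (CommutativeRing)
  open import Data.Bool using (true; false)
  open import Data.Fin.Subset using (∣_∣; ∁)
  open import Data.Integer as ℤ using (ℤ; +_; 0ℤ; 1ℤ; -1ℤ)
  import Data.Integer.Properties as ℤ
  import Data.Sum
  open import Data.Integer.Tactic.RingSolver using (solve-∀)
  open import Data.List using (upTo)
  open import Data.Nat as ℕ using (ℕ; zero; suc; z≤n; s≤s; _∸_)
  open import Data.Nat.Combinatorics using (_C_; nCn≡1; k>n⇒nCk≡0)
  import Data.Nat.Properties as ℕ
  open import Data.Nat.Properties using (_≟_)
  open import Data.Product using (proj₁; proj₂)
  open import Relation.Binary.PropositionalEquality as ≡ using (_≡_; _≢_; refl; cong; cong₂; sym; trans)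
  open import Relation.Nullary using (does; yes; no)
  open import Relation.Nullary.Decidable using (dec-true; dec-false)
  open Series
  open Sums
  open Count
  open Design
  open Enumerator
  open Forms
  open CodeForms

  open CommutativeRing seriesRing using (_+_; _*_; _-_; -_; 1#; 0#)
  open SeriesSolver using (solve; _:=_; _:*_; _:+_; _:-_; _:^_; :-_; con)

  EZMP : E * Z * (M * P) ≋ 1#
  EZMP = S.trans (solve 4 (λ e z m p → e :* z :* (m :* p) := e :* (m :* (p :* z))) S.refl E Z M P) E-inverse

  P-inverse : P⁻¹ * P ≋ 1#
  P-inverse = S.trans (solve 4 (λ e z m p → e :* (m :* z) :* p := e :* (m :* (p :* z))) S.refl E Z M P) E-inverse

  -- Setting X = 0 leaves the term of Y^L = V^L. This ties the unknown coefficients to the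
  -- difference at the minimum weight.
  moment-top : ∀ δ L → moment δ L L ≡ δ 0
  moment-top δ L = begin
    moment δ L L
      ≡⟨ Sumℤ.sum-upTo-suc L (λ j → δ j ℤ.* + ((L ∸ j) C L)) ⟩
    δ 0 ℤ.* + (L C L) ℤ.+ Sumℤ.sum (upTo L) (λ j → δ (suc j) ℤ.* + ((L ∸ suc j) C L))
      ≡⟨ cong₂ ℤ._+_ (trans (cong (λ x → δ 0 ℤ.* + x) (nCn≡1 L)) (ℤ.*-identityʳ (δ 0)))
           (trans (Sumℤ.sum-upTo-cong L (λ j j<L → trans
             (cong (λ x → δ (suc j) ℤ.* + x) (k>n⇒nCk≡0 (ℕ.∸-monoʳ-< (s≤s z≤n) j<L)))
             (ℤ.*-zeroʳ (δ (suc j))))) (Sumℤ.sum-zero (upTo L))) ⟩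
    δ 0 ℤ.+ 0ℤ
      ≡⟨ ℤ.+-identityʳ (δ 0) ⟩
    δ 0 ∎
    where open ≡.≡-Reasoning

  -- Binomial inversion: the monomials V^i X^(L-i) are expanded back in X and Y.
  recover : ∀ δ L j → j ℕ.≤ L →
    δ j ≡ Sumℤ.sum (upTo (suc L)) (λ i → -1ℤ ℤ.^ (i ℕ.+ (L ∸ j)) ℤ.* + (i C (L ∸ j)) ℤ.* moment δ L i)
  recover δ L j j≤L = sym (begin
    Sumℤ.sum U (λ i → c i ℤ.* moment δ L i)
      ≡⟨ Sumℤ.sum-cong U (λ i → Sumℤ.sum-*ˡ (c i) U (λ l → δ l ℤ.* + ((L ∸ l) C i))) ⟨
    Sumℤ.sum U (λ i → Sumℤ.sum U (λ l → c i ℤ.* (δ l ℤ.* + ((L ∸ l) C i))))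
      ≡⟨ Sumℤ.sum-swap U U (λ i l → c i ℤ.* (δ l ℤ.* + ((L ∸ l) C i))) ⟩
    Sumℤ.sum U (λ l → Sumℤ.sum U (λ i → c i ℤ.* (δ l ℤ.* + ((L ∸ l) C i))))
      ≡⟨ Sumℤ.sum-upTo-cong (suc L) (λ l l<1+L → column l (ℕ.s≤s⁻¹ l<1+L)) ⟩
    Sumℤ.sum U (λ l → Sumℤ.⟦ does (j ≟ l) ⟧ ℤ.* δ l)
      ≡⟨ Sumℤ.sum-upTo-single (suc L) j δ (s≤s j≤L) ⟩
    δ j ∎)
    where
    open ≡.≡-Reasoning
    U = upTo (suc L)
    c : ℕ → ℤ
    c i = -1ℤ ℤ.^ (i ℕ.+ (L ∸ j)) ℤ.* + (i C (L ∸ j))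
    column : ∀ l → l ℕ.≤ L →
      Sumℤ.sum U (λ i → c i ℤ.* (δ l ℤ.* + ((L ∸ l) C i))) ≡ Sumℤ.⟦ does (j ≟ l) ⟧ ℤ.* δ l
    column l l≤L = begin
      Sumℤ.sum U (λ i → c i ℤ.* (δ l ℤ.* + ((L ∸ l) C i)))
        ≡⟨ Sumℤ.sum-cong U (λ i → move (c i) (δ l) (+ ((L ∸ l) C i))) ⟩
      Sumℤ.sum U (λ i → c i ℤ.* + ((L ∸ l) C i) ℤ.* δ l)
        ≡⟨ Sumℤ.sum-*ʳ (δ l) U (λ i → c i ℤ.* + ((L ∸ l) C i)) ⟩
      Sumℤ.sum U (λ i → c i ℤ.* + ((L ∸ l) C i)) ℤ.* δ l
        ≡⟨ cong (ℤ._* δ l) (trans (inversion (L ∸ l) (L ∸ j) (suc L) (s≤s (ℕ.m∸n≤m L l))) (cong Sumℤ.⟦_⟧ same)) ⟩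
      Sumℤ.⟦ does (j ≟ l) ⟧ ℤ.* δ l ∎
      where
      move : ∀ a b c → a ℤ.* (b ℤ.* c) ≡ a ℤ.* c ℤ.* b
      move = solve-∀
      same : does (L ∸ j ≟ L ∸ l) ≡ does (j ≟ l)
      same with j ≟ l
      ... | yes refl = trans (dec-true (L ∸ j ≟ L ∸ j) refl) (sym (dec-true (j ≟ j) refl))
      ... | no j≢l   = trans (dec-false (L ∸ j ≟ L ∸ l) (λ eq → j≢l (ℕ.∸-cancelˡ-≡ j≤L l≤L eq))) (sym (dec-false (j ≟ l) j≢l))

  moments-zero : ∀ δ L → (∀ i → i ℕ.≤ L → moment δ L i ≡ 0ℤ) → ∀ j → j ℕ.≤ L → δ j ≡ 0ℤ
  moments-zero δ L eq j j≤L = trans (recover δ L j j≤L) (trans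
    (Sumℤ.sum-upTo-cong (suc L) (λ i i<1+L → trans
      (cong (-1ℤ ℤ.^ (i ℕ.+ (L ∸ j)) ℤ.* + (i C (L ∸ j)) ℤ.*_) (eq i (ℕ.s≤s⁻¹ i<1+L)))
      (ℤ.*-zeroʳ (-1ℤ ℤ.^ (i ℕ.+ (L ∸ j)) ℤ.* + (i C (L ∸ j)))))) (Sumℤ.sum-zero (upTo (suc L))))

  recover-tail : ∀ δ r q j → j ℕ.≤ r ℕ.+ q → (∀ i → i ℕ.< r → moment δ (r ℕ.+ q) i ≡ 0ℤ) →
    δ j ≡ Sumℤ.sum (upTo (suc q)) (λ s → -1ℤ ℤ.^ (r ℕ.+ s ℕ.+ (r ℕ.+ q ∸ j)) ℤ.* + ((r ℕ.+ s) C (r ℕ.+ q ∸ j)) ℤ.* moment δ (r ℕ.+ q) (r ℕ.+ s))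
  recover-tail δ r q j j≤L vanish = begin
    δ j
      ≡⟨ recover δ (r ℕ.+ q) j j≤L ⟩
    Sumℤ.sum (upTo (suc (r ℕ.+ q))) F
      ≡⟨ cong (λ l → Sumℤ.sum (upTo l) F) (ℕ.+-suc r q) ⟨
    Sumℤ.sum (upTo (r ℕ.+ suc q)) F
      ≡⟨ Sumℤ.sum-upTo-+ r (suc q) F ⟩
    Sumℤ.sum (upTo r) F ℤ.+ Sumℤ.sum (upTo (suc q)) (λ s → F (r ℕ.+ s))
      ≡⟨ cong (ℤ._+ Sumℤ.sum (upTo (suc q)) (λ s → F (r ℕ.+ s))) (trans
           (Sumℤ.sum-upTo-cong r (λ i i<r → trans (cong (c i ℤ.*_) (vanish i i<r)) (ℤ.*-zeroʳ (c i)))) (Sumℤ.sum-zero (upTo r))) ⟩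
    0ℤ ℤ.+ Sumℤ.sum (upTo (suc q)) (λ s → F (r ℕ.+ s))
      ≡⟨ ℤ.+-identityˡ _ ⟩
    Sumℤ.sum (upTo (suc q)) (λ s → F (r ℕ.+ s)) ∎
    where
    open ≡.≡-Reasoning
    c F : ℕ → ℤ
    c i = -1ℤ ℤ.^ (i ℕ.+ (r ℕ.+ q ∸ j)) ℤ.* + (i C (r ℕ.+ q ∸ j))
    F i = c i ℤ.* moment δ (r ℕ.+ q) i

  module Level {n : ℕ} {𝒞 : Code n} {d L k : ℕ} (ext : Extremal 𝒞 d L k) where
    open Extremal ext
    open Truncation ext

    -- The difference is taken inside the sum: for nonempty sets of equal size or not, the two
    -- indicators agree on the zero word and on the all-one word, as `group` requires.
    deviation : Word n → Word n → ℕ → ℤ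
    deviation T T′ j = total 𝒞 (d ℕ.+ j ℕ.* 4) (λ c → Sumℤ.⟦ T ⊑ c ⟧ ℤ.- Sumℤ.⟦ T′ ⊑ c ⟧)

    total-- : ∀ w f g → total 𝒞 w (λ c → f c ℤ.- g c) ≡ total 𝒞 w f ℤ.- total 𝒞 w g
    total-- w f g = trans (total-cong 𝒞 w {g = λ c → f c ℤ.+ -1ℤ ℤ.* g c} (λ c _ _ → neg (f c) (g c)))
      (trans (total-+ 𝒞 w f (λ c → -1ℤ ℤ.* g c)) (trans (cong (ℤ._+_ (total 𝒞 w f)) (total-* 𝒞 w -1ℤ g))
        (sym (neg (total 𝒞 w f) (total 𝒞 w g)))))
      where
      neg : ∀ a b → a ℤ.- b ≡ a ℤ.+ -1ℤ ℤ.* b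
      neg = solve-∀

    deviation-B : ∀ T T′ j → deviation T T′ j ≡ B 𝒞 (d ℕ.+ j ℕ.* 4) T ℤ.- B 𝒞 (d ℕ.+ j ℕ.* 4) T′
    deviation-B T T′ j = total-- (d ℕ.+ j ℕ.* 4) (λ c → Sumℤ.⟦ T ⊑ c ⟧) (λ c → Sumℤ.⟦ T′ ⊑ c ⟧)

    β-B : ∀ T → β 𝒞 d (wt T) T ≡ B 𝒞 d T
    β-B T = total-cong 𝒞 d (λ c _ _ → subset-C (wt T) T c refl)

    deviation-0 : ∀ T T′ → deviation T T′ 0 ≡ β 𝒞 d (wt T) T ℤ.- β 𝒞 d (wt T′) T′
    deviation-0 T T′ = trans (deviation-B T T′ 0) (trans
      (cong (λ w → B 𝒞 w T ℤ.- B 𝒞 w T′) (ℕ.+-identityʳ d))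
      (cong₂ ℤ._-_ (sym (β-B T)) (sym (β-B T′))))

    contains-difference : ∀ T T′ → wt T ≢ 0 → wt T′ ≢ 0 →
      contains T - contains T′ ≋ (M * P) ^ d * form (deviation T T′) L
    contains-difference T T′ T≢0 T′≢0 = begin
      contains T - contains T′
        ≈⟨ solve 2 (λ a b → a :- b := a :+ con -1ℤ :* b) S.refl (contains T) (contains T′) ⟩
      contains T + const -1ℤ * contains T′
        ≈⟨ S.+-congˡ (SumS.sum-*ˡ (const -1ℤ) (allWords n) _) ⟨
      contains T + SumS.sum (allWords n) (λ c → const -1ℤ * (SumS.⟦ 𝒞 c ⟧ * (SumS.⟦ T′ ⊑ c ⟧ * Φ c)))
        ≈⟨ SumS.sum-+ (allWords n) _ _ ⟨
      SumS.sum (allWords n) (λ c → SumS.⟦ 𝒞 c ⟧ * (SumS.⟦ T ⊑ c ⟧ * Φ c) + const -1ℤ * (SumS.⟦ 𝒞 c ⟧ * (SumS.⟦ T′ ⊑ c ⟧ * Φ c)))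
        ≈⟨ SumS.sum-cong (allWords n) combine ⟩
      SumS.sum (allWords n) (λ c → SumS.⟦ 𝒞 c ⟧ * (const (b c) * Φ c))
        ≈⟨ group b
             (λ c c≡0 → cong₂ (λ x y → Sumℤ.⟦ x ⟧ ℤ.- Sumℤ.⟦ y ⟧) (⊑-empty T c T≢0 c≡0) (⊑-empty T′ c T′≢0 c≡0))
             (λ c c≡n → cong₂ (λ x y → Sumℤ.⟦ x ⟧ ℤ.- Sumℤ.⟦ y ⟧) (⊑-full T c c≡n) (⊑-full T′ c c≡n)) ⟩
      (M * P) ^ d * form (deviation T T′) L ∎
      where
      open ≋-Reasoning
      b : Word n → ℤ
      b c = Sumℤ.⟦ T ⊑ c ⟧ ℤ.- Sumℤ.⟦ T′ ⊑ c ⟧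
      Φ : Word n → Series
      Φ c = M ^ wt c * P ^ ∣ ∁ c ∣
      difference : ∀ x y → SumS.⟦ x ⟧ + const -1ℤ * SumS.⟦ y ⟧ ≋ const (Sumℤ.⟦ x ⟧ ℤ.- Sumℤ.⟦ y ⟧)
      difference false false = solve 0 (con 0ℤ :+ con -1ℤ :* con 0ℤ := con 0ℤ) S.refl
      difference false true  = solve 0 (con 0ℤ :+ con -1ℤ :* con 1ℤ := con -1ℤ) S.refl
      difference true  false = solve 0 (con 1ℤ :+ con -1ℤ :* con 0ℤ := con 1ℤ) S.refl
      difference true  true  = solve 0 (con 1ℤ :+ con -1ℤ :* con 1ℤ := con 0ℤ) S.refl
      combine : ∀ c → SumS.⟦ 𝒞 c ⟧ * (SumS.⟦ T ⊑ c ⟧ * Φ c) + const -1ℤ * (SumS.⟦ 𝒞 c ⟧ * (SumS.⟦ T′ ⊑ c ⟧ * Φ c)) ≋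
        SumS.⟦ 𝒞 c ⟧ * (const (b c) * Φ c)
      combine c = S.trans (solve 5 (λ i x y f m → i :* (x :* f) :+ m :* (i :* (y :* f)) := i :* ((x :+ m :* y) :* f)) S.refl
          SumS.⟦ 𝒞 c ⟧ SumS.⟦ T ⊑ c ⟧ SumS.⟦ T′ ⊑ c ⟧ (Φ c) (const -1ℤ))
        (S.*-congˡ (S.*-congʳ (difference (T ⊑ c) (T′ ⊑ c))))

    cancel-MP : ∀ f → (E * Z) ^ d * ((M * P) ^ d * f) ≋ f
    cancel-MP f = S.trans (S.sym (S.*-assoc _ _ f)) (S.trans (S.*-congʳ (S.trans (S.sym (^-distrib-* (E * Z) (M * P) d))
      (S.trans (^-congˡ d EZMP) (1^ d)))) (S.*-identityˡ f))

    -- The contributions 1 of the zero word cancel, which exposes t^r. Of the inverse (EZ)^d of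
    -- (MP)^d, w factors turn `M ^ w` into `P⁻¹ ^ w` and r remain.
    deviation-form : ∀ T T′ r w → wt T ≡ w → wt T′ ≡ w → w ≢ 0 → r ℕ.+ w ≡ d →
      const (+ 2) ^ w * form (deviation T T′) L ≡[ r ℕ.+ 4 ]
      t ^ r * ((E * Z) ^ r * (const (+ 2) ^ k * (P⁻¹ ^ w * (profile T - profile T′))))
    deviation-form T T′ r w refl T′≡w w≢0 r+w≡d = ≡[]-trans (≋⇒≡[] (r ℕ.+ 4) first)
      (≡[]-trans (*-congˡ-≡[] A truncated) (≋⇒≡[] (r ℕ.+ 4) last))
      where
      open ≋-Reasoning
      A = (E * Z) ^ d * (const (+ 2) ^ k * M ^ w)
      first : const (+ 2) ^ w * form (deviation T T′) L ≋ A * (meets T - meets T′)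
      first = begin
        const (+ 2) ^ w * form (deviation T T′) L
          ≈⟨ S.*-congˡ (cancel-MP _) ⟨
        const (+ 2) ^ w * ((E * Z) ^ d * ((M * P) ^ d * form (deviation T T′) L))
          ≈⟨ S.*-congˡ (S.*-congˡ (contains-difference T T′ w≢0 (λ eq → w≢0 (trans (sym T′≡w) eq)))) ⟨
        const (+ 2) ^ w * ((E * Z) ^ d * (contains T - contains T′))
          ≈⟨ solve 4 (λ a e x y → a :* (e :* (x :- y)) := e :* (a :* x :- a :* y)) S.refl
               (const (+ 2) ^ w) ((E * Z) ^ d) (contains T) (contains T′) ⟩
        (E * Z) ^ d * (const (+ 2) ^ w * contains T - const (+ 2) ^ w * contains T′)
          ≈⟨ S.*-congˡ (S.+-cong (S.sym (identity T)) (S.-‿cong (S.trans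
               (S.reflexive (cong (λ x → const (+ 2) ^ x * contains T′) (sym T′≡w)))
               (S.trans (S.sym (identity T′)) (S.reflexive (cong (λ x → const (+ 2) ^ k * (M ^ x * meets T′)) T′≡w)))))) ⟩
        (E * Z) ^ d * (const (+ 2) ^ k * (M ^ w * meets T) - const (+ 2) ^ k * (M ^ w * meets T′))
          ≈⟨ solve 5 (λ e a m x y → e :* (a :* (m :* x) :- a :* (m :* y)) := e :* (a :* m) :* (x :- y)) S.refl
               ((E * Z) ^ d) (const (+ 2) ^ k) (M ^ w) (meets T) (meets T′) ⟩
        A * (meets T - meets T′) ∎
      truncated : meets T - meets T′ ≡[ r ℕ.+ 4 ] t ^ r * (profile T - profile T′)
      truncated = ≡[]-trans
        (upTo< λ i i<r+4 → cong₂ ℤ._-_ (below (meets-truncated T r r+w≡d) i i<r+4)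
          (below (meets-truncated T′ r (trans (cong (r ℕ.+_) T′≡w) r+w≡d)) i i<r+4))
        (≋⇒≡[] _ (solve 3 (λ a x y → (con 1ℤ :+ a :* x) :- (con 1ℤ :+ a :* y) := a :* (x :- y)) S.refl
          (t ^ r) (profile T) (profile T′)))
      last : A * (t ^ r * (profile T - profile T′)) ≋
        t ^ r * ((E * Z) ^ r * (const (+ 2) ^ k * (P⁻¹ ^ w * (profile T - profile T′))))
      last = begin
        (E * Z) ^ d * (const (+ 2) ^ k * M ^ w) * (t ^ r * (profile T - profile T′))
          ≈⟨ S.*-congʳ (S.*-congʳ (S.trans (S.reflexive (cong ((E * Z) ^_) (sym r+w≡d))) (^-homo-* (E * Z) r w))) ⟩
        (E * Z) ^ r * (E * Z) ^ w * (const (+ 2) ^ k * M ^ w) * (t ^ r * (profile T - profile T′))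
          ≈⟨ solve 6 (λ a b c m s p → a :* b :* (c :* m) :* (s :* p) := s :* (a :* (c :* ((b :* m) :* p)))) S.refl
               ((E * Z) ^ r) ((E * Z) ^ w) (const (+ 2) ^ k) (M ^ w) (t ^ r) (profile T - profile T′) ⟩
        t ^ r * ((E * Z) ^ r * (const (+ 2) ^ k * ((E * Z) ^ w * M ^ w * (profile T - profile T′))))
          ≈⟨ S.*-congˡ (S.*-congˡ (S.*-congˡ (S.*-congʳ (S.trans (S.sym (^-distrib-* (E * Z) M w))
               (^-congˡ w (solve 3 (λ e z m → e :* z :* m := e :* (m :* z)) S.refl E Z M)))))) ⟩
        t ^ r * ((E * Z) ^ r * (const (+ 2) ^ k * (P⁻¹ ^ w * (profile T - profile T′)))) ∎

    -- Assmus–Mattson: with more vanishing moments than weights, all deviations vanish.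
    deviation-low : ∀ T T′ r w → wt T ≡ w → wt T′ ≡ w → w ≢ 0 → r ℕ.+ w ≡ d → L ℕ.< r →
      ∀ j → j ℕ.≤ L → deviation T T′ j ≡ 0ℤ
    deviation-low T T′ r w T≡w T′≡w w≢0 r+w≡d L<r = moments-zero δ L λ i i≤L →
      expansion-vanish (moment δ L) L (suc L) ℕ.≤-refl (λ i i<1+L → trans (sym (coeff (form-expansion δ L) i))
        (ℤ.*-cancelˡ-≡ ((+ 2) ℤ.^ w) _ 0ℤ {{ℤ.≢-nonZero (2^≢0 w)}}
          (trans (sym (^-const-* (+ 2) w (form δ L) i))
          (trans (below (deviation-form T T′ r w T≡w T′≡w w≢0 r+w≡d) i (ℕ.<-≤-trans i<1+L (ℕ.≤-trans L<r (ℕ.m≤m+n r 4))))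
          (trans (t^-below r ((E * Z) ^ r * (const (+ 2) ^ k * (P⁻¹ ^ w * (profile T - profile T′)))) i (ℕ.<-≤-trans i<1+L L<r)) (sym (ℤ.*-zeroʳ ((+ 2) ℤ.^ w)))))))) i (s≤s i≤L)
      where δ = deviation T T′

    -- Both sets have w + 1 points. Moments of order below w agree, so only the orders w and w + 1
    -- survive, and the last of them is the block count at weight `d`.
    profile-difference : ∀ T T′ w → wt T ≡ suc w → wt T′ ≡ suc w → (∀ s → s ℕ.< w → β 𝒞 d s T ≡ β 𝒞 d s T′) →
      profile T - profile T′ ≋
      const (β 𝒞 d w T ℤ.- β 𝒞 d w T′) * ((- P) ^ w * t) + const (deviation T T′ 0) * (- P) ^ suc w
    profile-difference T T′ w T≡ T′≡ same = begin
      profile T - profile T′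
        ≈⟨ S.+-cong (unfold T T≡) (S.-‿cong (unfold T′ T′≡)) ⟩
      (low T + (const (β 𝒞 d w T) * ((- P) ^ w * t) + const (β 𝒞 d (suc w) T) * (- P) ^ suc w))
        - (low T′ + (const (β 𝒞 d w T′) * ((- P) ^ w * t) + const (β 𝒞 d (suc w) T′) * (- P) ^ suc w))
        ≈⟨ S.+-congʳ (S.+-congʳ (SumS.sum-upTo-cong w (λ s s<w → S.*-congʳ (S.reflexive (cong const (same s s<w)))))) ⟩
      (low T′ + (const (β 𝒞 d w T) * ((- P) ^ w * t) + const (β 𝒞 d (suc w) T) * (- P) ^ suc w))
        - (low T′ + (const (β 𝒞 d w T′) * ((- P) ^ w * t) + const (β 𝒞 d (suc w) T′) * (- P) ^ suc w))
        ≈⟨ solve 7 (λ l a b a′ b′ x y → (l :+ (a :* x :+ b :* y)) :- (l :+ (a′ :* x :+ b′ :* y)) :=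
             (a :+ con -1ℤ :* a′) :* x :+ (b :+ con -1ℤ :* b′) :* y) S.refl (low T′) (const (β 𝒞 d w T)) (const (β 𝒞 d (suc w) T))
             (const (β 𝒞 d w T′)) (const (β 𝒞 d (suc w) T′)) ((- P) ^ w * t) ((- P) ^ suc w) ⟩
      (const (β 𝒞 d w T) + const -1ℤ * const (β 𝒞 d w T′)) * ((- P) ^ w * t)
        + (const (β 𝒞 d (suc w) T) + const -1ℤ * const (β 𝒞 d (suc w) T′)) * (- P) ^ suc w
        ≈⟨ S.+-cong (S.*-congʳ (subtract (β 𝒞 d w T) (β 𝒞 d w T′))) (S.*-congʳ (S.trans (subtract (β 𝒞 d (suc w) T) (β 𝒞 d (suc w) T′))
             (S.reflexive (cong const (sym (trans (deviation-0 T T′)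
               (cong₂ (λ x y → β 𝒞 d x T ℤ.- β 𝒞 d y T′) T≡ T′≡))))))) ⟩
      const (β 𝒞 d w T ℤ.- β 𝒞 d w T′) * ((- P) ^ w * t) + const (deviation T T′ 0) * (- P) ^ suc w ∎
      where
      open ≋-Reasoning
      low : Word n → Series
      low U = SumS.sum (upTo w) (λ s → const (β 𝒞 d s U) * ((- P) ^ s * t ^ (suc w ∸ s)))
      subtract : ∀ a b → const a + const -1ℤ * const b ≋ const (a ℤ.- b)
      subtract a b = S.trans (S.+-congˡ (S.sym (const-* -1ℤ b)))
        (S.trans (S.sym (const-+ a (-1ℤ ℤ.* b))) (S.reflexive (cong (λ x → const (a ℤ.+ x)) (ℤ.-1*i≡-i b))))
      unfold : ∀ U → wt U ≡ suc w → profile U ≋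
        low U + (const (β 𝒞 d w U) * ((- P) ^ w * t) + const (β 𝒞 d (suc w) U) * (- P) ^ suc w)
      unfold U U≡ = begin
        profile U
          ≡⟨ cong (λ x → SumS.sum (upTo (suc x)) (λ s → const (β 𝒞 d s U) * ((- P) ^ s * t ^ (x ∸ s)))) U≡ ⟩
        SumS.sum (upTo (suc (suc w))) F
          ≡⟨ cong (λ x → SumS.sum (upTo x) F) (ℕ.+-comm 2 w) ⟩
        SumS.sum (upTo (w ℕ.+ 2)) F
          ≈⟨ SumS.sum-upTo-+ w 2 F ⟩
        low U + (F (w ℕ.+ 0) + (F (w ℕ.+ 1) + 0#))
          ≈⟨ S.+-congˡ (S.+-cong second (S.trans (S.+-identityʳ _) third)) ⟩
        low U + (const (β 𝒞 d w U) * ((- P) ^ w * t) + const (β 𝒞 d (suc w) U) * (- P) ^ suc w) ∎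
        where
        F : ℕ → Series
        F s = const (β 𝒞 d s U) * ((- P) ^ s * t ^ (suc w ∸ s))
        second : F (w ℕ.+ 0) ≋ const (β 𝒞 d w U) * ((- P) ^ w * t)
        second = S.trans (S.reflexive (cong F (ℕ.+-identityʳ w))) (S.*-congˡ (S.*-congˡ
          (S.trans (S.reflexive (cong (t ^_) (ℕ.m+n∸n≡m 1 w))) (S.*-identityʳ t))))
        third : F (w ℕ.+ 1) ≋ const (β 𝒞 d (suc w) U) * (- P) ^ suc w
        third = S.trans (S.reflexive (cong F (ℕ.+-comm w 1))) (S.*-congˡ (S.trans
          (S.*-congˡ (S.reflexive (cong (t ^_) (ℕ.n∸n≡0 w)))) (S.*-identityʳ _)))

    module _ (T T′ : Word n) (q w r : ℕ) (w≡ : w ≡ 3 ℕ.+ q) (T≡ : wt T ≡ suc w) (T′≡ : wt T′ ≡ suc w)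
      (r+w : r ℕ.+ suc w ≡ d) (r+q : r ℕ.+ q ≡ L) (k≡ : k ≡ r ℕ.* 3 ℕ.+ (suc w ℕ.+ q ℕ.* 2))
      (same : ∀ s → s ℕ.< w → β 𝒞 d s T ≡ β 𝒞 d s T′) where

      private
        δ = deviation T T′
        ξ = β 𝒞 d w T ℤ.- β 𝒞 d w T′
        D = const ξ * (t * P⁻¹) - const (δ 0)
        N : ℕ → ℤ
        N s = moment δ (r ℕ.+ q) (r ℕ.+ s)

        simplified : const (+ 2) ^ k * (P⁻¹ ^ suc w * (profile T - profile T′)) ≋
          const (+ 2) ^ k * (const -1ℤ ^ w * D)
        simplified = S.*-congˡ (begin
          P⁻¹ ^ suc w * (profile T - profile T′)
            ≈⟨ S.*-congˡ (profile-difference T T′ w T≡ T′≡ same) ⟩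
          P⁻¹ * P⁻¹ ^ w * (const ξ * ((- P) ^ w * t) + const (δ 0) * ((- P) * (- P) ^ w))
            ≈⟨ solve 7 (λ i iw x pw t δ p → i :* iw :* (x :* (pw :* t) :+ δ :* (:- p :* pw)) :=
                 (iw :* pw) :* (x :* (t :* i) :- δ :* (i :* p))) S.refl P⁻¹ (P⁻¹ ^ w) (const ξ) ((- P) ^ w) t (const (δ 0)) P ⟩
          P⁻¹ ^ w * (- P) ^ w * (const ξ * (t * P⁻¹) - const (δ 0) * (P⁻¹ * P))
            ≈⟨ S.*-cong (S.trans (S.sym (^-distrib-* P⁻¹ (- P) w)) (^-congˡ w (S.trans
                 (solve 2 (λ i p → i :* :- p := :- (i :* p)) S.refl P⁻¹ P) (S.trans (S.-‿cong P-inverse)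
                 (solve 0 (:- con 1ℤ := con -1ℤ) S.refl)))))
               (S.+-congˡ (S.-‿cong (S.trans (S.*-congˡ P-inverse) (S.*-identityʳ _)))) ⟩
          const -1ℤ ^ w * D ∎)
          where open ≋-Reasoning

        2^-split : ∀ r c → (+ 2) ℤ.^ (r ℕ.* 3 ℕ.+ c) ≡ (+ 8) ℤ.^ r ℤ.* (+ 2) ℤ.^ c
        2^-split zero    c = sym (ℤ.*-identityˡ _)
        2^-split (suc r) c = trans (cong (λ x → (+ 2) ℤ.* ((+ 2) ℤ.* ((+ 2) ℤ.* x))) (2^-split r c))
          (lemma ((+ 8) ℤ.^ r) ((+ 2) ℤ.^ c))
          where
          lemma : ∀ a b → (+ 2) ℤ.* ((+ 2) ℤ.* ((+ 2) ℤ.* (a ℤ.* b))) ≡ (+ 8) ℤ.* a ℤ.* b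
          lemma = solve-∀

        facts = leading-form δ r q (suc w) (const (+ 2) ^ k * (const -1ℤ ^ w * D))
          (≡.subst (λ l → const (+ 2) ^ suc w * form δ l ≡[ r ℕ.+ 4 ] t ^ r * ((E * Z) ^ r * (const (+ 2) ^ k * (const -1ℤ ^ w * D))))
            (sym r+q) (≡[]-trans (deviation-form T T′ r (suc w) T≡ T′≡ (λ ()) r+w)
              (≋⇒≡[] (r ℕ.+ 4) (S.*-congˡ (S.*-congˡ simplified)))))

      deviation-moments-low : ∀ i → i ℕ.< r → moment δ (r ℕ.+ q) i ≡ 0ℤ
      deviation-moments-low = proj₁ facts

      -- There are q + 1 unknowns `N s` against four equations. Since k = 3r + (w + 1) + 2q, the
      -- powers of 2 cancel down to 4^q.
      deviation-moments : ∀ i → i ℕ.< 4 →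
        at (expansion N q) i ≡ (+ 4) ℤ.^ q ℤ.* (-1ℤ ℤ.^ w ℤ.* (ξ ℤ.* at tP⁻¹ i ℤ.- at (const (δ 0)) i))
      deviation-moments i i<4 = ℤ.*-cancelˡ-≡ ((+ 2) ℤ.^ suc w ℤ.* (+ 8) ℤ.^ r) _ _ {{ℤ.≢-nonZero nonzero}} (begin
        (+ 2) ℤ.^ suc w ℤ.* (+ 8) ℤ.^ r ℤ.* at (expansion N q) i
          ≡⟨ ℤ.*-assoc ((+ 2) ℤ.^ suc w) ((+ 8) ℤ.^ r) (at (expansion N q) i) ⟩
        (+ 2) ℤ.^ suc w ℤ.* ((+ 8) ℤ.^ r ℤ.* at (expansion N q) i)
          ≡⟨ proj₂ facts i i<4 ⟩
        at (const (+ 2) ^ k * (const -1ℤ ^ w * D)) i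
          ≡⟨ trans (^-const-* (+ 2) k (const -1ℤ ^ w * D) i) (cong ((+ 2) ℤ.^ k ℤ.*_) (^-const-* -1ℤ w D i)) ⟩
        (+ 2) ℤ.^ k ℤ.* (-1ℤ ℤ.^ w ℤ.* (at (const ξ * (t * P⁻¹)) i ℤ.- at (const (δ 0)) i))
          ≡⟨ cong₂ (λ x y → x ℤ.* (-1ℤ ℤ.^ w ℤ.* (y ℤ.- at (const (δ 0)) i))) 2^k (at-const-* ξ (t * P⁻¹) i) ⟩
        (+ 8) ℤ.^ r ℤ.* ((+ 2) ℤ.^ suc w ℤ.* (+ 4) ℤ.^ q) ℤ.* rest
          ≡⟨ reorder ((+ 8) ℤ.^ r) ((+ 2) ℤ.^ suc w) ((+ 4) ℤ.^ q) rest ⟩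
        (+ 2) ℤ.^ suc w ℤ.* (+ 8) ℤ.^ r ℤ.* ((+ 4) ℤ.^ q ℤ.* rest) ∎)
        where
        open ≡.≡-Reasoning
        rest = -1ℤ ℤ.^ w ℤ.* (ξ ℤ.* at tP⁻¹ i ℤ.- at (const (δ 0)) i)
        nonzero : (+ 2) ℤ.^ suc w ℤ.* (+ 8) ℤ.^ r ≢ 0ℤ
        nonzero eq with ℤ.i*j≡0⇒i≡0∨j≡0 ((+ 2) ℤ.^ suc w) eq
        ... | Data.Sum.inj₁ z = 2^≢0 (suc w) z
        ... | Data.Sum.inj₂ z = 8^≢0 r z
        reorder : ∀ a b c d → a ℤ.* (b ℤ.* c) ℤ.* d ≡ b ℤ.* a ℤ.* (c ℤ.* d)
        reorder = solve-∀
        2^k : (+ 2) ℤ.^ k ≡ (+ 8) ℤ.^ r ℤ.* ((+ 2) ℤ.^ suc w ℤ.* (+ 4) ℤ.^ q)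
        2^k = trans (cong ((+ 2) ℤ.^_) k≡) (trans (2^-split r (suc w ℕ.+ q ℕ.* 2)) (cong ((+ 8) ℤ.^ r ℤ.*_)
          (trans (ℤ.^-distribˡ-+-* (+ 2) (suc w) (q ℕ.* 2)) (cong ((+ 2) ℤ.^ suc w ℤ.*_)
            (trans (cong ((+ 2) ℤ.^_) (ℕ.*-comm q 2)) (sym (ℤ.^-*-assoc (+ 2) 2 q)))))))

      deviation-recover : ∀ j → j ℕ.≤ r ℕ.+ q →
        δ j ≡ Sumℤ.sum (upTo (suc q)) (λ s → -1ℤ ℤ.^ (r ℕ.+ s ℕ.+ (r ℕ.+ q ∸ j)) ℤ.* + ((r ℕ.+ s) C (r ℕ.+ q ∸ j)) ℤ.* N s)
      deviation-recover j j≤L = recover-tail δ r q j j≤L deviation-moments-low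

-- Deviations for point sets of sizes four to eight.

module Steps where

  open import Data.Integer as ℤ using (ℤ; +_; 0ℤ; 1ℤ; -1ℤ; _+_; _*_; _-_; -_; _^_)
  import Data.Integer.Properties as ℤ
  open import Data.Integer.Tactic.RingSolver using (solve-∀)
  open import Data.List using (upTo)
  open import Data.Nat as ℕ using (ℕ; zero; suc; z≤n; s≤s; _∸_)
  open import Data.Nat.Combinatorics using (_C_)
  import Data.Nat.Properties as ℕ
  open import Data.Nat.Tactic.RingSolver using () renaming (solve-∀ to solveℕ-∀)
  open import Data.Product using (_,_)
  open import Data.Sum using ([_,_]′)
  open import Relation.Binary.PropositionalEquality as ≡ using (_≡_; refl; cong; cong₂; sym; trans)
  open Series
  open Sums
  open Count
  open Design
  open Forms
  open CodeForms
  open Levels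

  -- The coefficient of X^j Y^(L-j) in V^i X^(L-i).
  signedC : ℕ → ℕ → ℕ → ℤ
  signedC L j i = -1ℤ ^ (i ℕ.+ (L ∸ j)) * + (i C (L ∸ j))

  module Step {n : ℕ} {𝒞 : Code n} {d L k : ℕ} (ext : Extremal 𝒞 d L k)
    (d≡4+L : d ≡ 4 ℕ.+ L) (k≡4+3L : k ≡ 4 ℕ.+ 3 ℕ.* L) (4≤L : 4 ℕ.≤ L) (8≤n : 8 ℕ.≤ n) where

    open Extremal ext
    open Truncation ext
    open Level ext

    4≤d : 4 ℕ.≤ d
    4≤d = ≡.subst (4 ℕ.≤_) (sym d≡4+L) (ℕ.m≤m+n 4 L)

    deviation⇒balanced : ∀ w → (∀ T T′ → wt T ≡ w → wt T′ ≡ w → deviation T T′ 0 ≡ 0ℤ) → Balanced 𝒞 d w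
    deviation⇒balanced w eq T T′ T≡ T′≡ = trans (sym (β-B T)) (trans
      (ℤ.i-j≡0⇒i≡j _ _ (trans (sym (deviation-0 T T′)) (eq T T′ T≡ T′≡))) (β-B T′))

    balanced⇒deviation : ∀ {w} j → Balanced 𝒞 (d ℕ.+ j ℕ.* 4) w → ∀ T T′ → wt T ≡ w → wt T′ ≡ w → deviation T T′ j ≡ 0ℤ
    balanced⇒deviation j bal T T′ T≡ T′≡ = trans (deviation-B T T′ j)
      (trans (cong (_- B 𝒞 (d ℕ.+ j ℕ.* 4) T′) (bal T T′ T≡ T′≡)) (ℤ.+-inverseʳ (B 𝒞 (d ℕ.+ j ℕ.* 4) T′)))

    β-same : ∀ {s w} → s ℕ.≤ n → Balanced 𝒞 d s → ∀ T T′ → wt T ≡ w → wt T′ ≡ w → β 𝒞 d s T ≡ β 𝒞 d s T′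
    β-same {s} s≤n bal T T′ T≡ T′≡ = trans (β-balanced 𝒞 bal s≤n T) (trans
      (cong (λ x → index 𝒞 d s * + (x C s)) (trans T≡ (sym T′≡))) (sym (β-balanced 𝒞 bal s≤n T′)))

    -- Since d = L + 4, sets of at most three points leave r = d - (u + 1) > L, which is the range
    -- of `deviation-low`. Four points just fail.
    balanced-low : ∀ u → u ℕ.< 3 → Balanced 𝒞 d (suc u)
    balanced-low u u<3 = deviation⇒balanced (suc u) λ T T′ T≡ T′≡ →
      deviation-low T T′ (d ∸ suc u) (suc u) T≡ T′≡ (λ ())
        (ℕ.m∸n+n≡m (ℕ.≤-trans (ℕ.m≤n⇒m≤1+n u<3) 4≤d))
        (ℕ.≤-trans (ℕ.≤-reflexive (sym (trans (cong (_∸ 3) (trans d≡4+L (sym (ℕ.+-suc 3 L)))) (ℕ.m+n∸m≡n 3 (suc L))))) (ℕ.∸-monoʳ-≤ d u<3)) 0 z≤n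

    balanced-zero : Balanced 𝒞 d 0
    balanced-zero T T′ T≡ T′≡ = trans (empty T T≡) (sym (empty T′ T′≡))
      where
      empty : ∀ U → wt U ≡ 0 → B 𝒞 d U ≡ total 𝒞 d (λ _ → 1ℤ)
      empty U U≡ = total-cong 𝒞 d (λ c _ _ → sym (subset-C 0 U c U≡))

    balanced-below : ∀ w → w ℕ.< 4 → Balanced 𝒞 d w
    balanced-below zero    _         = balanced-zero
    balanced-below (suc u) (s≤s u<3) = balanced-low u u<3

    -- With 4 + q points the first r = L - q moments vanish, so `N 0` to `N q` are left. `ξ`
    -- compares the moments of order one less than the number of points.
    module Pair (q r : ℕ) (r+q : r ℕ.+ q ≡ L) (T T′ : Word n) (T≡ : wt T ≡ 4 ℕ.+ q) (T′≡ : wt T′ ≡ 4 ℕ.+ q)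
      (same : ∀ s → s ℕ.< 3 ℕ.+ q → β 𝒞 d s T ≡ β 𝒞 d s T′) where

      private
        r+w : r ℕ.+ (4 ℕ.+ q) ≡ d
        r+w = trans (lemma r q) (trans (cong (4 ℕ.+_) r+q) (sym d≡4+L))
          where
          lemma : ∀ r q → r ℕ.+ (4 ℕ.+ q) ≡ 4 ℕ.+ (r ℕ.+ q)
          lemma = solveℕ-∀
        k≡ : k ≡ r ℕ.* 3 ℕ.+ (4 ℕ.+ q ℕ.+ q ℕ.* 2)
        k≡ = trans k≡4+3L (trans (cong (λ l → 4 ℕ.+ 3 ℕ.* l) (sym r+q)) (lemma r q))
          where
          lemma : ∀ r q → 4 ℕ.+ 3 ℕ.* (r ℕ.+ q) ≡ r ℕ.* 3 ℕ.+ (4 ℕ.+ q ℕ.+ q ℕ.* 2)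
          lemma = solveℕ-∀

      δ : ℕ → ℤ
      δ = deviation T T′

      ξ : ℤ
      ξ = β 𝒞 d (3 ℕ.+ q) T - β 𝒞 d (3 ℕ.+ q) T′

      N : ℕ → ℤ
      N s = moment δ L (r ℕ.+ s)

      N-top : N q ≡ δ 0
      N-top = trans (cong (moment δ L) r+q) (moment-top δ L)

      N-equation : ∀ i → i ℕ.< 4 →
        Sumℤ.sum (upTo (suc q)) (λ s → N s * at (monomial q s) i) ≡
        (+ 4) ^ q * (-1ℤ ^ (3 ℕ.+ q) * (ξ * at tP⁻¹ i - at (const (δ 0)) i))
      N-equation i i<4 = trans (sym (trans (sum-coeff (upTo (suc q)) (λ s → S._*_ (const (N s)) (monomial q s)) i)
          (Sumℤ.sum-cong (upTo (suc q)) (λ s → at-const-* (N s) (monomial q s) i)))) (≡.subst (λ l → at (expansion (λ s → moment δ l (r ℕ.+ s)) q) i ≡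
          (+ 4) ^ q * (-1ℤ ^ (3 ℕ.+ q) * (ξ * at tP⁻¹ i - at (const (δ 0)) i))) r+q
        (deviation-moments T T′ q (3 ℕ.+ q) r refl T≡ T′≡ r+w r+q k≡ same i i<4))

      δ-recover : ∀ j → j ℕ.≤ L → δ j ≡ Sumℤ.sum (upTo (suc q)) (λ s → signedC L j (r ℕ.+ s) * N s)
      δ-recover j j≤L = ≡.subst (λ l → δ j ≡ Sumℤ.sum (upTo (suc q))
          (λ s → signedC l j (r ℕ.+ s) * moment δ l (r ℕ.+ s))) r+q
        (deviation-recover T T′ q (3 ℕ.+ q) r refl T≡ T′≡ r+w r+q k≡ same j (≡.subst (j ℕ.≤_) (sym r+q) j≤L))

      ξ≡0 : Balanced 𝒞 d (3 ℕ.+ q) → 3 ℕ.+ q ℕ.≤ n → ξ ≡ 0ℤ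
      ξ≡0 bal 3+q≤n = trans (cong (_- β 𝒞 d (3 ℕ.+ q) T′) (β-same 3+q≤n bal T T′ T≡ T′≡)) (ℤ.+-inverseʳ (β 𝒞 d (3 ℕ.+ q) T′))

    below-same : ∀ w → w ℕ.≤ 8 → (∀ s → s ℕ.< w → Balanced 𝒞 d s) → ∀ T T′ → wt T ≡ suc w → wt T′ ≡ suc w →
      ∀ s → s ℕ.< w → β 𝒞 d s T ≡ β 𝒞 d s T′
    below-same w w≤8 bal T T′ T≡ T′≡ s s<w =
      β-same (ℕ.≤-trans (ℕ.<⇒≤ s<w) (ℕ.≤-trans w≤8 8≤n)) (bal s s<w) T T′ T≡ T′≡

    extend : ∀ {w} → (∀ s → s ℕ.< w → Balanced 𝒞 d s) → Balanced 𝒞 d w → ∀ s → s ℕ.< suc w → Balanced 𝒞 d s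
    extend {w} bal balw s s<1+w =
      [ bal s , (λ s≡w → ≡.subst (Balanced 𝒞 d) (sym s≡w) balw) ]′ (ℕ.m<1+n⇒m<n∨m≡n s<1+w)

    -- A single moment is left, and it is the top one.
    deviation-four : ∀ T T′ → wt T ≡ 4 → wt T′ ≡ 4 → ∀ j → j ℕ.≤ L →
      deviation T T′ j ≡ signedC L j L * deviation T T′ 0
    deviation-four T T′ T≡ T′≡ j j≤L = begin
      δ j                                     ≡⟨ δ-recover j j≤L ⟩
      signedC L j (L ℕ.+ 0) * N 0 + 0ℤ    ≡⟨ ℤ.+-identityʳ (signedC L j (L ℕ.+ 0) * N 0) ⟩
      signedC L j (L ℕ.+ 0) * N 0           ≡⟨ cong₂ (λ x y → signedC L j x * y) (ℕ.+-identityʳ L) N-top ⟩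
      signedC L j L * δ 0 ∎
      where
      open ≡.≡-Reasoning
      open Pair 0 L (ℕ.+-identityʳ L) T T′ T≡ T′≡ (below-same 3 (ℕ.m≤m+n 3 5) (λ s s<3 → balanced-below s (ℕ.m≤n⇒m≤1+n s<3)) T T′ T≡ T′≡)

    balanced-five : Balanced 𝒞 d 4 → Balanced 𝒞 d 5
    balanced-five bal4 = deviation⇒balanced 5 zero-deviation
      where
      zero-deviation : ∀ T T′ → wt T ≡ 5 → wt T′ ≡ 5 → deviation T T′ 0 ≡ 0ℤ
      -- `V` is odd in t, so the coefficients 0 and 2 involve `N 0` only: with ξ = 0 they read N 0 =
      -- -4 δ and 6 N 0 = 0.
      zero-deviation T T′ T≡ T′≡ = solve-for-δ (δ 0) ξ (N 0) (N 1) (ξ≡0 bal4 (ℕ.≤-trans (ℕ.m≤m+n 4 4) 8≤n))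
        (N-equation 0 (s≤s z≤n)) (N-equation 2 (s≤s (s≤s (s≤s z≤n))))
        where
        open Pair 1 (L ∸ 1) (ℕ.m∸n+n≡m (ℕ.≤-trans (ℕ.m≤m+n 1 3) 4≤L)) T T′ T≡ T′≡ (below-same 4 (ℕ.m≤m+n 4 4) balanced-below T T′ T≡ T′≡)
        solve-for-δ : ∀ δ ξ N₀ N₁ → ξ ≡ 0ℤ →
          N₀ * 1ℤ + (N₁ * 0ℤ + 0ℤ) ≡ (+ 4) * (1ℤ * (ξ * 0ℤ - δ)) →
          N₀ * + 6 + (N₁ * 0ℤ + 0ℤ) ≡ (+ 4) * (1ℤ * (ξ * -1ℤ - 0ℤ)) →
          δ ≡ 0ℤ
        solve-for-δ δ ξ N₀ N₁ refl e₀ e₂ = ℤ.*-cancelˡ-≡ (+ 24) δ 0ℤ (begin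
          (+ 24) * δ                                                    ≡⟨ l₀ δ ⟩
          (- + 6) * ((+ 4) * (1ℤ * (0ℤ * 0ℤ - δ)))            ≡⟨ cong ((- + 6) *_) e₀ ⟨
          (- + 6) * (N₀ * 1ℤ + (N₁ * 0ℤ + 0ℤ))                ≡⟨ l₁ N₀ N₁ ⟩
          - (N₀ * + 6 + (N₁ * 0ℤ + 0ℤ))                         ≡⟨ cong -_ e₂ ⟩
          (+ 24) * 0ℤ ∎)
          where
          open ≡.≡-Reasoning
          l₀ : ∀ δ → (+ 24) * δ ≡ (- + 6) * ((+ 4) * (1ℤ * (0ℤ * 0ℤ - δ)))
          l₀ = solve-∀
          l₁ : ∀ N₀ N₁ → (- + 6) * (N₀ * 1ℤ + (N₁ * 0ℤ + 0ℤ)) ≡ - (N₀ * + 6 + (N₁ * 0ℤ + 0ℤ))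
          l₁ = solve-∀

    module _ (T T′ : Word n) (bal : ∀ s → s ℕ.< 6 → Balanced 𝒞 d s) (T≡ : wt T ≡ 6) (T′≡ : wt T′ ≡ 6) where
      private
        r = L ∸ 2
        open Pair 2 r (ℕ.m∸n+n≡m (ℕ.≤-trans (ℕ.m≤m+n 2 2) 4≤L)) T T′ T≡ T′≡ (below-same 5 (ℕ.m≤m+n 5 3) (λ s s<5 → bal s (ℕ.m≤n⇒m≤1+n s<5)) T T′ T≡ T′≡)

      -- The 5-design property gives ξ = 0. Then coefficient 0 yields N 0 = 16 δ, coefficient 1
      -- yields N 1 = 16 δ, and the top moment N 2 is δ, the difference at the minimum weight.
      deviation-six : ∀ j → j ℕ.≤ L → deviation T T′ j ≡
        (signedC L j (r ℕ.+ 0) * + 16 + (signedC L j (r ℕ.+ 1) * + 16 + signedC L j (r ℕ.+ 2))) * deviation T T′ 0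
      deviation-six j j≤L = trans (δ-recover j j≤L) (collect (signedC L j (r ℕ.+ 0)) (signedC L j (r ℕ.+ 1)) (signedC L j (r ℕ.+ 2))
          (δ 0) (N 0) (N 1) (N 2) (N₀ (N 0) (N 1) (N 2) ξ (δ 0) (N-equation 0 (s≤s z≤n)))
          (N₁ (N 0) (N 1) (N 2) ξ (δ 0) (ξ≡0 (bal 5 ℕ.≤-refl) (ℕ.≤-trans (ℕ.m≤m+n 5 3) 8≤n)) (N-equation 0 (s≤s z≤n)) (N-equation 1 (s≤s (s≤s z≤n)))) N-top)
        where
        open ≡.≡-Reasoning
        N₀ : ∀ N₀ N₁ N₂ ξ δ → N₀ * 1ℤ + (N₁ * 0ℤ + (N₂ * 0ℤ + 0ℤ)) ≡ (+ 16) * (-1ℤ * (ξ * 0ℤ - δ)) →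
          N₀ ≡ (+ 16) * δ
        N₀ N₀ N₁ N₂ ξ δ e = trans (l N₀ N₁ N₂) (trans e (l′ ξ δ))
          where
          l : ∀ a b c → a ≡ a * 1ℤ + (b * 0ℤ + (c * 0ℤ + 0ℤ))
          l = solve-∀
          l′ : ∀ ξ δ → (+ 16) * (-1ℤ * (ξ * 0ℤ - δ)) ≡ (+ 16) * δ
          l′ = solve-∀
        N₁ : ∀ N₀′ N₁ N₂ ξ δ → ξ ≡ 0ℤ →
          N₀′ * 1ℤ + (N₁ * 0ℤ + (N₂ * 0ℤ + 0ℤ)) ≡ (+ 16) * (-1ℤ * (ξ * 0ℤ - δ)) →
          N₀′ * - + 8 + (N₁ * + 8 + (N₂ * 0ℤ + 0ℤ)) ≡ (+ 16) * (-1ℤ * (ξ * 1ℤ - 0ℤ)) →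
          N₁ ≡ (+ 16) * δ
        N₁ N₀′ N₁ N₂ ξ δ refl e₀ e₁ = ℤ.*-cancelˡ-≡ (+ 8) N₁ ((+ 16) * δ) (begin
          (+ 8) * N₁    ≡⟨ l N₀′ N₁ N₂ ⟩
          (N₀′ * - + 8 + (N₁ * + 8 + (N₂ * 0ℤ + 0ℤ))) + (+ 8) * N₀′
            ≡⟨ cong₂ (λ x y → x + (+ 8) * y) e₁ (N₀ N₀′ N₁ N₂ 0ℤ δ e₀) ⟩
          0ℤ + (+ 8) * ((+ 16) * δ)   ≡⟨ ℤ.+-identityˡ _ ⟩
          (+ 8) * ((+ 16) * δ) ∎)
          where
          l : ∀ a b c → (+ 8) * b ≡ (a * - + 8 + (b * + 8 + (c * 0ℤ + 0ℤ))) + (+ 8) * a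
          l = solve-∀
        collect : ∀ a b c δ N₀ N₁ N₂ → N₀ ≡ (+ 16) * δ → N₁ ≡ (+ 16) * δ → N₂ ≡ δ →
          a * N₀ + (b * N₁ + (c * N₂ + 0ℤ)) ≡ (a * + 16 + (b * + 16 + c)) * δ
        collect a b c δ _ _ _ refl refl refl = l a b c δ
          where
          l : ∀ a b c δ → a * ((+ 16) * δ) + (b * ((+ 16) * δ) + (c * δ + 0ℤ)) ≡ (a * + 16 + (b * + 16 + c)) * δ
          l = solve-∀

    module _ (T T′ : Word n) (bal : ∀ s → s ℕ.< 7 → Balanced 𝒞 d s) (T≡ : wt T ≡ 7) (T′≡ : wt T′ ≡ 7) where
      private
        r = L ∸ 3
        open Pair 3 r (ℕ.m∸n+n≡m (ℕ.≤-trans (ℕ.m≤m+n 3 1) 4≤L)) T T′ T≡ T′≡ (below-same 6 (ℕ.m≤m+n 6 2) (λ s s<6 → bal s (ℕ.m≤n⇒m≤1+n s<6)) T T′ T≡ T′≡)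

      -- With ξ = 0, the coefficients 0, 1 and 2 determine N 0, N 1 and N 2 as -64, -96 and -30
      -- times the top moment N 3.
      deviation-seven : ∀ j → j ℕ.≤ L → deviation T T′ j ≡
        (signedC L j (r ℕ.+ 0) * - + 64 + (signedC L j (r ℕ.+ 1) * - + 96 + (signedC L j (r ℕ.+ 2) * - + 30 + signedC L j (r ℕ.+ 3)))) * deviation T T′ 0
      deviation-seven j j≤L = trans (δ-recover j j≤L)
        (collect (signedC L j (r ℕ.+ 0)) (signedC L j (r ℕ.+ 1)) (signedC L j (r ℕ.+ 2)) (signedC L j (r ℕ.+ 3))
          (δ 0) ξ (N 0) (N 1) (N 2) (N 3) (ξ≡0 (bal 6 ℕ.≤-refl) (ℕ.≤-trans (ℕ.m≤m+n 6 2) 8≤n))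
          (N-equation 0 (s≤s z≤n)) (N-equation 1 (s≤s (s≤s z≤n))) (N-equation 2 (s≤s (s≤s (s≤s z≤n)))) N-top)
        where
        collect : ∀ a b c e δ ξ N₀ N₁ N₂ N₃ → ξ ≡ 0ℤ →
          N₀ * 1ℤ + (N₁ * 0ℤ + (N₂ * 0ℤ + (N₃ * 0ℤ + 0ℤ))) ≡ (+ 64) * (1ℤ * (ξ * 0ℤ - δ)) →
          N₀ * - + 12 + (N₁ * + 8 + (N₂ * 0ℤ + (N₃ * 0ℤ + 0ℤ))) ≡ (+ 64) * (1ℤ * (ξ * 1ℤ - 0ℤ)) →
          N₀ * + 66 + (N₁ * - + 64 + (N₂ * + 64 + (N₃ * 0ℤ + 0ℤ))) ≡ (+ 64) * (1ℤ * (ξ * -1ℤ - 0ℤ)) →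
          N₃ ≡ δ →
          a * N₀ + (b * N₁ + (c * N₂ + (e * N₃ + 0ℤ))) ≡
          (a * - + 64 + (b * - + 96 + (c * - + 30 + e))) * δ
        -- The diagonal of the triangular system is 1, 8, 64. After multiplication by 64, back
        -- substitution starting from `c` gives the multipliers of the three equations.
        collect a b c e δ _ N₀ N₁ N₂ N₃ refl e₀ e₁ e₂ refl = ℤ.*-cancelˡ-≡ (+ 64) _ _ (begin
          (+ 64) * (a * N₀ + (b * N₁ + (c * N₂ + (e * δ + 0ℤ))))
            ≡⟨ expand a b c e δ N₀ N₁ N₂ ⟩
          ((+ 64) * a + (+ 96) * b + (+ 30) * c) * E₀ + ((+ 8) * b + (+ 8) * c) * E₁ + c * E₂ + (+ 64) * e * δ
            ≡⟨ cong₂ _+_ (cong₂ _+_ (cong₂ _+_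
                 (cong (((+ 64) * a + (+ 96) * b + (+ 30) * c) *_) e₀)
                 (cong (((+ 8) * b + (+ 8) * c) *_) e₁)) (cong (c *_) e₂)) refl ⟩
          ((+ 64) * a + (+ 96) * b + (+ 30) * c) * ((+ 64) * (1ℤ * (0ℤ * 0ℤ - δ)))
            + ((+ 8) * b + (+ 8) * c) * 0ℤ + c * 0ℤ + (+ 64) * e * δ
            ≡⟨ reduce a b c e δ ⟩
          (+ 64) * ((a * - + 64 + (b * - + 96 + (c * - + 30 + e))) * δ) ∎)
          where
          open ≡.≡-Reasoning
          E₀ = N₀ * 1ℤ + (N₁ * 0ℤ + (N₂ * 0ℤ + (δ * 0ℤ + 0ℤ)))
          E₁ = N₀ * - + 12 + (N₁ * + 8 + (N₂ * 0ℤ + (δ * 0ℤ + 0ℤ)))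
          E₂ = N₀ * + 66 + (N₁ * - + 64 + (N₂ * + 64 + (δ * 0ℤ + 0ℤ)))
          expand : ∀ a b c e δ N₀ N₁ N₂ → (+ 64) * (a * N₀ + (b * N₁ + (c * N₂ + (e * δ + 0ℤ)))) ≡
            ((+ 64) * a + (+ 96) * b + (+ 30) * c) * (N₀ * 1ℤ + (N₁ * 0ℤ + (N₂ * 0ℤ + (δ * 0ℤ + 0ℤ))))
            + ((+ 8) * b + (+ 8) * c) * (N₀ * - + 12 + (N₁ * + 8 + (N₂ * 0ℤ + (δ * 0ℤ + 0ℤ))))
            + c * (N₀ * + 66 + (N₁ * - + 64 + (N₂ * + 64 + (δ * 0ℤ + 0ℤ)))) + (+ 64) * e * δ
          expand = solve-∀
          reduce : ∀ a b c e δ → ((+ 64) * a + (+ 96) * b + (+ 30) * c) * ((+ 64) * (1ℤ * (0ℤ * 0ℤ - δ)))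
            + ((+ 8) * b + (+ 8) * c) * 0ℤ + c * 0ℤ + (+ 64) * e * δ ≡
            (+ 64) * ((a * - + 64 + (b * - + 96 + (c * - + 30 + e))) * δ)
          reduce = solve-∀

    module _ (T T′ : Word n) (bal : ∀ s → s ℕ.< 7 → Balanced 𝒞 d s) (T≡ : wt T ≡ 8) (T′≡ : wt T′ ≡ 8) where
      private
        r = L ∸ 4
        open Pair 4 r (ℕ.m∸n+n≡m 4≤L) T T′ T≡ T′≡ (below-same 7 (ℕ.m≤m+n 7 1) bal T T′ T≡ T′≡)

      -- Only strength 6 of the minimum-weight words is assumed, so the difference of the seventh
      -- moments stays as a second parameter. The four unknowns below the top moment use up all four
      -- known coefficients.
      deviation-eight : ∀ j → j ℕ.≤ L → deviation T T′ j ≡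
        (signedC L j (r ℕ.+ 0) * + 256 + (signedC L j (r ℕ.+ 1) * + 512 + (signedC L j (r ℕ.+ 2) * + 288
          + (signedC L j (r ℕ.+ 3) * + 32 + signedC L j (r ℕ.+ 4))))) * deviation T T′ 0
        + (signedC L j (r ℕ.+ 1) * - + 32 + (signedC L j (r ℕ.+ 2) * - + 44
          + signedC L j (r ℕ.+ 3) * - + 11)) * (β 𝒞 d 7 T - β 𝒞 d 7 T′)
      deviation-eight j j≤L = trans (δ-recover j j≤L)
        (collect (signedC L j (r ℕ.+ 0)) (signedC L j (r ℕ.+ 1)) (signedC L j (r ℕ.+ 2)) (signedC L j (r ℕ.+ 3)) (signedC L j (r ℕ.+ 4))
          (δ 0) ξ (N 0) (N 1) (N 2) (N 3) (N 4)
          (N-equation 0 (s≤s z≤n)) (N-equation 1 (s≤s (s≤s z≤n))) (N-equation 2 (s≤s (s≤s (s≤s z≤n))))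
          (N-equation 3 (s≤s (s≤s (s≤s (s≤s z≤n))))) N-top)
        where
        row : ℤ → ℤ → ℤ → ℤ → ℤ → ℤ → ℤ → ℤ → ℤ → ℤ → ℤ
        row a b c e f N₀ N₁ N₂ N₃ N₄ = N₀ * a + (N₁ * b + (N₂ * c + (N₃ * e + (N₄ * f + 0ℤ))))
        collect : ∀ a b c e f δ ξ N₀ N₁ N₂ N₃ N₄ →
          row (+ 1) 0ℤ 0ℤ 0ℤ 0ℤ N₀ N₁ N₂ N₃ N₄ ≡ (+ 256) * (-1ℤ * (ξ * 0ℤ - δ)) →
          row (- + 16) (+ 8) 0ℤ 0ℤ 0ℤ N₀ N₁ N₂ N₃ N₄ ≡ (+ 256) * (-1ℤ * (ξ * 1ℤ - 0ℤ)) →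
          row (+ 120) (- + 96) (+ 64) 0ℤ 0ℤ N₀ N₁ N₂ N₃ N₄ ≡ (+ 256) * (-1ℤ * (ξ * -1ℤ - 0ℤ)) →
          row (- + 560) (+ 536) (- + 512) (+ 512) 0ℤ N₀ N₁ N₂ N₃ N₄ ≡ (+ 256) * (-1ℤ * (ξ * 1ℤ - 0ℤ)) →
          N₄ ≡ δ →
          a * N₀ + (b * N₁ + (c * N₂ + (e * N₃ + (f * N₄ + 0ℤ)))) ≡
          (a * + 256 + (b * + 512 + (c * + 288 + (e * + 32 + f)))) * δ
          + (b * - + 32 + (c * - + 44 + e * - + 11)) * ξ
        -- As for seven points, now with diagonal 1, 8, 64, 512.
        collect a b c e f δ ξ N₀ N₁ N₂ N₃ _ e₀ e₁ e₂ e₃ refl = ℤ.*-cancelˡ-≡ (+ 512) _ _ (trans (expand a b c e f δ N₀ N₁ N₂ N₃)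
          (trans (cong₂ _+_ (cong₂ _+_ (cong₂ _+_ (cong₂ _+_
            (cong (((+ 512) * a + (+ 1024) * b + (+ 576) * c + (+ 64) * e) *_) e₀)
            (cong (((+ 64) * b + (+ 96) * c + (+ 29) * e) *_) e₁))
            (cong (((+ 8) * c + (+ 8) * e) *_) e₂)) (cong (e *_) e₃)) refl)
          (reduce a b c e f δ ξ)))
          where
          expand : ∀ a b c e f δ N₀ N₁ N₂ N₃ → (+ 512) * (a * N₀ + (b * N₁ + (c * N₂ + (e * N₃ + (f * δ + 0ℤ))))) ≡
            ((+ 512) * a + (+ 1024) * b + (+ 576) * c + (+ 64) * e) * (N₀ * + 1 + (N₁ * 0ℤ + (N₂ * 0ℤ + (N₃ * 0ℤ + (δ * 0ℤ + 0ℤ)))))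
            + ((+ 64) * b + (+ 96) * c + (+ 29) * e) * (N₀ * - + 16 + (N₁ * + 8 + (N₂ * 0ℤ + (N₃ * 0ℤ + (δ * 0ℤ + 0ℤ)))))
            + ((+ 8) * c + (+ 8) * e) * (N₀ * + 120 + (N₁ * - + 96 + (N₂ * + 64 + (N₃ * 0ℤ + (δ * 0ℤ + 0ℤ)))))
            + e * (N₀ * - + 560 + (N₁ * + 536 + (N₂ * - + 512 + (N₃ * + 512 + (δ * 0ℤ + 0ℤ))))) + (+ 512) * f * δ
          expand = solve-∀
          reduce : ∀ a b c e f δ ξ → ((+ 512) * a + (+ 1024) * b + (+ 576) * c + (+ 64) * e) * ((+ 256) * (-1ℤ * (ξ * 0ℤ - δ))) + ((+ 64) * b + (+ 96) * c + (+ 29) * e) * ((+ 256) * (-1ℤ * (ξ * 1ℤ - 0ℤ)))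
            + ((+ 8) * c + (+ 8) * e) * ((+ 256) * (-1ℤ * (ξ * -1ℤ - 0ℤ))) + e * ((+ 256) * (-1ℤ * (ξ * 1ℤ - 0ℤ))) + (+ 512) * f * δ ≡
            (+ 512) * ((a * + 256 + (b * + 512 + (c * + 288 + (e * + 32 + f)))) * δ
            + (b * - + 32 + (c * - + 44 + e * - + 11)) * ξ)
          reduce = solve-∀

-- The number of words of minimum weight.

module MinCount where

  open import Algebra.Bundles using (CommutativeRing)
  open import Data.Integer as ℤ using (ℤ; +_; 0ℤ; 1ℤ)
  import Data.Integer.Properties as ℤ
  open import Data.Integer.Tactic.RingSolver using (solve-∀)
  open import Data.Nat as ℕ using (ℕ; zero; suc; z≤n; s≤s; _∸_)
  open import Data.Nat.Combinatorics using (_C_; nC1≡n)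
  import Data.Nat.Properties as ℕ
  open import Relation.Binary.PropositionalEquality as ≡ using (_≡_; _≢_; refl; cong; cong₂; sym; trans)
  open Series
  open Count
  open Design
  open Enumerator
  open Forms
  open Residue
  open CodeForms
  open Levels

  open CommutativeRing seriesRing using (_+_; _*_; _-_; -_; 1#; 0#)
  open SeriesSolver using (solve; _:=_; _:*_; _:+_; _:-_; _:^_; :-_; con)

  C2-double : ∀ n → (+ 2) ℤ.* + (n C 2) ≡ + n ℤ.* (+ n ℤ.- 1ℤ)
  C2-double zero    = refl
  C2-double (suc n) = begin
    (+ 2) ℤ.* + (suc n C 2)
      ≡⟨ cong ((+ 2) ℤ.*_) (trans (sym (pascal n 1)) (cong (λ x → + x ℤ.+ + (n C 2)) (nC1≡n n))) ⟩
    (+ 2) ℤ.* (+ n ℤ.+ + (n C 2))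
      ≡⟨ ℤ.*-distribˡ-+ (+ 2) (+ n) (+ (n C 2)) ⟩
    (+ 2) ℤ.* + n ℤ.+ (+ 2) ℤ.* + (n C 2)
      ≡⟨ cong (ℤ._+_ ((+ 2) ℤ.* + n)) (C2-double n) ⟩
    (+ 2) ℤ.* + n ℤ.+ + n ℤ.* (+ n ℤ.- 1ℤ)
      ≡⟨ lemma (+ n) ⟩
    + suc n ℤ.* (+ suc n ℤ.- 1ℤ) ∎
    where
    open ≡.≡-Reasoning
    lemma : ∀ n → (+ 2) ℤ.* n ℤ.+ n ℤ.* (n ℤ.- 1ℤ) ≡ (1ℤ ℤ.+ n) ℤ.* ((1ℤ ℤ.+ n) ℤ.- 1ℤ)
    lemma = solve-∀

  module Minimum {n : ℕ} {𝒞 : Code n} {d L k : ℕ} (ext : Extremal 𝒞 d L k) (m : ℕ)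
    (L≡4m : L ≡ m ℕ.* 4) (d≡4+L : d ≡ 4 ℕ.+ L) (k≡4+3L : k ≡ 4 ℕ.+ 3 ℕ.* L) (2≤n : 2 ℕ.≤ n)
    (balanced-1 : Balanced 𝒞 d 1) (balanced-2 : Balanced 𝒞 d 2) where

    open Extremal ext
    open Truncation ext
    open Level ext

    private
      T₁ = prefix 1 n
      T₂ = prefix 2 n

      T₁≡ : wt T₁ ≡ 1
      T₁≡ = prefix-wt (ℕ.<⇒≤ 2≤n)

      T₂≡ : wt T₂ ≡ 2
      T₂≡ = prefix-wt 2≤n

      -- For at most three points d - w exceeds L, so only the zero word is visible up to t^L.
      meets-1 : ∀ w T → wt T ≡ w → w ℕ.< 4 → meets T ≡[ suc L ] 1#
      meets-1 w T T≡ w<4 = upTo< λ i i<1+L → trans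
        (below (meets-truncated T (d ∸ w) (trans (cong (d ∸ w ℕ.+_) T≡) (ℕ.m∸n+n≡m (ℕ.≤-trans (ℕ.<⇒≤ w<4) (≡.subst (4 ℕ.≤_) (sym d≡4+L) (ℕ.m≤m+n 4 L))))))
          i (ℕ.≤-trans (ℕ.<-≤-trans i<1+L L<r) (ℕ.m≤m+n (d ∸ w) 4)))
        (trans (cong (ℤ._+_ (at 1# i)) (t^-below (d ∸ w) (profile T) i (ℕ.<-≤-trans i<1+L L<r))) (ℤ.+-identityʳ (at 1# i)))
        where
        L<r : suc L ℕ.≤ d ∸ w
        L<r = ℕ.≤-trans (ℕ.≤-reflexive (sym (trans (cong (_∸ 3) (trans d≡4+L (sym (ℕ.+-suc 3 L)))) (ℕ.m+n∸m≡n 3 (suc L)))))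
          (ℕ.∸-monoʳ-≤ d (ℕ.s≤s⁻¹ w<4))

      doubled : const (+ 2) ^ 2 * (contains T₁ - contains T₂) ≋
        const (+ 2) ^ k * (const (+ 2) * (M * meets T₁) - M * (M * meets T₂))
      doubled = begin
        const (+ 2) ^ 2 * (contains T₁ - contains T₂)
          ≈⟨ solve 2 (λ x y → con (+ 2) :^ 2 :* (x :- y) := con (+ 2) :* (con (+ 2) :^ 1 :* x) :- con (+ 2) :^ 2 :* y) S.refl
               (contains T₁) (contains T₂) ⟩
        const (+ 2) * (const (+ 2) ^ 1 * contains T₁) - const (+ 2) ^ 2 * contains T₂
          ≈⟨ S.+-cong (S.*-congˡ (S.trans (S.reflexive (cong (λ w → const (+ 2) ^ w * contains T₁) (sym T₁≡)))
               (S.trans (S.sym (identity T₁)) (S.reflexive (cong (λ w → const (+ 2) ^ k * (M ^ w * meets T₁)) T₁≡)))))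
               (S.-‿cong (S.trans (S.reflexive (cong (λ w → const (+ 2) ^ w * contains T₂) (sym T₂≡)))
               (S.trans (S.sym (identity T₂)) (S.reflexive (cong (λ w → const (+ 2) ^ k * (M ^ w * meets T₂)) T₂≡))))) ⟩
        const (+ 2) * (const (+ 2) ^ k * (M ^ 1 * meets T₁)) - const (+ 2) ^ k * (M ^ 2 * meets T₂)
          ≈⟨ solve 4 (λ a m x y → con (+ 2) :* (a :* (m :^ 1 :* x)) :- a :* (m :^ 2 :* y) :=
               a :* (con (+ 2) :* (m :* x) :- m :* (m :* y))) S.refl (const (+ 2) ^ k) M (meets T₁) (meets T₂) ⟩
        const (+ 2) ^ k * (const (+ 2) * (M * meets T₁) - M * (M * meets T₂)) ∎
        where open ≋-Reasoning

      -- The truncations of meets T₁ and meets T₂ are 1, and 2 M - M² = M P.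
      leading : const (+ 2) ^ 2 * form (deviation T₁ T₂) L ≡[ suc L ] const (+ 2) ^ k * (E * Z) ^ (3 ℕ.+ L)
      leading = ≡[]-trans (≋⇒≡[] (suc L) first) (≡[]-trans (*-congˡ-≡[] ((E * Z) ^ d * const (+ 2) ^ k) truncated) (≋⇒≡[] (suc L) last))
        where
        open ≋-Reasoning
        first : const (+ 2) ^ 2 * form (deviation T₁ T₂) L ≋
          (E * Z) ^ d * const (+ 2) ^ k * (const (+ 2) * (M * meets T₁) - M * (M * meets T₂))
        first = begin
          const (+ 2) ^ 2 * form (deviation T₁ T₂) L
            ≈⟨ S.*-congˡ (cancel-MP _) ⟨
          const (+ 2) ^ 2 * ((E * Z) ^ d * ((M * P) ^ d * form (deviation T₁ T₂) L))
            ≈⟨ S.*-congˡ (S.*-congˡ (contains-difference T₁ T₂ (λ eq → ℕ.1+n≢0 (trans (sym T₁≡) eq))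
                 (λ eq → ℕ.1+n≢0 (trans (sym T₂≡) eq)))) ⟨
          const (+ 2) ^ 2 * ((E * Z) ^ d * (contains T₁ - contains T₂))
            ≈⟨ solve 3 (λ a e x → a :* (e :* x) := e :* (a :* x)) S.refl (const (+ 2) ^ 2) ((E * Z) ^ d) (contains T₁ - contains T₂) ⟩
          (E * Z) ^ d * (const (+ 2) ^ 2 * (contains T₁ - contains T₂))
            ≈⟨ S.trans (S.*-congˡ doubled) (S.sym (S.*-assoc _ _ _)) ⟩
          (E * Z) ^ d * const (+ 2) ^ k * (const (+ 2) * (M * meets T₁) - M * (M * meets T₂)) ∎
        truncated : const (+ 2) * (M * meets T₁) - M * (M * meets T₂) ≡[ suc L ] const (+ 2) * (M * 1#) - M * (M * 1#)
        truncated = upTo< λ i i<1+L → cong₂ ℤ._-_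
          (below (*-congˡ-≡[] (const (+ 2)) (*-congˡ-≡[] M (meets-1 1 T₁ T₁≡ (s≤s (s≤s z≤n))))) i i<1+L)
          (below (*-congˡ-≡[] M (*-congˡ-≡[] M (meets-1 2 T₂ T₂≡ (s≤s (s≤s (s≤s z≤n)))))) i i<1+L)
        last : (E * Z) ^ d * const (+ 2) ^ k * (const (+ 2) * (M * 1#) - M * (M * 1#)) ≋ const (+ 2) ^ k * (E * Z) ^ (3 ℕ.+ L)
        last = begin
          (E * Z) ^ d * const (+ 2) ^ k * (const (+ 2) * (M * 1#) - M * (M * 1#))
            ≡⟨ cong (λ x → (E * Z) ^ x * const (+ 2) ^ k * (const (+ 2) * (M * 1#) - M * (M * 1#))) d≡4+L ⟩
          E * Z * (E * Z) ^ (3 ℕ.+ L) * const (+ 2) ^ k * (const (+ 2) * (M * 1#) - M * (M * 1#))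
            ≈⟨ solve 4 (λ ez q a t → ez :* q :* a :* (con (+ 2) :* ((con 1ℤ :- t) :* con 1ℤ) :- (con 1ℤ :- t) :* ((con 1ℤ :- t) :* con 1ℤ)) :=
                 a :* q :* (ez :* ((con 1ℤ :- t) :* (con 1ℤ :+ t)))) S.refl (E * Z) ((E * Z) ^ (3 ℕ.+ L)) (const (+ 2) ^ k) t ⟩
          const (+ 2) ^ k * (E * Z) ^ (3 ℕ.+ L) * (E * Z * (M * P))
            ≈⟨ S.trans (S.*-congˡ EZMP) (S.*-identityʳ _) ⟩
          const (+ 2) ^ k * (E * Z) ^ (3 ℕ.+ L) ∎

    -- A single set would leave the all-one word in the enumerator. The difference of a 1-set and a
    -- 2-set removes it, and its top moment is λ₁ - λ₂. The factor 4 is the quotient of 2^k = 16 ·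
    -- 8^L by the factor 4 · 8^L on the left.
    minimum-difference : index 𝒞 d 1 ℤ.- index 𝒞 d 2 ≡ (+ 4) ℤ.* + residue (3 ℕ.+ L) m
    minimum-difference = trans (trans (sym at-0) (sym (moment-top δ L))) (ℤ.*-cancelˡ-≡ ((+ 4) ℤ.* (+ 8) ℤ.^ L) _ _ {{ℤ.≢-nonZero nonzero}} (begin
      (+ 4) ℤ.* (+ 8) ℤ.^ L ℤ.* moment δ L L
        ≡⟨ reorder ((+ 8) ℤ.^ L) (moment δ L L) ⟩
      (+ 2) ℤ.^ 2 ℤ.* (moment δ L L ℤ.* (+ 8) ℤ.^ L)
        ≡⟨ residue-moment δ L 2 k ((E * Z) ^ (3 ℕ.+ L)) leading ⟩
      (+ 2) ℤ.^ k ℤ.* at (kernel L * (E * Z) ^ (3 ℕ.+ L)) L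
        ≡⟨ cong₂ ℤ._*_ 2^k (trans (coeff (kernel-EZ L) L) (trans (cong (at (E ^ (4 ℕ.+ L) * (P ^ 4 * Z ^ 3))) L≡4m) (residue-coefficient (3 ℕ.+ L) m))) ⟩
      (+ 16) ℤ.* (+ 8) ℤ.^ L ℤ.* + residue (3 ℕ.+ L) m
        ≡⟨ reorder′ ((+ 8) ℤ.^ L) (+ residue (3 ℕ.+ L) m) ⟩
      (+ 4) ℤ.* (+ 8) ℤ.^ L ℤ.* ((+ 4) ℤ.* + residue (3 ℕ.+ L) m) ∎))
      where
      open ≡.≡-Reasoning
      δ = deviation T₁ T₂
      at-0 : δ 0 ≡ index 𝒞 d 1 ℤ.- index 𝒞 d 2
      at-0 = trans (deviation-B T₁ T₂ 0) (cong (λ w → B 𝒞 w T₁ ℤ.- B 𝒞 w T₂) (ℕ.+-identityʳ d))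
      nonzero : (+ 4) ℤ.* (+ 8) ℤ.^ L ≢ 0ℤ
      nonzero eq = 8^≢0 L (ℤ.*-cancelˡ-≡ (+ 4) _ 0ℤ eq)
      reorder : ∀ a b → (+ 4) ℤ.* a ℤ.* b ≡ (+ 4) ℤ.* (b ℤ.* a)
      reorder = solve-∀
      reorder′ : ∀ a b → (+ 16) ℤ.* a ℤ.* b ≡ (+ 4) ℤ.* a ℤ.* ((+ 4) ℤ.* b)
      reorder′ = solve-∀
      2^k : (+ 2) ℤ.^ k ≡ (+ 16) ℤ.* (+ 8) ℤ.^ L
      2^k = trans (cong ((+ 2) ℤ.^_) k≡4+3L) (trans (ℤ.^-distribˡ-+-* (+ 2) 4 (3 ℕ.* L))
        (cong ((+ 16) ℤ.*_) (sym (ℤ.^-*-assoc (+ 2) 3 L))))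

    A : ℤ
    A = total 𝒞 d (λ _ → 1ℤ)

    -- From λ₁ = A d / n and λ₂ = A d (d - 1) / (n (n - 1)) the difference λ₁ - λ₂ is A d (n - d) /
    -- (n (n - 1)).
    minimum-count : A ℤ.* (+ d ℤ.* (+ n ℤ.- + d)) ≡ (+ 4) ℤ.* + residue (3 ℕ.+ L) m ℤ.* (+ n ℤ.* (+ n ℤ.- 1ℤ))
    minimum-count = begin
      A ℤ.* (+ d ℤ.* (+ n ℤ.- + d))
        ≡⟨ regroup A (+ d) (+ n) ⟩
      (+ d ℤ.* A) ℤ.* (+ n ℤ.- 1ℤ) ℤ.- A ℤ.* (+ d ℤ.* (+ d ℤ.- 1ℤ))
        ≡⟨ cong₂ (λ x y → x ℤ.* (+ n ℤ.- 1ℤ) ℤ.- A ℤ.* y) i₁ (sym (C2-double d)) ⟩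
      (index 𝒞 d 1 ℤ.* + n) ℤ.* (+ n ℤ.- 1ℤ) ℤ.- A ℤ.* ((+ 2) ℤ.* + (d C 2))
        ≡⟨ cong (λ y → (index 𝒞 d 1 ℤ.* + n) ℤ.* (+ n ℤ.- 1ℤ) ℤ.- y) (trans (swap A (+ (d C 2))) (cong ((+ 2) ℤ.*_) (sym i₂))) ⟩
      (index 𝒞 d 1 ℤ.* + n) ℤ.* (+ n ℤ.- 1ℤ) ℤ.- (+ 2) ℤ.* (index 𝒞 d 2 ℤ.* + (n C 2))
        ≡⟨ cong (λ y → (index 𝒞 d 1 ℤ.* + n) ℤ.* (+ n ℤ.- 1ℤ) ℤ.- y) (trans (swap′ (index 𝒞 d 2) (+ (n C 2))) (cong (index 𝒞 d 2 ℤ.*_) (C2-double n))) ⟩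
      (index 𝒞 d 1 ℤ.* + n) ℤ.* (+ n ℤ.- 1ℤ) ℤ.- index 𝒞 d 2 ℤ.* (+ n ℤ.* (+ n ℤ.- 1ℤ))
        ≡⟨ factor (index 𝒞 d 1) (index 𝒞 d 2) (+ n) (+ n ℤ.- 1ℤ) ⟩
      (index 𝒞 d 1 ℤ.- index 𝒞 d 2) ℤ.* (+ n ℤ.* (+ n ℤ.- 1ℤ))
        ≡⟨ cong (ℤ._* (+ n ℤ.* (+ n ℤ.- 1ℤ))) minimum-difference ⟩
      (+ 4) ℤ.* + residue (3 ℕ.+ L) m ℤ.* (+ n ℤ.* (+ n ℤ.- 1ℤ)) ∎
      where
      open ≡.≡-Reasoning
      i₁ : + d ℤ.* A ≡ index 𝒞 d 1 ℤ.* + n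
      i₁ = sym (trans (cong (λ x → index 𝒞 d 1 ℤ.* + x) (sym (nC1≡n n)))
        (trans (index-total 𝒞 balanced-1 (ℕ.<⇒≤ 2≤n)) (cong (λ x → + x ℤ.* A) (nC1≡n d))))
      i₂ : index 𝒞 d 2 ℤ.* + (n C 2) ≡ + (d C 2) ℤ.* A
      i₂ = index-total 𝒞 balanced-2 2≤n
      regroup : ∀ A d n → A ℤ.* (d ℤ.* (n ℤ.- d)) ≡ (d ℤ.* A) ℤ.* (n ℤ.- 1ℤ) ℤ.- A ℤ.* (d ℤ.* (d ℤ.- 1ℤ))
      regroup = solve-∀
      swap : ∀ a b → a ℤ.* ((+ 2) ℤ.* b) ≡ (+ 2) ℤ.* (b ℤ.* a)
      swap = solve-∀
      swap′ : ∀ a b → (+ 2) ℤ.* (a ℤ.* b) ≡ a ℤ.* ((+ 2) ℤ.* b)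
      swap′ = solve-∀
      factor : ∀ a b n n′ → (a ℤ.* n) ℤ.* n′ ℤ.- b ℤ.* (n ℤ.* n′) ≡ (a ℤ.- b) ℤ.* (n ℤ.* n′)
      factor = solve-∀

-- Divisibility from the intersections with a codeword.

module Parity where

  open import Data.Bool using (true; false)
  open import Data.Bool.Properties using (not-involutive)
  open import Data.Fin.Subset using (∣_∣; _∩_)
  open import Data.Integer as ℤ using (ℤ; +_; 1ℤ; _+_; _*_; _-_; -_)
  open import Data.Integer.Tactic.RingSolver using (solve-∀)
  open import Data.Nat as ℕ using (ℕ; zero; suc)
  open import Data.Nat.Combinatorics using (_C_)
  import Data.Nat.Properties as ℕ
  open import Data.Nat.Tactic.RingSolver using () renaming (solve-∀ to solveℕ-∀)
  open import Data.Product using (_,_; ∃-syntax)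
  open import Relation.Binary.PropositionalEquality as ≡ using (_≡_; refl; cong; cong₂; sym; trans)
  open Count using (pascal)
  open import Data.Vec using ([]; _∷_)
  open Design
  open CodeForms using (odd)

  double half : ℕ → ℕ
  double zero    = zero
  double (suc i) = suc (suc (double i))
  half zero          = zero
  half (suc zero)    = zero
  half (suc (suc j)) = suc (half j)

  double-half : ∀ j → odd j ≡ false → double (half j) ≡ j
  double-half zero          _  = refl
  double-half (suc (suc j)) ev = cong (λ x → suc (suc x)) (double-half j (trans (sym (not-involutive (odd j))) ev))

  double-+ : ∀ i → double i ≡ i ℕ.+ i
  double-+ zero    = refl
  double-+ (suc i) = cong suc (trans (cong suc (double-+ i)) (sym (ℕ.+-suc i i)))

  two-mod-four : ∀ j → odd j ≡ false → odd (half j) ≡ true → j ≡ 2 ℕ.+ 4 ℕ.* half (half j)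
  two-mod-four j even odd-half = trans (sym (double-half j even)) (trans
    (cong double (suc-double (half j) odd-half)) (trans (double-+ (suc (double (half (half j)))))
    (trans (cong (λ x → suc x ℕ.+ suc x) (double-+ (half (half j)))) (lemma (half (half j))))))
    where
    lemma : ∀ h → 1 ℕ.+ (h ℕ.+ h) ℕ.+ (1 ℕ.+ (h ℕ.+ h)) ≡ 2 ℕ.+ 4 ℕ.* h
    lemma = solveℕ-∀
    suc-double : ∀ i → odd i ≡ true → i ≡ suc (double (half i))
    suc-double (suc zero)    _  = refl
    suc-double (suc (suc i)) ev = cong (λ x → suc (suc x)) (suc-double i (trans (sym (not-involutive (odd i))) ev))

  -- The coefficients come from (1 + x)²ⁱ = (1 + (2 x + x²))ⁱ.
  record Doubling (f g : ℕ → ℤ) : Set where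
    constructor doubling
    field
      f₁ : f 1 ≡ (+ 2) * g 1
      f₂ : f 2 ≡ g 1 + (+ 4) * g 2
      f₃ : f 3 ≡ (+ 4) * g 2 + (+ 8) * g 3
      f₄ : f 4 ≡ g 2 + (+ 12) * g 3 + (+ 16) * g 4
      f₅ : f 5 ≡ (+ 6) * g 3 + (+ 32) * g 4 + (+ 32) * g 5
      f₆ : f 6 ≡ g 3 + (+ 24) * g 4 + (+ 80) * g 5 + (+ 64) * g 6

  choose : ℕ → ℕ → ℤ
  choose n k = + (n C k)

  private
    pascal₂ : ∀ n k → choose (suc (suc n)) (suc (suc k)) ≡ choose n (suc (suc k)) + (+ 2) * choose n (suc k) + choose n k
    pascal₂ n k = trans (sym (pascal (suc n) (suc k))) (trans
      (sym (cong₂ _+_ (pascal n k) (pascal n (suc k))))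
      (lemma (choose n k) (choose n (suc k)) (choose n (suc (suc k)))))
      where
      lemma : ∀ a b c → a + b + (b + c) ≡ c + (+ 2) * b + a
      lemma = solve-∀

    pascal₂₁ : ∀ n → choose (suc (suc n)) 1 ≡ choose n 1 + (+ 2)
    pascal₂₁ n = trans (sym (pascal (suc n) 0)) (trans (cong (_+_ 1ℤ) (sym (pascal n 0))) (lemma (choose n 1)))
      where
      lemma : ∀ c → 1ℤ + (1ℤ + c) ≡ c + (+ 2)
      lemma = solve-∀

  -- Pascal's rule, applied twice to `double i` and once to `i`, gives both sides of each equation
  -- the same recurrence.
  double-binomials : ∀ i → Doubling (choose (double i)) (choose i)
  double-binomials zero = doubling refl refl refl refl refl refl
  double-binomials (suc i) with double-binomials i
  ... | doubling f₁ f₂ f₃ f₄ f₅ f₆ = doubling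
    (trans (pascal₂₁ D) (trans (cong (_+ + 2) f₁)
      (trans (l₁ (g 1)) (cong ((+ 2) *_) (pascal i 0)))))
    (trans (pascal₂ D 0) (trans (cong₂ (λ x y → x + (+ 2) * y + 1ℤ) f₂ f₁)
      (trans (l₂ (g 1) (g 2)) (cong₂ (λ x y → x + (+ 4) * y) (pascal i 0) (pascal i 1)))))
    (trans (pascal₂ D 1) (trans (cong₃ f₃ f₂ f₁)
      (trans (l₃ (g 1) (g 2) (g 3)) (cong₂ (λ x y → (+ 4) * x + (+ 8) * y) (pascal i 1) (pascal i 2)))))
    (trans (pascal₂ D 2) (trans (cong₃ f₄ f₃ f₂)
      (trans (l₄ (g 1) (g 2) (g 3) (g 4)) (cong₂ (λ x y → x + (+ 16) * y)
        (cong₂ (λ x y → x + (+ 12) * y) (pascal i 1) (pascal i 2)) (pascal i 3)))))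
    (trans (pascal₂ D 3) (trans (cong₃ f₅ f₄ f₃)
      (trans (l₅ (g 2) (g 3) (g 4) (g 5)) (cong₂ (λ x y → x + (+ 32) * y)
        (cong₂ (λ x y → (+ 6) * x + (+ 32) * y) (pascal i 2) (pascal i 3)) (pascal i 4)))))
    (trans (pascal₂ D 4) (trans (cong₃ f₆ f₅ f₄)
      (trans (l₆ (g 2) (g 3) (g 4) (g 5) (g 6)) (cong₂ (λ x y → x + (+ 64) * y)
        (cong₂ (λ x y → x + (+ 80) * y) (cong₂ (λ x y → x + (+ 24) * y) (pascal i 2) (pascal i 3)) (pascal i 4)) (pascal i 5)))))
    where
    D = double i
    g = choose i
    cong₃ : ∀ {a b c a′ b′ c′} → a ≡ a′ → b ≡ b′ → c ≡ c′ → a + (+ 2) * b + c ≡ a′ + (+ 2) * b′ + c′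
    cong₃ refl refl refl = refl
    l₁ : ∀ a → (+ 2) * a + + 2 ≡ (+ 2) * (1ℤ + a)
    l₁ = solve-∀
    l₂ : ∀ a b → a + (+ 4) * b + (+ 2) * ((+ 2) * a) + 1ℤ ≡ (1ℤ + a) + (+ 4) * (a + b)
    l₂ = solve-∀
    l₃ : ∀ a b c → (+ 4) * b + (+ 8) * c + (+ 2) * (a + (+ 4) * b) + (+ 2) * a ≡
      (+ 4) * (a + b) + (+ 8) * (b + c)
    l₃ = solve-∀
    l₄ : ∀ a b c d → b + (+ 12) * c + (+ 16) * d + (+ 2) * ((+ 4) * b + (+ 8) * c) + (a + (+ 4) * b) ≡
      (a + b) + (+ 12) * (b + c) + (+ 16) * (c + d)
    l₄ = solve-∀
    l₅ : ∀ b c d e → (+ 6) * c + (+ 32) * d + (+ 32) * e + (+ 2) * (b + (+ 12) * c + (+ 16) * d)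
      + ((+ 4) * b + (+ 8) * c) ≡ (+ 6) * (b + c) + (+ 32) * (c + d) + (+ 32) * (d + e)
    l₅ = solve-∀
    l₆ : ∀ b c d e f → c + (+ 24) * d + (+ 80) * e + (+ 64) * f
      + (+ 2) * ((+ 6) * c + (+ 32) * d + (+ 32) * e) + (b + (+ 12) * c + (+ 16) * d) ≡
      (b + c) + (+ 24) * (c + d) + (+ 80) * (d + e) + (+ 64) * (e + f)
    l₆ = solve-∀

  -- Newton coefficients of j (j - 2) ⋯ (j - 10) / 45 and of j (j - 4) ⋯ (j - 20) / 45.
  alternating₂ alternating₄ : (ℕ → ℤ) → ℤ
  alternating₂ f = (- + 21) * f 1 + (+ 42) * f 2 + (- + 56) * f 3
    + (+ 56) * f 4 + (- + 40) * f 5 + (+ 16) * f 6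
  alternating₄ f = (- + 1463) * f 1 + (+ 1582) * f 2 + (- + 1020) * f 3
    + (+ 440) * f 4 + (- + 120) * f 5 + (+ 16) * f 6

  private
    cong₆ : ∀ (F : ℤ → ℤ → ℤ → ℤ → ℤ → ℤ → ℤ) {a b c d e f a′ b′ c′ d′ e′ f′} →
      a ≡ a′ → b ≡ b′ → c ≡ c′ → d ≡ d′ → e ≡ e′ → f ≡ f′ → F a b c d e f ≡ F a′ b′ c′ d′ e′ f′
    cong₆ F refl refl refl refl refl refl = refl

  alternating₂-cong : ∀ {f g} → (∀ s → s ℕ.≤ 6 → f s ≡ g s) → alternating₂ f ≡ alternating₂ g
  alternating₂-cong eq = cong₆ (λ a b c d e f → (- + 21) * a + (+ 42) * b + (- + 56) * c
      + (+ 56) * d + (- + 40) * e + (+ 16) * f)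
    (eq 1 (ℕ.m≤m+n 1 5)) (eq 2 (ℕ.m≤m+n 2 4)) (eq 3 (ℕ.m≤m+n 3 3)) (eq 4 (ℕ.m≤m+n 4 2)) (eq 5 (ℕ.m≤m+n 5 1)) (eq 6 ℕ.≤-refl)

  alternating₄-cong : ∀ {f g} → (∀ s → s ℕ.≤ 6 → f s ≡ g s) → alternating₄ f ≡ alternating₄ g
  alternating₄-cong eq = cong₆ (λ a b c d e f → (- + 1463) * a + (+ 1582) * b + (- + 1020) * c
      + (+ 440) * d + (- + 120) * e + (+ 16) * f)
    (eq 1 (ℕ.m≤m+n 1 5)) (eq 2 (ℕ.m≤m+n 2 4)) (eq 3 (ℕ.m≤m+n 3 3)) (eq 4 (ℕ.m≤m+n 4 2)) (eq 5 (ℕ.m≤m+n 5 1)) (eq 6 ℕ.≤-refl)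

  -- At j = 2i the product j (j - 2) ⋯ (j - 10) / 45 is 64 · 720 / 45 = 1024 times C(i, 6).
  alternating₂-doubling : ∀ {f g} → Doubling f g → alternating₂ f ≡ (+ 1024) * g 6
  alternating₂-doubling {f} {g} (doubling f₁ f₂ f₃ f₄ f₅ f₆) = trans
    (cong₆ (λ a b c d e f → (- + 21) * a + (+ 42) * b + (- + 56) * c
      + (+ 56) * d + (- + 40) * e + (+ 16) * f) f₁ f₂ f₃ f₄ f₅ f₆)
    (lemma (g 1) (g 2) (g 3) (g 4) (g 5) (g 6))
    where
    lemma : ∀ a b c d e f → (- + 21) * ((+ 2) * a) + (+ 42) * (a + (+ 4) * b)
      + (- + 56) * ((+ 4) * b + (+ 8) * c)
      + (+ 56) * (b + (+ 12) * c + (+ 16) * d)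
      + (- + 40) * ((+ 6) * c + (+ 32) * d + (+ 32) * e)
      + (+ 16) * (c + (+ 24) * d + (+ 80) * e + (+ 64) * f) ≡ (+ 1024) * f
    lemma = solve-∀

  -- Halving j turns steps of 4 into steps of 2 at the cost of a factor 2⁶, so the second halving is
  -- `alternating₂-doubling`.
  alternating₄-doubling : ∀ {f g h} → Doubling f g → Doubling g h → alternating₄ f ≡ (+ 64) * ((+ 1024) * h 6)
  alternating₄-doubling {f} {g} {h} (doubling f₁ f₂ f₃ f₄ f₅ f₆) G = trans
    (cong₆ (λ a b c d e f → (- + 1463) * a + (+ 1582) * b + (- + 1020) * c
      + (+ 440) * d + (- + 120) * e + (+ 16) * f) f₁ f₂ f₃ f₄ f₅ f₆)
    (trans (lemma (g 1) (g 2) (g 3) (g 4) (g 5) (g 6)) (cong ((+ 64) *_) (alternating₂-doubling G)))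
    where
    lemma : ∀ a b c d e f → (- + 1463) * ((+ 2) * a) + (+ 1582) * (a + (+ 4) * b)
      + (- + 1020) * ((+ 4) * b + (+ 8) * c)
      + (+ 440) * (b + (+ 12) * c + (+ 16) * d)
      + (- + 120) * ((+ 6) * c + (+ 32) * d + (+ 32) * e)
      + (+ 16) * (c + (+ 24) * d + (+ 80) * e + (+ 64) * f) ≡
      (+ 64) * ((- + 21) * a + (+ 42) * b + (- + 56) * c
        + (+ 56) * d + (- + 40) * e + (+ 16) * f)
    lemma = solve-∀

  module _ {n : ℕ} (𝒞 : Code n) where

    private
      combine : ∀ w b a₁ a₂ a₃ a₄ a₅ a₆ →
        a₁ * β 𝒞 w 1 b + a₂ * β 𝒞 w 2 b + a₃ * β 𝒞 w 3 b + a₄ * β 𝒞 w 4 b + a₅ * β 𝒞 w 5 b + a₆ * β 𝒞 w 6 b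
        ≡ total 𝒞 w (λ c → a₁ * choose (∣ b ∩ c ∣) 1 + a₂ * choose (∣ b ∩ c ∣) 2 + a₃ * choose (∣ b ∩ c ∣) 3
            + a₄ * choose (∣ b ∩ c ∣) 4 + a₅ * choose (∣ b ∩ c ∣) 5 + a₆ * choose (∣ b ∩ c ∣) 6)
      combine w b a₁ a₂ a₃ a₄ a₅ a₆ = add (add (add (add (add (mult a₁ 1) (mult a₂ 2)) (mult a₃ 3)) (mult a₄ 4)) (mult a₅ 5)) (mult a₆ 6)
        where
        mult : ∀ a s → a * β 𝒞 w s b ≡ total 𝒞 w (λ c → a * choose (∣ b ∩ c ∣) s)
        mult a s = sym (total-* 𝒞 w a (λ c → choose (∣ b ∩ c ∣) s))
        add : ∀ {x y} {f g : Word n → ℤ} → x ≡ total 𝒞 w f → y ≡ total 𝒞 w g → x + y ≡ total 𝒞 w (λ c → f c + g c)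
        add {f = f} {g} p q = trans (cong₂ _+_ p q) (sym (total-+ 𝒞 w f g))

    -- `K` sums C(|b ∩ c| / 2, 6) over the blocks. Once the moments on the left are known from
    -- design parameters, divisibility by 1024 becomes a condition on m.
    even-meets : ∀ w b → (∀ c → c ∈C 𝒞 → wt c ≡ w → odd ∣ b ∩ c ∣ ≡ false) →
      ∃[ K ] alternating₂ (λ s → β 𝒞 w s b) ≡ (+ 1024) * K
    even-meets w b even = total 𝒞 w (λ c → choose (half ∣ b ∩ c ∣) 6) , trans
      (combine w b (- + 21) (+ 42) (- + 56) (+ 56) (- + 40) (+ 16)) (trans
      (total-cong 𝒞 w (λ c c∈ wt≡ → alternating₂-doubling (≡.subst (λ j → Doubling (choose j) (choose (half ∣ b ∩ c ∣)))
        (double-half ∣ b ∩ c ∣ (even c c∈ wt≡)) (double-binomials (half ∣ b ∩ c ∣)))))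
      (total-* 𝒞 w (+ 1024) (λ c → choose (half ∣ b ∩ c ∣) 6)))

    quarter-meets : ∀ w b → (∀ c → c ∈C 𝒞 → wt c ≡ w → odd ∣ b ∩ c ∣ ≡ false) →
      (∀ c → c ∈C 𝒞 → wt c ≡ w → odd (half ∣ b ∩ c ∣) ≡ false) →
      ∃[ K ] alternating₄ (λ s → β 𝒞 w s b) ≡ (+ 64) * ((+ 1024) * K)
    quarter-meets w b even even′ = total 𝒞 w (λ c → choose (half (half ∣ b ∩ c ∣)) 6) , trans
      (combine w b (- + 1463) (+ 1582) (- + 1020) (+ 440) (- + 120) (+ 16)) (trans
      (total-cong 𝒞 w (λ c c∈ wt≡ → alternating₄-doubling
        (≡.subst (λ j → Doubling (choose j) (choose (half ∣ b ∩ c ∣))) (double-half ∣ b ∩ c ∣ (even c c∈ wt≡)) (double-binomials (half ∣ b ∩ c ∣)))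
        (≡.subst (λ j → Doubling (choose j) (choose (half (half ∣ b ∩ c ∣)))) (double-half (half ∣ b ∩ c ∣) (even′ c c∈ wt≡))
          (double-binomials (half (half ∣ b ∩ c ∣))))))
      (trans (total-* 𝒞 w (+ 64) (λ c → (+ 1024) * choose (half (half ∣ b ∩ c ∣)) 6))
        (cong ((+ 64) *_) (total-* 𝒞 w (+ 1024) (λ c → choose (half (half ∣ b ∩ c ∣)) 6)))))

    wt-⊕ : ∀ {n} (b c : Word n) → wt (b ⊕ c) ℕ.+ double ∣ b ∩ c ∣ ≡ wt b ℕ.+ wt c
    wt-⊕ []          []          = refl
    wt-⊕ (true ∷ b)  (true ∷ c)  = trans (ℕ.+-suc _ _) (trans (cong suc (ℕ.+-suc _ _))
      (cong suc (trans (cong suc (wt-⊕ b c)) (sym (ℕ.+-suc (wt b) (wt c))))))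
    wt-⊕ (true ∷ b)  (false ∷ c) = cong suc (wt-⊕ b c)
    wt-⊕ (false ∷ b) (true ∷ c)  = trans (cong suc (wt-⊕ b c)) (sym (ℕ.+-suc (wt b) (wt c)))
    wt-⊕ (false ∷ b) (false ∷ c) = wt-⊕ b c

-- Numerical conditions on m and their evaluation.

module Sieve where

  open import Data.Bool using (Bool; true; false; not; _∧_; _∨_; T)
  open import Data.Empty using (⊥)
  open import Data.Integer as ℤ using (ℤ; +_; 0ℤ; ∣_∣)
  open import Data.Nat as ℕ using (ℕ; zero; suc; _+_; _*_; _∸_; _≡ᵇ_; s≤s)
  open import Data.Nat.DivMod using (_/_; _%_; m*n/n≡m; m*n%n≡0)
  open import Data.Nat.Combinatorics using (_C_; nCk+nC[k+1]≡[n+1]C[k+1])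
  import Data.Nat.Properties as ℕ
  open import Data.Sum as Sum using (_⊎_; inj₁; inj₂; [_,_]′)
  open import Relation.Binary.PropositionalEquality as ≡ using (_≡_; _≢_; refl; cong; sym; trans)
  open import Relation.Nullary using (contradiction)
  open Residue using (residue)
  open import Data.Nat.Tactic.RingSolver using (solve-∀)
  open Parity using (alternating₂; alternating₄; double; double-+)
  open Steps using (signedC)

  -- Total in the divisor. The remainder `a` at divisor 0 keeps `remainder-multiple` true, since the
  -- only multiple of 0 is 0.
  quotient remainder : ℕ → ℕ → ℕ
  quotient a zero    = 0
  quotient a (suc b) = a / suc b
  remainder a zero    = a
  remainder a (suc b) = a % suc b

  quotient-unique : ∀ x a b → b ≢ 0 → x * b ≡ a → x ≡ quotient a b
  quotient-unique x a zero    b≢0 eq = contradiction refl b≢0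
  quotient-unique x a (suc b) b≢0 eq = trans (sym (m*n/n≡m x (suc b))) (cong (_/ suc b) eq)

  remainder-multiple : ∀ x a b → x * b ≡ a → (remainder a b ≡ᵇ 0) ≡ true
  remainder-multiple x a zero    eq = cong (_≡ᵇ 0) (trans (sym eq) (ℕ.*-zeroʳ x))
  remainder-multiple x a (suc b) eq = cong (_≡ᵇ 0) (trans (cong (_% suc b) (sym eq)) (m*n%n≡0 x (suc b)))

  C≢0 : ∀ n k → k ℕ.≤ n → n C k ≢ 0
  C≢0 n       zero    _         = λ ()
  C≢0 (suc n) (suc k) (s≤s k≤n) = λ eq → C≢0 n k k≤n
    (ℕ.m+n≡0⇒m≡0 (n C k) (trans (nCk+nC[k+1]≡[n+1]C[k+1] n k) eq))

  -- Boolean-valued, so that a check over a range is a closed term that `refl` evaluates.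
  allBelow : (ℕ → Bool) → ℕ → Bool
  allBelow p zero    = true
  allBelow p (suc n) = p n ∧ allBelow p n

  allBelow-sound : ∀ p n → allBelow p n ≡ true → ∀ i → i ℕ.< n → p i ≡ true
  allBelow-sound p (suc n) eq i i<1+n with p n in pn
  ... | true = [ allBelow-sound p n eq i , (λ i≡n → trans (cong p i≡n) pn) ]′ (ℕ.m<1+n⇒m<n∨m≡n i<1+n)

  -- `count m` is the number of words of weight `dist m`, solved from `minimum-count`.
  len dist count : ℕ → ℕ
  len m = 24 * m + 8
  dist m = 4 * m + 4
  count m = quotient (4 * residue (3 + m * 4) m * (len m * (len m ∸ 1))) (dist m * (len m ∸ dist m))

  -- Integrality of λ_s = C(d, s) A / C(n, s).
  passes : ℕ → ℕ → Bool
  passes m s = remainder ((dist m C s) * count m) (len m C s) ≡ᵇ 0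

  ∨-split : ∀ a {b} → (a ∨ b) ≡ true → a ≡ true ⊎ b ≡ true
  ∨-split true  _  = inj₁ refl
  ∨-split false eq = inj₂ eq

  not-true : ∀ {b} → not b ≡ true → b ≡ false
  not-true {false} _ = refl

  true≢false : ∀ {b} → b ≡ true → b ≡ false → ⊥
  true≢false refl ()

  ≡ᵇ-sound : ∀ a b → (a ≡ᵇ b) ≡ true → a ≡ b
  ≡ᵇ-sound a b eq = ℕ.≡ᵇ⇒≡ a b (≡.subst T (sym eq) _)

  implies : Bool → Bool → Bool
  implies a b = not a ∨ b

  implies-elim : ∀ a b → implies a b ≡ true → a ≡ true → b ≡ true
  implies-elim true b eq _ = eq

  candidate : ℕ → Bool
  candidate m = (m ≡ᵇ 20) ∨ (m ≡ᵇ 58) ∨ (m ≡ᵇ 90) ∨ (m ≡ᵇ 113)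

  candidate-sound : ∀ m → candidate m ≡ true → m ≡ 20 ⊎ m ≡ 58 ⊎ m ≡ 90 ⊎ m ≡ 113
  candidate-sound m eq = Sum.map (≡ᵇ-sound m 20)
    (λ eq₁ → Sum.map (≡ᵇ-sound m 58)
      (λ eq₂ → Sum.map (≡ᵇ-sound m 90) (≡ᵇ-sound m 113) (∨-split (m ≡ᵇ 90) eq₂))
      (∨-split (m ≡ᵇ 58) eq₁))
    (∨-split (m ≡ᵇ 20) eq)

  sieve : ℕ → Bool
  sieve m = implies (passes m 5 ∧ passes m 6) (candidate m)

  sieve-all : allBelow (λ m → sieve (suc m)) 158 ≡ true
  sieve-all = refl

  -- With L = 4m and y = L - 2u the equation becomes Pell's (6L + 1)² - 48 y² = 1. Its solutions
  -- have L = 1, 16, 225, 3136, ..., and within the range 4 ≤ L ≤ 632 only 16 is a multiple of 4.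
  pell : ℕ → ℕ → Bool
  pell m u = implies ((m * 4 * (m * 4 ∸ 1)) ≡ᵇ (16 * (u * (m * 4 ∸ u)))) (m ≡ᵇ 4)

  pell-all : allBelow (λ m → allBelow (pell (suc m)) (suc (suc m * 4))) 158 ≡ true
  pell-all = refl

  lam : ℕ → ℕ → ℕ
  lam m s = quotient ((dist m C s) * count m) (len m C s)

  -- `w` is the weight of the codeword that meets the blocks; the blocks themselves have weight
  -- `dist m`.
  divides₂ : ℕ → ℕ → Bool
  divides₂ m w = remainder ∣ alternating₂ (λ s → + (lam m s * (w C s))) ∣ 1024 ≡ᵇ 0

  divides₄ : ℕ → Bool
  divides₄ m = remainder ∣ alternating₄ (λ s → + (lam m s * (dist m C s))) ∣ (64 * 1024) ≡ᵇ 0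

  divides₂-20 : divides₂ 20 (dist 20) ≡ false
  divides₂-20 = refl

  divides₂-90 : divides₂ 90 (dist 90) ≡ false
  divides₂-90 = refl

  divides₄-113 : divides₄ 113 ≡ false
  divides₄-113 = refl

  -- Two words of weight 456 that meet in 2 + 4y points have a sum of weight 912 - 2 (2 + 4y) = 908
  -- - 8y, and 2 + 4y ≤ 456 gives y < 114.
  divides₂-113 : allBelow (λ y → not (divides₂ 113 (908 ∸ 8 * y))) 114 ≡ true
  divides₂-113 = refl

  -- With Y = X + V the forms X² + 14 X Y + Y², (X + Y) (X² - 34 X Y + Y²) and (X² + 14 X Y + Y²)²
  -- have the coefficients (16, 16, 1), (-64, -96, -30, 1) and (256, 512, 288, 32, 1) in X and V.
  coefficient₆ coefficient₇ coefficient₈ correction₈ : ℕ → ℕ → ℤ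
  coefficient₆ L j = signedC L j (L ∸ 2 + 0) ℤ.* + 16 ℤ.+ (signedC L j (L ∸ 2 + 1) ℤ.* + 16 ℤ.+ signedC L j (L ∸ 2 + 2))
  coefficient₇ L j = signedC L j (L ∸ 3 + 0) ℤ.* ℤ.- + 64 ℤ.+ (signedC L j (L ∸ 3 + 1) ℤ.* ℤ.- + 96
    ℤ.+ (signedC L j (L ∸ 3 + 2) ℤ.* ℤ.- + 30 ℤ.+ signedC L j (L ∸ 3 + 3)))
  coefficient₈ L j = signedC L j (L ∸ 4 + 0) ℤ.* + 256 ℤ.+ (signedC L j (L ∸ 4 + 1) ℤ.* + 512
    ℤ.+ (signedC L j (L ∸ 4 + 2) ℤ.* + 288 ℤ.+ (signedC L j (L ∸ 4 + 3) ℤ.* + 32 ℤ.+ signedC L j (L ∸ 4 + 4))))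
  correction₈ L j = signedC L j (L ∸ 4 + 1) ℤ.* ℤ.- + 32 ℤ.+ (signedC L j (L ∸ 4 + 2) ℤ.* ℤ.- + 44
    ℤ.+ signedC L j (L ∸ 4 + 3) ℤ.* ℤ.- + 11)

  vanishes : ℤ → Bool
  vanishes x = ∣ x ∣ ≡ᵇ 0

  coefficient₇-nonzero : allBelow (λ j → (j ≡ᵇ 116) ∨ not (vanishes (coefficient₇ 232 j))) 233 ≡ true
  coefficient₇-nonzero = refl

  -- The exponent 232 - 3 of V is odd and the remaining cubic factor is symmetric, so exchanging X
  -- and Y changes the sign of the form: its middle coefficient equals its own negative.
  coefficient₇-middle : coefficient₇ 232 116 ≡ 0ℤ
  coefficient₇-middle = refl

  coefficient₈-nonzero : allBelow (λ j → not (vanishes (coefficient₈ 232 j))) 233 ≡ true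
  coefficient₈-nonzero = refl

  -- The origin of 1386 and 229: this ratio turns `coefficient₈` δ + `correction₈` ξ = 0 at the
  -- middle weight into 1386 δ = 229 ξ.
  coefficient₈-middle : + 1386 ℤ.* correction₈ 232 116 ≡ ℤ.- (+ 229 ℤ.* coefficient₈ 232 116)
  coefficient₈-middle = refl

  -- Summing 1386 B_d(T) - 229 Σ B_d(S) over all 8-sets T counts each 7-set S exactly `len m` - 7
  -- times. If the summand is constant, the sum is a multiple of C(n, 8).
  eight : ℕ → Bool
  eight m = remainder ∣ (+ 1386 ℤ.* + (dist m C 8) ℤ.- + 229 ℤ.* ((+ len m ℤ.- + 7) ℤ.* + (dist m C 7))) ℤ.* + count m ∣ (len m C 8) ≡ᵇ 0

  eight-58 : eight 58 ≡ false
  eight-58 = refl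

  sieve-sound : ∀ m → 1 ℕ.≤ m → m ℕ.≤ 158 → passes m 5 ≡ true → passes m 6 ≡ true → m ≡ 20 ⊎ m ≡ 58 ⊎ m ≡ 90 ⊎ m ≡ 113
  sieve-sound (suc m) _ m<158 p₅ p₆ = candidate-sound (suc m)
    (implies-elim (passes (suc m) 5 ∧ passes (suc m) 6) (candidate (suc m))
      (allBelow-sound (λ m → sieve (suc m)) 158 sieve-all m m<158) (≡.cong₂ _∧_ p₅ p₆))

  pell-sound : ∀ m u → 1 ℕ.≤ m → m ℕ.≤ 158 → u ℕ.≤ m * 4 → m * 4 * (m * 4 ∸ 1) ≡ 16 * (u * (m * 4 ∸ u)) → m ≡ 4
  pell-sound (suc m) u _ m<158 u≤ eq = ≡ᵇ-sound (suc m) 4 (implies-elim _ (suc m ≡ᵇ 4)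
    (allBelow-sound (pell (suc m)) (suc (suc m * 4))
      (allBelow-sound (λ m → allBelow (pell (suc m)) (suc (suc m * 4))) 158 pell-all m m<158) u (s≤s u≤))
    (≡ᵇ-complete eq))
    where
    ≡ᵇ-refl : ∀ a → (a ≡ᵇ a) ≡ true
    ≡ᵇ-refl zero    = refl
    ≡ᵇ-refl (suc a) = ≡ᵇ-refl a
    ≡ᵇ-complete : ∀ {a b} → a ≡ b → (a ≡ᵇ b) ≡ true
    ≡ᵇ-complete {a} refl = ≡ᵇ-refl a

  divides₂-113-false : ∀ h → h ℕ.< 114 → divides₂ 113 (908 ∸ 8 * h) ≡ false
  divides₂-113-false h h<114 = not-true (allBelow-sound (λ y → not (divides₂ 113 (908 ∸ 8 * y))) 114 divides₂-113 h h<114)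

  h-bound : ∀ h → 2 + 4 * h ℕ.≤ dist 113 → h ℕ.< 114
  h-bound h le = ℕ.*-cancelˡ-< 4 h 114 (ℕ.≤-trans (ℕ.n≤1+n (suc (4 * h))) le)

  weight-of-sum : ∀ w h → w + double (2 + 4 * h) ≡ dist 113 + dist 113 → w ≡ 908 ∸ 8 * h
  weight-of-sum w h eq = sym (trans (cong (_∸ 8 * h) (sym total)) (ℕ.m+n∸n≡m w (8 * h)))
    where
    total : w + 8 * h ≡ 908
    total = ℕ.+-cancelˡ-≡ 4 (w + 8 * h) 908 (trans (lemma w h) (trans (cong (_+_ w) (sym (double-+ (2 + 4 * h)))) eq))
      where
      lemma : ∀ w h → 4 + (w + 8 * h) ≡ w + (2 + 4 * h + (2 + 4 * h))
      lemma = solve-∀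

  vanishes-complete : ∀ {x} → x ≡ 0ℤ → vanishes x ≡ true
  vanishes-complete refl = refl

  coefficient₇≢0 : ∀ L j → L ≡ 232 → j ℕ.≤ L → j ≢ 116 → coefficient₇ L j ≢ 0ℤ
  coefficient₇≢0 L j refl j≤L j≢116 eq = [ (λ j≡ → j≢116 (≡ᵇ-sound j 116 j≡)) ,
    (λ nope → true≢false (vanishes-complete eq) (not-true nope)) ]′
    (∨-split (j ≡ᵇ 116) (allBelow-sound (λ j → (j ≡ᵇ 116) ∨ not (vanishes (coefficient₇ 232 j))) 233 coefficient₇-nonzero j (s≤s j≤L)))

  coefficient₈≢0 : ∀ L j → L ≡ 232 → j ℕ.≤ L → coefficient₈ L j ≢ 0ℤ
  coefficient₈≢0 L j refl j≤L eq = true≢false (vanishes-complete eq)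
    (not-true (allBelow-sound (λ j → not (vanishes (coefficient₈ 232 j))) 233 coefficient₈-nonzero j (s≤s j≤L)))

-- Zeros of the coefficient for six points.

module Absorption where

  open import Data.Integer as ℤ using (ℤ; +_; 0ℤ; 1ℤ; -1ℤ; _+_; _*_; _-_; _^_)
  import Data.Integer.Properties as ℤ
  open import Data.Integer.Tactic.RingSolver using (solve-∀)
  open import Data.Nat as ℕ using (zero; suc; _∸_)
  open import Data.Nat.Combinatorics using (nCn≡1; k>n⇒nCk≡0; nC1≡n)
  import Data.Nat.Properties as ℕ
  open import Data.Sum using ([_,_]′)
  open import Relation.Binary.PropositionalEquality as ≡ using (_≡_; _≢_; refl; cong; cong₂; sym; trans)
  open import Relation.Nullary using (contradiction)
  open Count using (pascal)
  open Parity using (choose)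
  open Steps using (signedC)
  open Sieve using (coefficient₆; C≢0)

  absorbˡ : ∀ n k → + suc k * choose (suc n) (suc k) ≡ + suc n * choose n k
  absorbˡ zero zero    = refl
  absorbˡ zero (suc k) = trans (ℤ.*-zeroʳ (+ suc (suc k))) (sym (ℤ.*-zeroʳ 1ℤ))
  absorbˡ (suc n) zero = trans (cong (λ x → 1ℤ * + x) (nC1≡n (suc (suc n))))
    (ℤ.*-comm 1ℤ (+ suc (suc n)))
  absorbˡ (suc n) (suc k) = begin
    + suc (suc k) * choose (suc (suc n)) (suc (suc k))
      ≡⟨ cong (+ suc (suc k) *_) (pascal (suc n) (suc k)) ⟨
    + suc (suc k) * (choose (suc n) (suc k) + choose (suc n) (suc (suc k)))
      ≡⟨ split (+ suc k) (choose (suc n) (suc k)) (choose (suc n) (suc (suc k))) ⟩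
    + suc k * choose (suc n) (suc k) + + suc (suc k) * choose (suc n) (suc (suc k)) + choose (suc n) (suc k)
      ≡⟨ cong₂ (λ x y → x + y + choose (suc n) (suc k)) (absorbˡ n k) (absorbˡ n (suc k)) ⟩
    + suc n * choose n k + + suc n * choose n (suc k) + choose (suc n) (suc k)
      ≡⟨ cong (_+ choose (suc n) (suc k)) (trans (sym (ℤ.*-distribˡ-+ (+ suc n) (choose n k) (choose n (suc k)))) (cong (+ suc n *_) (pascal n k))) ⟩
    + suc n * choose (suc n) (suc k) + choose (suc n) (suc k)
      ≡⟨ join (+ suc n) (choose (suc n) (suc k)) ⟩
    + suc (suc n) * choose (suc n) (suc k) ∎
    where
    open ≡.≡-Reasoning
    split : ∀ k a b → (1ℤ + k) * (a + b) ≡ k * a + (1ℤ + k) * b + a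
    split = solve-∀
    join : ∀ n a → n * a + a ≡ (1ℤ + n) * a
    join = solve-∀

  absorbʳ : ∀ n k → (+ suc n - + k) * choose (suc n) k ≡ + suc n * choose n k
  absorbʳ n zero    = cong (_* 1ℤ) (ℤ.+-identityʳ (+ suc n))
  absorbʳ n (suc k) = begin
    (+ suc n - + suc k) * choose (suc n) (suc k)
      ≡⟨ expand (+ suc n) (+ suc k) (choose (suc n) (suc k)) ⟩
    + suc n * choose (suc n) (suc k) - + suc k * choose (suc n) (suc k)
      ≡⟨ cong₂ (λ x y → + suc n * x - y) (sym (pascal n k)) (absorbˡ n k) ⟩
    + suc n * (choose n k + choose n (suc k)) - + suc n * choose n k
      ≡⟨ cancel (+ suc n) (choose n k) (choose n (suc k)) ⟩
    + suc n * choose n (suc k) ∎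
    where
    open ≡.≡-Reasoning
    expand : ∀ n k a → (n - k) * a ≡ n * a - k * a
    expand = solve-∀
    cancel : ∀ n a b → n * (a + b) - n * a ≡ n * b
    cancel = solve-∀

  absorb₂ : ∀ l v → (+ suc v * (+ suc l - + v)) * choose (suc (suc l)) (suc v) ≡ (+ suc (suc l) * + suc l) * choose l v
  absorb₂ l v = begin
    (+ suc v * (+ suc l - + v)) * choose (suc (suc l)) (suc v)
      ≡⟨ move (+ suc v) (+ suc l - + v) (choose (suc (suc l)) (suc v)) ⟩
    (+ suc l - + v) * (+ suc v * choose (suc (suc l)) (suc v))
      ≡⟨ cong ((+ suc l - + v) *_) (absorbˡ (suc l) v) ⟩
    (+ suc l - + v) * (+ suc (suc l) * choose (suc l) v)
      ≡⟨ move′ (+ suc l - + v) (+ suc (suc l)) (choose (suc l) v) ⟩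
    + suc (suc l) * ((+ suc l - + v) * choose (suc l) v)
      ≡⟨ trans (cong (+ suc (suc l) *_) (absorbʳ l v)) (sym (ℤ.*-assoc (+ suc (suc l)) (+ suc l) (choose l v))) ⟩
    (+ suc (suc l) * + suc l) * choose l v ∎
    where
    open ≡.≡-Reasoning
    move : ∀ a b c → (a * b) * c ≡ b * (a * c)
    move = solve-∀
    move′ : ∀ a b c → a * (b * c) ≡ b * (a * c)
    move′ = solve-∀

  -1^≢0 : ∀ k → -1ℤ ^ k ≢ 0ℤ
  -1^≢0 k eq with ℤ.i^n≡0⇒i≡0 -1ℤ k eq
  ... | ()

  signedC-top : ∀ L j → j ℕ.≤ L → signedC L j L ≢ 0ℤ
  signedC-top L j j≤L eq = [ -1^≢0 (L ℕ.+ (L ∸ j)) , (λ c≡0 → C≢0 L (L ∸ j) (ℕ.m∸n≤m L j) (ℤ.+-injective c≡0)) ]′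
    (ℤ.i*j≡0⇒i≡0∨j≡0 (-1ℤ ^ (L ℕ.+ (L ∸ j))) eq)

  private
    -- The signs for three consecutive exponents of V alternate; without their common sign the
    -- factors 16, 16, 1 become 16, -16, 1.
    bracket : ∀ l j u → suc (suc l) ∸ j ≡ u → coefficient₆ (suc (suc l)) j ≡ 0ℤ →
      (+ 16) * choose l u - (+ 16) * choose (suc l) u + choose (suc (suc l)) u ≡ 0ℤ
    bracket l j u u≡ eq = [ (λ z → contradiction z (-1^≢0 (l ℕ.+ u))) , (λ z → z) ]′
      (ℤ.i*j≡0⇒i≡0∨j≡0 (-1ℤ ^ (l ℕ.+ u)) (trans (sym signs) eq))
      where
      at-shift : ∀ s → signedC (suc (suc l)) j (l ℕ.+ s) ≡ -1ℤ ^ (s ℕ.+ (l ℕ.+ u)) * choose (s ℕ.+ l) u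
      at-shift s = trans (cong (λ x → -1ℤ ^ (l ℕ.+ s ℕ.+ x) * choose (l ℕ.+ s) x) u≡)
        (cong (λ x → -1ℤ ^ x * choose (l ℕ.+ s) u) (trans (cong (ℕ._+ u) (ℕ.+-comm l s)) (ℕ.+-assoc s l u))
          ⨾ cong (λ x → -1ℤ ^ (s ℕ.+ (l ℕ.+ u)) * choose x u) (ℕ.+-comm l s))
        where
        _⨾_ : ∀ {a b c : ℤ} → a ≡ b → b ≡ c → a ≡ c
        _⨾_ = trans
      signs : coefficient₆ (suc (suc l)) j ≡
        -1ℤ ^ (l ℕ.+ u) * ((+ 16) * choose l u - (+ 16) * choose (suc l) u + choose (suc (suc l)) u)
      signs = trans (cong₂ (λ x y → x * + 16 + y) (at-shift 0) (cong₂ (λ x y → x * + 16 + y) (at-shift 1) (at-shift 2)))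
        (collect (-1ℤ ^ (l ℕ.+ u)) (choose l u) (choose (suc l) u) (choose (suc (suc l)) u))
        where
        collect : ∀ s a b c → s * a * + 16 + ((-1ℤ * s) * b * + 16 + (-1ℤ * (-1ℤ * s)) * c) ≡
          s * ((+ 16) * a - (+ 16) * b + c)
        collect = solve-∀

  -- The bracket is C(L,u) - 16 C(L-2,u-1), and u (L-u) C(L,u) = L (L-1) C(L-2,u-1).
  coefficient₆-zero : ∀ l j → j ℕ.≤ suc (suc l) → coefficient₆ (suc (suc l)) j ≡ 0ℤ →
    suc (suc l) ℕ.* suc l ≡ 16 ℕ.* ((suc (suc l) ∸ j) ℕ.* (suc (suc l) ∸ (suc (suc l) ∸ j)))
  coefficient₆-zero l j j≤L eq = cases (suc (suc l) ∸ j) refl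
    where
    cases : ∀ u → suc (suc l) ∸ j ≡ u → suc (suc l) ℕ.* suc l ≡ 16 ℕ.* (u ℕ.* (suc (suc l) ∸ u))
    -- At u = 0 all three binomials are 1 and the bracket is 16 - 16 + 1 = 1.
    cases zero u≡ with () ← bracket l j 0 u≡ eq
    cases (suc v) u≡ = [ (λ v<1+l → inner (ℕ.s≤s⁻¹ v<1+l)) , (λ v≡ → contradiction (outer v≡) (λ ())) ]′
      (ℕ.m<1+n⇒m<n∨m≡n (≡.subst (ℕ._≤ suc (suc l)) u≡ (ℕ.m∸n≤m (suc (suc l)) j)))
      where
      sixteen : choose (suc (suc l)) (suc v) ≡ (+ 16) * choose l v
      sixteen = ℤ.i-j≡0⇒i≡j _ _ (trans (rewrite-pascal (choose l v) (choose l (suc v)) (choose (suc (suc l)) (suc v)))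
        (trans (cong (λ x → (+ 16) * choose l (suc v) - (+ 16) * x + choose (suc (suc l)) (suc v)) (pascal l v))
          (bracket l j (suc v) u≡ eq)))
        where
        rewrite-pascal : ∀ a b c → c - (+ 16) * a ≡ (+ 16) * b - (+ 16) * (a + b) + c
        rewrite-pascal = solve-∀
      -- This is u = L, where C(L, u) is 1 but C(L - 2, u - 1) is 0.
      outer : v ≡ suc l → 1ℤ ≡ 0ℤ
      outer refl = trans (sym (cong +_ (nCn≡1 (suc (suc l))))) (trans sixteen
        (cong (λ x → (+ 16) * + x) (k>n⇒nCk≡0 (ℕ.n<1+n l))))
      inner : v ℕ.≤ l → suc (suc l) ℕ.* suc l ≡ 16 ℕ.* (suc v ℕ.* (suc (suc l) ∸ suc v))
      inner v≤l = ℤ.+-injective (begin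
        + (suc (suc l) ℕ.* suc l)
          ≡⟨ ℤ.pos-* (suc (suc l)) (suc l) ⟩
        + suc (suc l) * + suc l
          ≡⟨ ℤ.*-cancelʳ-≡ _ _ (choose l v) {{ℤ.≢-nonZero (λ z → C≢0 l v v≤l (ℤ.+-injective z))}} multiplied ⟩
        (+ 16) * (+ suc v * (+ suc l - + v))
          ≡⟨ cong (λ x → (+ 16) * (+ suc v * x)) (trans (ℤ.m-n≡m⊖n (suc l) v) (ℤ.⊖-≥ (ℕ.m≤n⇒m≤1+n v≤l))) ⟩
        (+ 16) * (+ suc v * + (suc l ∸ v))
          ≡⟨ trans (ℤ.pos-* 16 (suc v ℕ.* (suc l ∸ v))) (cong ((+ 16) *_) (ℤ.pos-* (suc v) (suc l ∸ v))) ⟨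
        + (16 ℕ.* (suc v ℕ.* (suc l ∸ v))) ∎)
        where
        open ≡.≡-Reasoning
        multiplied : + suc (suc l) * + suc l * choose l v ≡ (+ 16) * (+ suc v * (+ suc l - + v)) * choose l v
        multiplied = trans (sym (absorb₂ l v)) (trans (cong (+ suc v * (+ suc l - + v) *_) sixteen)
          (move (+ suc v * (+ suc l - + v)) (choose l v)))
          where
          move : ∀ a b → a * ((+ 16) * b) ≡ (+ 16) * a * b
          move = solve-∀

-- Descent to the minimum weight and the resulting contradictions.

module Main where

  open import Data.Bool using (true; false)
  open import Data.Fin.Subset using (_∩_; ⊤)
  open import Data.Fin.Subset.Properties using (∣⊤∣≡n; ∣p∩q∣≤∣p∣)
  open import Data.Integer as ℤ using (ℤ; +_; 0ℤ; 1ℤ; ∣_∣; _+_; _*_; _-_; -_)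
  import Data.Integer.Properties as ℤ
  open import Data.Integer.Tactic.RingSolver using (solve-∀)
  open import Data.List using (List)
  open import Data.Nat as ℕ using (ℕ; suc; z≤n; s≤s; _∸_; _≤_; _<_)
  open import Data.Nat.Combinatorics using (_C_)
  open import Data.Nat.DivMod using (_/_; m*n/n≡m; +-distrib-/-∣ˡ)
  open import Data.Nat.Divisibility using (_∣_; divides; m∣m*n; ∣m+n∣m⇒∣n)
  import Data.Nat.Properties as ℕ
  open import Data.Nat.Tactic.RingSolver using () renaming (solve-∀ to solveℕ-∀)
  open import Data.Product using (_×_; _,_; proj₁; proj₂; ∃-syntax)
  open import Data.Sum using (_⊎_; [_,_]′)
  open import Data.Empty using (⊥; ⊥-elim)
  open import Relation.Binary.PropositionalEquality as ≡ using (_≡_; _≢_; refl; cong; cong₂; sym; trans)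
  open import Relation.Nullary using (¬_; Dec; contradiction; yes; no)
  open Sums
  open Count
  open Design
  open CodeForms
  open Levels
  open Steps
  open MinCount
  open Parity
  open Sieve
  open Absorption
  open Residue using (residue)

  abs-multiple : ∀ x a b → x * + b ≡ a → ∣ x ∣ ℕ.* b ≡ ∣ a ∣
  abs-multiple x a b refl = sym (ℤ.abs-* x (+ b))

  length/24 : ∀ m → (24 ℕ.* m ℕ.+ 8) / 24 ≡ m
  length/24 m = trans (+-distrib-/-∣ˡ {24 ℕ.* m} 8 (m∣m*n m)) (trans
    (cong₂ ℕ._+_ (trans (cong (_/ 24) (ℕ.*-comm 24 m)) (m*n/n≡m m 24)) refl) (ℕ.+-identityʳ m))

  abs-multiple₂ : ∀ x y a b → y ≡ + a * (+ b * x) → ∣ x ∣ ℕ.* (a ℕ.* b) ≡ ∣ y ∣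
  abs-multiple₂ x y a b eq = abs-multiple x y (a ℕ.* b) (trans
    (trans (cong (x *_) (ℤ.pos-* a b)) (lemma x (+ a) (+ b))) (sym eq))
    where
    lemma : ∀ x a b → x * (a * b) ≡ a * (b * x)
    lemma = solve-∀

  eliminate : ∀ c e δ ξ a b → c ≢ 0ℤ → c * δ + e * ξ ≡ 0ℤ → a * e ≡ - (b * c) → a * δ ≡ b * ξ
  eliminate c e δ ξ a b c≢0 eq ae = ℤ.*-cancelˡ-≡ c (a * δ) (b * ξ) {{ℤ.≢-nonZero c≢0}} (begin
    c * (a * δ)                                   ≡⟨ expand a c e δ ξ ⟩
    a * (c * δ + e * ξ) - a * e * ξ     ≡⟨ cong₂ (λ x y → a * x - y * ξ) eq ae ⟩
    a * 0ℤ - - (b * c) * ξ                  ≡⟨ reduce a b c ξ ⟩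
    c * (b * ξ) ∎)
    where
    open ≡.≡-Reasoning
    expand : ∀ a c e δ ξ → c * (a * δ) ≡ a * (c * δ + e * ξ) - a * e * ξ
    expand = solve-∀
    reduce : ∀ a b c ξ → a * 0ℤ - - (b * c) * ξ ≡ c * (b * ξ)
    reduce = solve-∀

  both-zero : ∀ a b {x y} → x ≡ 0ℤ → y ≡ 0ℤ → a * x ≡ b * y
  both-zero a b refl refl = trans (ℤ.*-zeroʳ a) (sym (ℤ.*-zeroʳ b))

  zero-deviation : ∀ c e δ ξ → c ≢ 0ℤ → ξ ≡ 0ℤ → c * δ + e * ξ ≡ 0ℤ → δ ≡ 0ℤ
  zero-deviation c e δ _ c≢0 refl eq = [ (λ c≡0 → contradiction c≡0 c≢0) , (λ δ≡0 → δ≡0) ]′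
    (ℤ.i*j≡0⇒i≡0∨j≡0 c (trans (sym (trans (cong (_+_ (c * δ)) (ℤ.*-zeroʳ e)) (ℤ.+-identityʳ (c * δ)))) eq))

  middle-relation : ∀ L j → L ≡ 232 → j ≡ 116 → + 1386 * correction₈ L j ≡ - (+ 229 * coefficient₈ L j)
  middle-relation _ _ refl refl = coefficient₈-middle

  module Theorem (m : ℕ) (1≤m : 1 ≤ m) (m≤158 : m ≤ 158) (𝒞 : Code (24 ℕ.* m ℕ.+ 8))
    (desd : IsDESD 𝒞) (min-weight : MinWeight 𝒞 (dist m)) where

    n = len m
    d = dist m
    L = m ℕ.* 4
    k = 12 ℕ.* m ℕ.+ 4

    ext : Extremal 𝒞 d L k
    ext = record
      { linear     = proj₁ desd
      ; selfDual   = proj₁ (proj₂ desd)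
      ; doublyEven = proj₂ (proj₂ desd)
      ; minimum    = proj₂ min-weight
      ; 4∣d        = divides (suc m) (four m)
      ; n≡k+k      = half-length m
      ; n≡d+d+4L   = length-split m
      ; d>0        = ℕ.≤-trans (s≤s z≤n) (ℕ.m≤n+m 4 (4 ℕ.* m))
      }
      where
      four : ∀ m → 4 ℕ.* m ℕ.+ 4 ≡ (1 ℕ.+ m) ℕ.* 4
      four = solveℕ-∀
      half-length : ∀ m → 24 ℕ.* m ℕ.+ 8 ≡ (12 ℕ.* m ℕ.+ 4) ℕ.+ (12 ℕ.* m ℕ.+ 4)
      half-length = solveℕ-∀
      length-split : ∀ m → 24 ℕ.* m ℕ.+ 8 ≡ (4 ℕ.* m ℕ.+ 4) ℕ.+ ((4 ℕ.* m ℕ.+ 4) ℕ.+ m ℕ.* 4 ℕ.* 4)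
      length-split = solveℕ-∀

    open Extremal ext
    open Truncation ext
    open Level ext

    d≡4+L : d ≡ 4 ℕ.+ L
    d≡4+L = lemma m
      where
      lemma : ∀ m → 4 ℕ.* m ℕ.+ 4 ≡ 4 ℕ.+ m ℕ.* 4
      lemma = solveℕ-∀

    k≡4+3L : k ≡ 4 ℕ.+ 3 ℕ.* L
    k≡4+3L = lemma m
      where
      lemma : ∀ m → 12 ℕ.* m ℕ.+ 4 ≡ 4 ℕ.+ 3 ℕ.* (m ℕ.* 4)
      lemma = solveℕ-∀

    4≤L : 4 ≤ L
    4≤L = ℕ.*-monoˡ-≤ 4 1≤m

    8≤d : 8 ≤ d
    8≤d = ≡.subst (8 ≤_) (sym d≡4+L) (ℕ.+-monoʳ-≤ 4 4≤L)

    d≤n : d ≤ n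
    d≤n = ≡.subst (d ≤_) (sym n≡d+d+4L) (ℕ.m≤m+n d _)

    8≤n : 8 ≤ n
    8≤n = ℕ.m≤n+m 8 (24 ℕ.* m)

    open Step ext d≡4+L k≡4+3L 4≤L 8≤n
    open Minimum ext m refl d≡4+L k≡4+3L (ℕ.≤-trans (ℕ.m≤m+n 2 6) 8≤n)
      (balanced-low 0 (s≤s z≤n)) (balanced-low 1 (s≤s (s≤s z≤n)))

    B≥0 : ∀ w T → B 𝒞 w T ≡ + ∣ B 𝒞 w T ∣
    B≥0 w T = trans (sym (count≡B 𝒞 w T)) (cong (λ x → + ∣ x ∣) (count≡B 𝒞 w T))

    -- `A` counts codewords, so it is nonnegative and `minimum-count` can be solved for it by
    -- division in ℕ.
    A≡count : A ≡ + count m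
    A≡count = trans A≥0 (cong +_ (quotient-unique ∣ A ∣ _ (d ℕ.* (n ∸ d)) nonzero (ℤ.+-injective (begin
      + (∣ A ∣ ℕ.* (d ℕ.* (n ∸ d)))
        ≡⟨ trans (ℤ.pos-* ∣ A ∣ (d ℕ.* (n ∸ d))) (cong₂ _*_ (sym A≥0) (ℤ.pos-* d (n ∸ d))) ⟩
      A * (+ d * + (n ∸ d))
        ≡⟨ cong (λ x → A * (+ d * x)) (sym (difference d≤n)) ⟩
      A * (+ d * (+ n - + d))
        ≡⟨ minimum-count ⟩
      (+ 4) * + residue (3 ℕ.+ L) m * (+ n * (+ n - 1ℤ))
        ≡⟨ cong (λ x → (+ 4) * + residue (3 ℕ.+ L) m * (+ n * x)) (difference (ℕ.≤-trans (s≤s z≤n) 8≤n)) ⟩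
      (+ 4) * + residue (3 ℕ.+ L) m * (+ n * + (n ∸ 1))
        ≡⟨ cong₂ _*_ (sym (ℤ.pos-* 4 (residue (3 ℕ.+ L) m))) (sym (ℤ.pos-* n (n ∸ 1))) ⟩
      + (4 ℕ.* residue (3 ℕ.+ L) m) * + (n ℕ.* (n ∸ 1))
        ≡⟨ ℤ.pos-* (4 ℕ.* residue (3 ℕ.+ L) m) (n ℕ.* (n ∸ 1)) ⟨
      + (4 ℕ.* residue (3 ℕ.+ L) m ℕ.* (n ℕ.* (n ∸ 1))) ∎))))
      where
      open ≡.≡-Reasoning
      A≥0 : A ≡ + ∣ A ∣
      A≥0 = trans (sym empty) (trans (B≥0 d (zeroWord n)) (cong (λ x → + ∣ x ∣) empty))
        where
        empty : B 𝒞 d (zeroWord n) ≡ A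
        empty = total-cong 𝒞 d (λ c _ _ → cong Sumℤ.⟦_⟧ (zeroWord-⊑ c))
      difference : ∀ {a b} → b ≤ a → + a - + b ≡ + (a ∸ b)
      difference {a} {b} b≤a = trans (ℤ.m-n≡m⊖n a b) (ℤ.⊖-≥ b≤a)
      d<n : d < n
      d<n = ≡.subst (d <_) (sym n≡d+d+4L) (ℕ.m<m+n d (ℕ.≤-trans d>0 (ℕ.m≤m+n d _)))
      nonzero : d ℕ.* (n ∸ d) ≢ 0
      nonzero eq = [ (λ d≡0 → ℕ.<⇒≢ d>0 (sym d≡0)) , (λ z → ℕ.<⇒≢ (ℕ.m<n⇒0<n∸m d<n) (sym z)) ]′ (ℕ.m*n≡0⇒m≡0∨n≡0 d eq)

    index-count : ∀ {s} → s ≤ n → Balanced 𝒞 d s → ∣ index 𝒞 d s ∣ ℕ.* (n C s) ≡ (d C s) ℕ.* count m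
    index-count {s} s≤n bal = abs-multiple (index 𝒞 d s) (+ ((d C s) ℕ.* count m)) (n C s)
      (trans (index-total 𝒞 bal s≤n) (trans (cong (+ (d C s) *_) A≡count) (sym (ℤ.pos-* (d C s) (count m)))))

    index≡lam : ∀ {s} → s ≤ n → Balanced 𝒞 d s → index 𝒞 d s ≡ + lam m s
    index≡lam {s} s≤n bal = trans (B≥0 d (prefix s n))
      (cong +_ (quotient-unique ∣ index 𝒞 d s ∣ _ (n C s) (C≢0 n s s≤n) (index-count s≤n bal)))

    balanced-passes : ∀ {s} → s ≤ n → Balanced 𝒞 d s → passes m s ≡ true
    balanced-passes {s} s≤n bal = remainder-multiple ∣ index 𝒞 d s ∣ _ (n C s) (index-count s≤n bal)

    β≡lam : ∀ b {s} → s ≤ n → Balanced 𝒞 d s → β 𝒞 d s b ≡ + (lam m s ℕ.* (wt b C s))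
    β≡lam b {s} s≤n bal = trans (β-balanced 𝒞 bal s≤n b)
      (trans (cong (_* + (wt b C s)) (index≡lam s≤n bal)) (sym (ℤ.pos-* (lam m s) (wt b C s))))

    weight-index : ∀ w → 4 ∣ w → d ≤ w → w ≤ n ∸ d → ∃[ j ] (j ≤ L × w ≡ d ℕ.+ j ℕ.* 4)
    weight-index w 4∣w d≤w w≤n-d = from (∣m+n∣m⇒∣n (≡.subst (4 ∣_) (sym d+e) 4∣w) 4∣d)
      where
      e = w ∸ d
      d+e : d ℕ.+ e ≡ w
      d+e = ℕ.m+[n∸m]≡n d≤w
      e≤4L : e ≤ L ℕ.* 4
      e≤4L = ℕ.+-cancelˡ-≤ d e (L ℕ.* 4) (≡.subst₂ _≤_ (sym d+e)
        (trans (cong (_∸ d) n≡d+d+4L) (ℕ.m+n∸m≡n d (d ℕ.+ L ℕ.* 4))) w≤n-d)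
      from : 4 ∣ e → ∃[ j ] (j ≤ L × w ≡ d ℕ.+ j ℕ.* 4)
      from (divides j eq) = j , ℕ.*-cancelʳ-≤ j L 4 (≡.subst (_≤ L ℕ.* 4) eq e≤4L) , trans (sym d+e) (cong (d ℕ.+_) eq)

    lower : ∀ {s} j → suc s ≤ 8 → Balanced 𝒞 (d ℕ.+ j ℕ.* 4) (suc s) → Balanced 𝒞 (d ℕ.+ j ℕ.* 4) s
    lower j s<8 = balanced-pred 𝒞 (ℕ.≤-trans s<8 8≤n) (ℕ.<-≤-trans s<8 (ℕ.≤-trans 8≤d (ℕ.m≤m+n d (j ℕ.* 4))))

    -- The proportionality makes `weighted` constant on 8-sets, although neither of its two terms
    -- need be constant; its value then follows from the sum over all 8-sets.
    module Average (p q : ℤ)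
      (proportional : ∀ T T′ → wt T ≡ 8 → wt T′ ≡ 8 → p * deviation T T′ 0 ≡ q * (β 𝒞 d 7 T - β 𝒞 d 7 T′)) where

      weighted : Word n → ℤ
      weighted T = p * B 𝒞 d T - q * β 𝒞 d 7 T

      weighted-constant : ∀ T T′ → wt T ≡ 8 → wt T′ ≡ 8 → weighted T ≡ weighted T′
      weighted-constant T T′ T≡ T′≡ = regroup p q (B 𝒞 d T) (B 𝒞 d T′) (β 𝒞 d 7 T) (β 𝒞 d 7 T′)
        (trans (cong (p *_) (sym (trans (deviation-B T T′ 0)
          (cong (λ w → B 𝒞 w T - B 𝒞 w T′) (ℕ.+-identityʳ d))))) (proportional T T′ T≡ T′≡))
        where
        regroup : ∀ a b x x′ y y′ → a * (x - x′) ≡ b * (y - y′) → a * x - b * y ≡ a * x′ - b * y′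
        regroup a b x x′ y y′ eq = ℤ.i-j≡0⇒i≡j (a * x - b * y) (a * x′ - b * y′)
          (trans (difference a b x x′ y y′) (trans (cong (_- b * (y - y′)) eq) (ℤ.+-inverseʳ (b * (y - y′)))))
          where
          difference : ∀ a b x x′ y y′ → (a * x - b * y) - (a * x′ - b * y′) ≡ a * (x - x′) - b * (y - y′)
          difference = solve-∀

      averaged : weighted (prefix 8 n) * + (n C 8) ≡
        (p * + (d C 8) - q * ((+ n - + 7) * + (d C 7))) * + count m
      averaged = begin
        weighted (prefix 8 n) * + (n C 8)
          ≡⟨ cong (λ x → weighted (prefix 8 n) * + (x C 8)) (∣⊤∣≡n n) ⟨
        weighted (prefix 8 n) * + (wt (⊤ {n}) C 8)
          ≡⟨ cong (weighted (prefix 8 n) *_) (sum-subsets-1 8 (⊤ {n})) ⟨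
        weighted (prefix 8 n) * Sumℤ.sum (subsets 8 (⊤ {n})) (λ _ → 1ℤ)
          ≡⟨ sum-All weighted (weighted (prefix 8 n)) (subsets-wt 8 (⊤ {n}))
               (λ T T≡ → weighted-constant T (prefix 8 n) T≡ (prefix-wt 8≤n)) ⟨
        Sumℤ.sum (subsets 8 (⊤ {n})) weighted
          ≡⟨ sum-difference p q (subsets 8 (⊤ {n})) (B 𝒞 d) (β 𝒞 d 7) ⟩
        p * Sumℤ.sum (subsets 8 (⊤ {n})) (B 𝒞 d) - q * Sumℤ.sum (subsets 8 (⊤ {n})) (β 𝒞 d 7)
          ≡⟨ cong₂ (λ x y → p * x - q * y)
               (trans (sym (β-subsets 𝒞 d 8 ⊤)) (trans (β-⊤ 𝒞 d 8) (cong (+ (d C 8) *_) A≡count))) sevens ⟩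
        p * (+ (d C 8) * + count m) - q * ((+ n - + 7) * (+ (d C 7) * + count m))
          ≡⟨ factor p q (+ (d C 8)) (+ n - + 7) (+ (d C 7)) (+ count m) ⟩
        (p * + (d C 8) - q * ((+ n - + 7) * + (d C 7))) * + count m ∎
        where
        open ≡.≡-Reasoning
        factor : ∀ a b x y z c → a * (x * c) - b * (y * (z * c)) ≡ (a * x - b * (y * z)) * c
        factor = solve-∀
        sum-difference : ∀ a b (xs : List (Word n)) (f g : Word n → ℤ) →
          Sumℤ.sum xs (λ x → a * f x - b * g x) ≡ a * Sumℤ.sum xs f - b * Sumℤ.sum xs g
        sum-difference a b xs f g = trans (Sumℤ.sum-cong xs (λ x → negate (a * f x) b (g x))) (trans
          (Sumℤ.sum-+ xs (λ x → a * f x) (λ x → - b * g x)) (trans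
          (cong₂ _+_ (Sumℤ.sum-*ˡ a xs f) (Sumℤ.sum-*ˡ (- b) xs g)) (sym (negate (a * Sumℤ.sum xs f) b (Sumℤ.sum xs g)))))
          where
          negate : ∀ x b y → x - b * y ≡ x + - b * y
          negate = solve-∀
        sevens : Sumℤ.sum (subsets 8 (⊤ {n})) (β 𝒞 d 7) ≡ (+ n - + 7) * (+ (d C 7) * + count m)
        sevens = trans (isolate _ (+ 7) (+ wt (⊤ {n})) (β 𝒞 d 7 ⊤) (sum-subsets-β 𝒞 d 7 ⊤))
          (cong₂ (λ x y → (+ x - + 7) * y) (∣⊤∣≡n n) (trans (β-⊤ 𝒞 d 7) (cong (+ (d C 7) *_) A≡count)))
          where
          isolate : ∀ s r w b → s + r * b ≡ w * b → s ≡ (w - r) * b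
          isolate s r w b eq = trans (add s (r * b)) (trans (cong (_- r * b) eq) (collect w r b))
            where
            add : ∀ s x → s ≡ s + x - x
            add = solve-∀
            collect : ∀ w r b → w * b - r * b ≡ (w - r) * b
            collect = solve-∀

    -- The design property is carried from one weight to the minimum weight size by size, since each
    -- deviation formula presupposes the smaller sizes there. At the minimum weight all parameters
    -- are explicit numbers.
    module Six (j : ℕ) (j≤L : j ≤ L) (bal₆ : Balanced 𝒞 (d ℕ.+ j ℕ.* 4) 6) where

      bal₅ : Balanced 𝒞 (d ℕ.+ j ℕ.* 4) 5
      bal₅ = lower j (ℕ.m≤m+n 6 2) bal₆

      bal₄ : Balanced 𝒞 (d ℕ.+ j ℕ.* 4) 4
      bal₄ = lower j (ℕ.m≤m+n 5 3) bal₅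

      min₄ : Balanced 𝒞 d 4
      min₄ = deviation⇒balanced 4 λ T T′ T≡ T′≡ →
        [ (λ c≡0 → contradiction c≡0 (signedC-top L j j≤L)) , (λ δ≡0 → δ≡0) ]′
        (ℤ.i*j≡0⇒i≡0∨j≡0 (signedC L j L) (trans (sym (deviation-four T T′ T≡ T′≡ j j≤L))
          (balanced⇒deviation j bal₄ T T′ T≡ T′≡)))

      min₅ : Balanced 𝒞 d 5
      min₅ = balanced-five min₄

      below₆ : ∀ s → s < 6 → Balanced 𝒞 d s
      below₆ = extend (extend balanced-below min₄) min₅

      passes₅ : passes m 5 ≡ true
      passes₅ = balanced-passes (ℕ.≤-trans (ℕ.m≤m+n 5 3) 8≤n) min₅

      -- Strength 5 at the minimum weight is obtained before the coefficient for six points is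
      -- inverted, so integrality at size 5 can already dispose of the one value of m where that
      -- coefficient may vanish.
      m≢4 : m ≢ 4
      m≢4 eq = true≢false passes₅ (cong (λ m → passes m 5) eq)

      coefficient₆≢0 : coefficient₆ L j ≢ 0ℤ
      coefficient₆≢0 eq = m≢4 (pell-sound m (L ∸ j) 1≤m m≤158 (ℕ.m∸n≤m L j)
        (equation (L ∸ 2) (ℕ.m+[n∸m]≡n (ℕ.≤-trans (ℕ.m≤m+n 2 2) 4≤L))))
        where
        equation : ∀ l → 2 ℕ.+ l ≡ L → L ℕ.* (L ∸ 1) ≡ 16 ℕ.* ((L ∸ j) ℕ.* (L ∸ (L ∸ j)))
        equation l 2+l≡L = ≡.subst (λ L → L ℕ.* (L ∸ 1) ≡ 16 ℕ.* ((L ∸ j) ℕ.* (L ∸ (L ∸ j)))) 2+l≡L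
          (coefficient₆-zero l j (≡.subst (j ≤_) (sym 2+l≡L) j≤L)
            (≡.subst (λ L → coefficient₆ L j ≡ 0ℤ) (sym 2+l≡L) eq))

      min₆ : Balanced 𝒞 d 6
      min₆ = deviation⇒balanced 6 λ T T′ T≡ T′≡ →
        [ (λ c≡0 → contradiction c≡0 coefficient₆≢0) , (λ δ≡0 → δ≡0) ]′
        (ℤ.i*j≡0⇒i≡0∨j≡0 (coefficient₆ L j) (trans (sym (deviation-six T T′ below₆ T≡ T′≡ j j≤L))
          (balanced⇒deviation j bal₆ T T′ T≡ T′≡)))

      below₇ : ∀ s → s < 7 → Balanced 𝒞 d s
      below₇ = extend below₆ min₆

      passes₆ : passes m 6 ≡ true
      passes₆ = balanced-passes (ℕ.≤-trans (ℕ.m≤m+n 6 2) 8≤n) min₆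

      candidates : m ≡ 20 ⊎ m ≡ 58 ⊎ m ≡ 90 ⊎ m ≡ 113
      candidates = sieve-sound m 1≤m m≤158 passes₅ passes₆

      b : Word n
      b = proj₁ (proj₁ min-weight)

      b∈ : b ∈C 𝒞
      b∈ = proj₁ (proj₂ (proj₁ min-weight))

      wt-b : wt b ≡ d
      wt-b = proj₂ (proj₂ (proj₂ (proj₁ min-weight)))

      even : ∀ {x} → x ∈C 𝒞 → ∀ c → c ∈C 𝒞 → wt c ≡ d → odd (wt (x ∩ c)) ≡ false
      even x∈ c c∈ _ = meet-even 𝒞 linear selfDual doublyEven x∈ c∈

      β₆ : ∀ x s → s < 7 → β 𝒞 d s x ≡ + (lam m s ℕ.* (wt x C s))
      β₆ x s s<7 = β≡lam x {s} (ℕ.≤-trans (ℕ.<⇒≤ s<7) (ℕ.≤-trans (ℕ.n≤1+n 7) 8≤n)) (below₇ s s<7)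

      -- Any codeword may be used, not only one of minimum weight: strength 6 determines its moments
      -- up to order 6 from its weight.
      divisible₂ : ∀ {x} → x ∈C 𝒞 → divides₂ m (wt x) ≡ true
      divisible₂ {x} x∈ = remainder-multiple ∣ K ∣ _ 1024 (abs-multiple K _ 1024 (trans (ℤ.*-comm K (+ 1024))
        (trans (sym (proj₂ meets₂)) values)))
        where
        meets₂ = even-meets 𝒞 d x (even x∈)
        K = proj₁ meets₂
        values : alternating₂ (λ s → β 𝒞 d s x) ≡ alternating₂ (λ s → + (lam m s ℕ.* (wt x C s)))
        values = alternating₂-cong (λ s s≤6 → β₆ x s (s≤s s≤6))

      divisible₄ : (∀ c → c ∈C 𝒞 → wt c ≡ d → odd (half (wt (b ∩ c))) ≡ false) → divides₄ m ≡ true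
      divisible₄ even′ = remainder-multiple ∣ proj₁ meets₄ ∣ ∣ alternating₄ g ∣ (64 ℕ.* 1024)
        (abs-multiple₂ (proj₁ meets₄) (alternating₄ g) 64 1024
          (trans (sym (alternating₄-cong {f} {g} values)) (proj₂ meets₄)))
        where
        meets₄ = quarter-meets 𝒞 d b (even b∈) even′
        f g : ℕ → ℤ
        f s = β 𝒞 d s b
        g s = + (lam m s ℕ.* (d C s))
        values : ∀ s → s ≤ 6 → f s ≡ g s
        values s s≤6 = trans (β₆ b s (s≤s s≤6)) (cong (λ w → + (lam m s ℕ.* (w C s))) wt-b)

      m≢20 : m ≢ 20
      m≢20 eq = true≢false (divisible₂ b∈) (trans (cong₂ divides₂ eq (trans wt-b (cong dist eq))) divides₂-20)

      m≢90 : m ≢ 90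
      m≢90 eq = true≢false (divisible₂ b∈) (trans (cong₂ divides₂ eq (trans wt-b (cong dist eq))) divides₂-90)

      -- Either all codewords of weight d meet b in a multiple of 4 points, or some b ⊕ c has weight 4 modulo 8.
      m≢113 : m ≢ 113
      m≢113 eq = true≢false (divisible₄ even′) (trans (cong divides₄ eq) divides₄-113)
        where
        even′ : ∀ c → c ∈C 𝒞 → wt c ≡ d → odd (half (wt (b ∩ c))) ≡ false
        even′ c c∈ wt-c = decide (odd (half (wt (b ∩ c)))) refl
          where
          h = half (half (wt (b ∩ c)))
          decide : ∀ x → odd (half (wt (b ∩ c))) ≡ x → odd (half (wt (b ∩ c))) ≡ false
          decide false eq′ = eq′
          decide true  eq′ = ⊥-elim (true≢false (divisible₂ (proj₂ linear b c b∈ c∈))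
            (trans (cong₂ divides₂ eq (weight-of-sum (wt (b ⊕ c)) h sum-of-weights)) (divides₂-113-false h (h-bound h bounded))))
            where
            j≡ : wt (b ∩ c) ≡ 2 ℕ.+ 4 ℕ.* h
            j≡ = two-mod-four (wt (b ∩ c)) (even b∈ c c∈ wt-c) eq′
            bounded : 2 ℕ.+ 4 ℕ.* h ≤ dist 113
            bounded = ≡.subst₂ _≤_ j≡ (trans wt-b (cong dist eq)) (∣p∩q∣≤∣p∣ b c)
            sum-of-weights : wt (b ⊕ c) ℕ.+ double (2 ℕ.+ 4 ℕ.* h) ≡ dist 113 ℕ.+ dist 113
            sum-of-weights = trans (cong (λ j → wt (b ⊕ c) ℕ.+ double j) (sym j≡))
              (trans (wt-⊕ 𝒞 b c) (cong₂ ℕ._+_ (trans wt-b (cong dist eq)) (trans wt-c (cong dist eq))))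

      m≡58 : m ≡ 58
      m≡58 = [ (λ eq → contradiction eq m≢20) , [ (λ eq → eq) ,
        [ (λ eq → contradiction eq m≢90) , (λ eq → contradiction eq m≢113) ]′ ]′ ]′ candidates

      L≡232 : L ≡ 232
      L≡232 = ≡.subst (λ x → x ℕ.* 4 ≡ 232) (sym m≡58) refl

      -- The coefficient is zero, so the deviation on 7-sets vanishes at this weight whatever it is
      -- at the minimum weight.
      balanced-middle : j ≡ 116 → Balanced 𝒞 (d ℕ.+ j ℕ.* 4) 7
      balanced-middle j≡116 T T′ T≡ T′≡ = ℤ.i-j≡0⇒i≡j (B 𝒞 (d ℕ.+ j ℕ.* 4) T) (B 𝒞 (d ℕ.+ j ℕ.* 4) T′) (begin
        B 𝒞 (d ℕ.+ j ℕ.* 4) T - B 𝒞 (d ℕ.+ j ℕ.* 4) T′    ≡⟨ deviation-B T T′ j ⟨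
        deviation T T′ j                                      ≡⟨ deviation-seven T T′ below₇ T≡ T′≡ j j≤L ⟩
        coefficient₇ L j * deviation T T′ 0                 ≡⟨ cong (_* deviation T T′ 0)
                                                                   (trans (cong₂ coefficient₇ L≡232 j≡116) coefficient₇-middle) ⟩
        0ℤ ∎)
        where open ≡.≡-Reasoning

    module Eight (j : ℕ) (j≤L : j ≤ L) (bal₈ : Balanced 𝒞 (d ℕ.+ j ℕ.* 4) 8) where

      bal₇ : Balanced 𝒞 (d ℕ.+ j ℕ.* 4) 7
      bal₇ = lower j ℕ.≤-refl bal₈

      open Six j j≤L (lower j (ℕ.n≤1+n 7) bal₇)

      ξ : Word n → Word n → ℤ
      ξ T T′ = β 𝒞 d 7 T - β 𝒞 d 7 T′

      equation : ∀ T T′ → wt T ≡ 8 → wt T′ ≡ 8 →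
        coefficient₈ L j * deviation T T′ 0 + correction₈ L j * ξ T T′ ≡ 0ℤ
      equation T T′ T≡ T′≡ = trans (sym (deviation-eight T T′ below₇ T≡ T′≡ j j≤L)) (balanced⇒deviation j bal₈ T T′ T≡ T′≡)

      -- Away from the middle the coefficient for seven points is nonzero, so strength 7 does
      -- descend to the minimum weight.
      min₇ : j ≢ 116 → Balanced 𝒞 d 7
      min₇ j≢116 = deviation⇒balanced 7 λ T T′ T≡ T′≡ →
        [ (λ c≡0 → contradiction c≡0 (coefficient₇≢0 L j L≡232 j≤L j≢116)) , (λ δ≡0 → δ≡0) ]′
        (ℤ.i*j≡0⇒i≡0∨j≡0 (coefficient₇ L j) (trans (sym (deviation-seven T T′ below₇ T≡ T′≡ j j≤L))
          (balanced⇒deviation j bal₇ T T′ T≡ T′≡)))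

      -- At the middle weight the 8-design equation itself is this relation. Elsewhere strength 7
      -- gives ξ = 0 and the equation then makes the deviation zero, so the relation holds trivially
      -- and one contradiction serves both cases.
      proportional : ∀ T T′ → wt T ≡ 8 → wt T′ ≡ 8 → + 1386 * deviation T T′ 0 ≡ + 229 * ξ T T′
      proportional T T′ T≡ T′≡ = by-cases (j ℕ.≟ 116)
        where
        c₈≢0 : coefficient₈ L j ≢ 0ℤ
        c₈≢0 = coefficient₈≢0 L j L≡232 j≤L
        by-cases : Dec (j ≡ 116) → + 1386 * deviation T T′ 0 ≡ + 229 * ξ T T′
        by-cases (yes j≡116) = eliminate (coefficient₈ L j) (correction₈ L j) (deviation T T′ 0) (ξ T T′) (+ 1386) (+ 229)
          c₈≢0 (equation T T′ T≡ T′≡) (middle-relation L j L≡232 j≡116)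
        by-cases (no j≢116) = both-zero (+ 1386) (+ 229)
          (zero-deviation (coefficient₈ L j) (correction₈ L j) (deviation T T′ 0) (ξ T T′) c₈≢0 ξ≡0 (equation T T′ T≡ T′≡)) ξ≡0
          where
          ξ≡0 : ξ T T′ ≡ 0ℤ
          ξ≡0 = trans (cong (_- β 𝒞 d 7 T′) (β-same (ℕ.≤-trans (ℕ.n≤1+n 7) 8≤n) (min₇ j≢116) T T′ T≡ T′≡)) (ℤ.+-inverseʳ (β 𝒞 d 7 T′))

      impossible : ⊥
      impossible = true≢false (remainder-multiple ∣ weighted (prefix 8 n) ∣ ∣ total-weight ∣ (n C 8)
          (abs-multiple (weighted (prefix 8 n)) total-weight (n C 8) averaged))
        (trans (cong eight m≡58) eight-58)
        where
        open Average (+ 1386) (+ 229) proportional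
        total-weight = (+ 1386 * + (d C 8) - + 229 * ((+ n - + 7) * + (d C 7))) * + count m

    6-design⇒m≡58 : ∀ w → 4 ∣ w → d ≤ w → w ≤ n ∸ d → IsDesign 6 𝒞 w → m ≡ 58
    6-design⇒m≡58 w 4∣w d≤w w≤n-d design = from (weight-index w 4∣w d≤w w≤n-d)
      where
      from : ∃[ j ] (j ≤ L × w ≡ d ℕ.+ j ℕ.* 4) → m ≡ 58
      from (j , j≤L , w≡) = Six.m≡58 j j≤L (≡.subst (λ w → Balanced 𝒞 w 6) w≡ (design⇒balanced 𝒞 design))

    7-design⇒m≡58 : ∀ w → 4 ∣ w → d ≤ w → w ≤ n ∸ d → IsDesign 7 𝒞 w → m ≡ 58
    7-design⇒m≡58 w 4∣w d≤w w≤n-d design = from (weight-index w 4∣w d≤w w≤n-d)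
      where
      from : ∃[ j ] (j ≤ L × w ≡ d ℕ.+ j ℕ.* 4) → m ≡ 58
      from (j , j≤L , w≡) = Six.m≡58 j j≤L (lower j (ℕ.n≤1+n 7) (≡.subst (λ w → Balanced 𝒞 w 7) w≡ (design⇒balanced 𝒞 design)))

    middle-6-design : IsDesign 6 𝒞 (12 ℕ.* m ℕ.+ 4) → IsDesign 7 𝒞 (12 ℕ.* m ℕ.+ 4) × m ≡ 58
    middle-6-design design = balanced⇒design 𝒞 (ℕ.≤-trans (ℕ.n≤1+n 7) 8≤n) (≡.subst (λ w → Balanced 𝒞 w 7) (sym w≡)
        (balanced-middle (≡.subst (λ x → 2 ℕ.* x ≡ 116) (sym m≡58) refl))) , m≡58
      where
      w≡ : 12 ℕ.* m ℕ.+ 4 ≡ d ℕ.+ (2 ℕ.* m) ℕ.* 4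
      w≡ = lemma m
        where
        lemma : ∀ m → 12 ℕ.* m ℕ.+ 4 ≡ (4 ℕ.* m ℕ.+ 4) ℕ.+ (2 ℕ.* m) ℕ.* 4
        lemma = solveℕ-∀
      2m≤L : 2 ℕ.* m ≤ L
      2m≤L = ≡.subst (2 ℕ.* m ≤_) (ℕ.*-comm 4 m) (ℕ.*-monoˡ-≤ m (ℕ.m≤m+n 2 2))
      open Six (2 ℕ.* m) 2m≤L (≡.subst (λ w → Balanced 𝒞 w 6) w≡ (design⇒balanced 𝒞 design))

    no-8-design : ∀ w → 4 ∣ w → d ≤ w → w ≤ n ∸ d → ¬ IsDesign 8 𝒞 w
    no-8-design w 4∣w d≤w w≤n-d design = from (weight-index w 4∣w d≤w w≤n-d)
      where
      from : ∃[ j ] (j ≤ L × w ≡ d ℕ.+ j ℕ.* 4) → ⊥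
      from (j , j≤L , w≡) = Eight.impossible j j≤L (≡.subst (λ w → Balanced 𝒞 w 8) w≡ (design⇒balanced 𝒞 design))

-- The result for extremal codes of length 24m + 8.

open import Data.Nat using (ℕ; _+_; _*_; _∸_; _≤_)
open import Data.Nat.Divisibility using (_∣_)
open import Data.Product using (_×_; _,_)
open import Relation.Binary.PropositionalEquality using (_≡_; _≢_; subst)
open import Relation.Nullary using (¬_)
open Main

theorem3p5 : (m : ℕ) → 1 ≤ m → m ≤ 158 →
    (C : Code (24 * m + 8)) → IsDESD C → IsExtremal C →
    ((w : ℕ) → 4 ∣ w → 4 * m + 4 ≤ w → w ≤ (24 * m + 8) ∸ (4 * m + 4) → w ≢ 12 * m + 4 →
    (IsDesign 6 C w → m ≡ 58) × (IsDesign 7 C w → m ≡ 58))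
    × (IsDesign 6 C (12 * m + 4) → IsDesign 7 C (12 * m + 4) × m ≡ 58)
    × ((w : ℕ) → 4 ∣ w → 4 * m + 4 ≤ w → w ≤ (24 * m + 8) ∸ (4 * m + 4) → ¬ IsDesign 8 C w)
theorem3p5 m 1≤m m≤158 C desd extremal =
    (λ w 4∣w d≤w w≤n-d _ → 6-design⇒m≡58 w 4∣w d≤w w≤n-d , 7-design⇒m≡58 w 4∣w d≤w w≤n-d)
  , middle-6-design
  , no-8-design
  where
  open Theorem m 1≤m m≤158 C desd (subst (λ q → MinWeight C (4 * q + 4)) (length/24 m) extremal)
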